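{- Let $G$ be a finite group, and let $f:G \to \{\pm 1\}$ be a function with $\mathbb{E}_{x \in G} f(x) = 0$. Then \[ \Pr_{x,y}\,[f(x)f(y) = f(xy)] \le \frac{1}{2}\left(1 + \frac{1}{\sqrt{d}}\right), \] where $x,y$ are chosen uniformly and independently from $G$, and $d = \min_{\rho \ne 1} d_\rho$ is the minimum dimension of a nontrivial irreducible (complex) representation $\rho$ of $G$.
   Context: $d_\rho$ denotes the dimension of the representation $\rho$; the minimum is over nontrivial irreducible complex representations of $G$. $\mathbb{E}$ denotes the average over the uniform distribution on $G$. -}

module Defs where

open import Algebra.Bundles using (Group)
open import Algebra.Bundles.Raw using (RawMonoid)
import Algebra.Definitions.RawMonoid as RawMonoidDefinitions
open import Algebra.Morphism.Structures using (IsMonoidHomomorphism)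
open import Data.Bool.Base using (if_then_else_)
open import Data.Empty using (⊥-elim)
open import Data.Fin.Base using (Fin)
import Data.Fin.Properties as Fin
open import Data.Integer.Base as ℤ using (+_)
import Data.Integer.Properties as ℤ
open import Data.Nat.Base as ℕ using (ℕ; zero; suc; NonZero)
import Data.Nat.Properties as ℕ
import Data.Nat.Solver as ℕ
open import Data.Product.Base using (∃; _×_; _,_)
open import Data.Rational.Base as ℚ using (ℚ; 0ℚ; 1ℚ; mkℚ)
import Data.Rational.Properties as ℚ
import Data.Rational.Solver as ℚ
open import Data.Rational.Unnormalised.Base as ℚᵘ using (mkℚᵘ)
import Data.Rational.Unnormalised.Properties as ℚᵘ
open import Data.Sign.Base as Sign using (Sign)
open import Data.Sum.Base using (inj₁; inj₂)
open import Data.Vec.Functional using (Vector)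
open import Function.Bundles using (Inverse)
open import Level using (Level; _⊔_) renaming (suc to lsuc)
open import Relation.Binary.PropositionalEquality.Core
  using (_≡_; refl; sym; trans; cong; cong₂; subst; subst₂)
import Relation.Binary.PropositionalEquality.Properties as ≡
open import Relation.Nullary.Decidable.Core using (Dec; does; yes; no)
open import Relation.Nullary.Negation.Core using (¬_)

private

  ∣p∣≤q : ∀ {p q} → p ℚ.≤ q → ℚ.- p ℚ.≤ q → ℚ.∣ p ∣ ℚ.≤ q
  ∣p∣≤q {p} p≤q -p≤q with ℚ.∣p∣≡p∨∣p∣≡-p p
  ... | inj₁ eq = subst (ℚ._≤ _) (sym eq) p≤q
  ... | inj₂ eq = subst (ℚ._≤ _) (sym eq) -p≤q

  *-mono-≤ : ∀ {p q r s} → 0ℚ ℚ.≤ q → 0ℚ ℚ.≤ r →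
             p ℚ.≤ q → r ℚ.≤ s → p ℚ.* r ℚ.≤ q ℚ.* s
  *-mono-≤ {p} {q} {r} {s} 0≤q 0≤r p≤q r≤s = ℚ.≤-trans
    (ℚ.*-monoʳ-≤-nonNeg r {{ℚ.nonNegative 0≤r}} p≤q)
    (ℚ.*-monoˡ-≤-nonNeg q {{ℚ.nonNegative 0≤q}} r≤s)

  *-pos : ∀ {p q} → 0ℚ ℚ.< p → 0ℚ ℚ.< q → 0ℚ ℚ.< p ℚ.* q
  *-pos {p} {q} 0<p 0<q = ℚ.positive⁻¹ _
    {{ℚ.pos*pos⇒pos p {{ℚ.positive 0<p}} q {{ℚ.positive 0<q}}}}

  0<½ : 0ℚ ℚ.< ℚ.½
  0<½ = ℚ.positive⁻¹ ℚ.½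

  ½p+½p≡p : ∀ p → ℚ.½ ℚ.* p ℚ.+ ℚ.½ ℚ.* p ≡ p
  ½p+½p≡p p = trans (sym (ℚ.*-distribʳ-+ p ℚ.½ ℚ.½)) (ℚ.*-identityˡ p)

  toℚᵘ-/ : ∀ i n → ℚ.toℚᵘ (i ℚ./ suc n) ℚᵘ.≃ mkℚᵘ i n
  toℚᵘ-/ i n = ℚ.toℚᵘ-fromℚᵘ (mkℚᵘ i n)

  /-mono-≤ : ∀ i j m n → i ℤ.* + suc n ℤ.≤ j ℤ.* + suc m → i ℚ./ suc m ℚ.≤ j ℚ./ suc n
  /-mono-≤ i j m n le = ℚ.toℚᵘ-cancel-≤
    (ℚᵘ.≤-trans (ℚᵘ.≤-reflexive (toℚᵘ-/ i m))
    (ℚᵘ.≤-trans (ℚᵘ.*≤* le)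
                (ℚᵘ.≤-reflexive (ℚᵘ.≃-sym (toℚᵘ-/ j n)))))

  /-distrib-+ : ∀ a b n → + (a ℕ.+ b) ℚ./ suc n ≡ (+ a ℚ./ suc n) ℚ.+ (+ b ℚ./ suc n)
  /-distrib-+ a b n = ℚ.toℚᵘ-injective
    (ℚᵘ.≃-trans (toℚᵘ-/ (+ (a ℕ.+ b)) n)
    (ℚᵘ.≃-trans {j = mkℚᵘ (+ a) n ℚᵘ.+ mkℚᵘ (+ b) n} (ℚᵘ.*≡* eq)
    (ℚᵘ.≃-trans (ℚᵘ.≃-sym (ℚᵘ.+-cong (toℚᵘ-/ (+ a) n) (toℚᵘ-/ (+ b) n)))
                (ℚᵘ.≃-sym (ℚ.toℚᵘ-homo-+ (+ a ℚ./ suc n) (+ b ℚ./ suc n))))))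
    where
    N = + suc n
    eq : + (a ℕ.+ b) ℤ.* (N ℤ.* N) ≡ (+ a ℤ.* N ℤ.+ + b ℤ.* N) ℤ.* N
    eq = trans (sym (ℤ.*-assoc (+ (a ℕ.+ b)) N N))
               (cong (ℤ._* N) (ℤ.*-distribʳ-+ N (+ a) (+ b)))

  archimedean : ∀ ε → 0ℚ ℚ.< ε → ∃ λ N → + 1 ℚ./ suc N ℚ.≤ ε
  archimedean ε@(mkℚ (+ zero) _ _) 0<ε with () ← ℚ.positive 0<ε
  archimedean ε@(mkℚ (ℤ.-[1+ _ ]) _ _) 0<ε with () ← ℚ.positive 0<ε
  archimedean ε@(mkℚ (+ suc a) d _) 0<ε = d , subst (+ 1 ℚ./ suc d ℚ.≤_) (ℚ.↥p/↧p≡p ε)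
    (/-mono-≤ (+ 1) (+ suc a) d d
      (ℤ.*-monoʳ-≤-nonNeg (+ suc d) (ℤ.+≤+ {1} {suc a} (ℕ.s≤s ℕ.z≤n))))

Eventually : (ℕ → Set) → Set
Eventually P = ∃ λ N → ∀ n → N ℕ.≤ n → P n

-- Reals are Cauchy sequences of rationals, compared by _≈ℝ_ rather than _≡_.
record ℝ : Set where
  constructor mkℝ
  field
    seq    : ℕ → ℚ
    cauchy : ∀ ε → 0ℚ ℚ.< ε →
             ∃ λ N → ∀ m n → N ℕ.≤ m → N ℕ.≤ n → ℚ.∣ seq m ℚ.- seq n ∣ ℚ.≤ ε

open ℝ public

infix 4 _≈ℝ_ _≤ℝ_

record _≈ℝ_ (x y : ℝ) : Set where
  constructor mk≈
  field
    close : ∀ ε → 0ℚ ℚ.< ε → Eventually λ n → ℚ.∣ seq x n ℚ.- seq y n ∣ ℚ.≤ ε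

record _≤ℝ_ (x y : ℝ) : Set where
  constructor mk≤
  field
    below : ∀ ε → 0ℚ ℚ.< ε → Eventually λ n → seq x n ℚ.≤ seq y n ℚ.+ ε

record Positiveℝ (x : ℝ) : Set where
  constructor mkPos
  field
    bound      : ℚ
    0<bound    : 0ℚ ℚ.< bound
    eventually : Eventually λ n → bound ℚ.≤ seq x n

fromℚ : ℚ → ℝ
fromℚ q = mkℝ (λ _ → q) λ ε 0<ε → 0 , λ _ _ _ _ →
  subst (ℚ._≤ ε) (sym (cong ℚ.∣_∣ (ℚ.+-inverseʳ q))) (ℚ.<⇒≤ 0<ε)

0ℝ 1ℝ : ℝ
0ℝ = fromℚ 0ℚ
1ℝ = fromℚ 1ℚ

infixl 6 _+ℝ_ _-ℝ_
infixl 7 _*ℝ_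
infix  8 -ℝ_

_+ℝ_ : ℝ → ℝ → ℝ
seq    (x +ℝ y) n = seq x n ℚ.+ seq y n
cauchy (x +ℝ y) ε 0<ε
  with cauchy x (ℚ.½ ℚ.* ε) (*-pos 0<½ 0<ε) | cauchy y (ℚ.½ ℚ.* ε) (*-pos 0<½ 0<ε)
... | M , p | N , q = M ℕ.⊔ N , λ m n m≥ n≥ → begin
  ℚ.∣ (seq x m ℚ.+ seq y m) ℚ.- (seq x n ℚ.+ seq y n) ∣
    ≡⟨ cong ℚ.∣_∣ (solve 4 (λ a b c d → (a :+ b) :- (c :+ d) := (a :- c) :+ (b :- d))
         refl (seq x m) (seq y m) (seq x n) (seq y n)) ⟩
  ℚ.∣ (seq x m ℚ.- seq x n) ℚ.+ (seq y m ℚ.- seq y n) ∣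
    ≤⟨ ℚ.∣p+q∣≤∣p∣+∣q∣ (seq x m ℚ.- seq x n) (seq y m ℚ.- seq y n) ⟩
  ℚ.∣ seq x m ℚ.- seq x n ∣ ℚ.+ ℚ.∣ seq y m ℚ.- seq y n ∣
    ≤⟨ ℚ.+-mono-≤ (p m n (ℕ.m⊔n≤o⇒m≤o M N m≥) (ℕ.m⊔n≤o⇒m≤o M N n≥))
                  (q m n (ℕ.m⊔n≤o⇒n≤o M N m≥) (ℕ.m⊔n≤o⇒n≤o M N n≥)) ⟩
  ℚ.½ ℚ.* ε ℚ.+ ℚ.½ ℚ.* ε
    ≡⟨ ½p+½p≡p ε ⟩
  ε ∎
  where
  open ℚ.≤-Reasoning
  open ℚ.+-*-Solver

-ℝ_ : ℝ → ℝ
seq    (-ℝ x) n = ℚ.- seq x n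
cauchy (-ℝ x) ε 0<ε with cauchy x ε 0<ε
... | N , p = N , λ m n m≥ n≥ → subst (ℚ._≤ ε)
  (trans (sym (ℚ.∣-p∣≡∣p∣ (seq x m ℚ.- seq x n)))
         (cong ℚ.∣_∣ (ℚ.neg-distrib-+ (seq x m) (ℚ.- seq x n))))
  (p m n m≥ n≥)

_-ℝ_ : ℝ → ℝ → ℝ
x -ℝ y = x +ℝ (-ℝ y)

eventuallyBounded : ∀ x → ∃ λ K → 0ℚ ℚ.< K × Eventually λ n → ℚ.∣ seq x n ∣ ℚ.≤ K
eventuallyBounded x with cauchy x 1ℚ (ℚ.positive⁻¹ 1ℚ)
... | N , p = 1ℚ ℚ.+ ℚ.∣ seq x N ∣ , 0<K , N , λ n n≥ → begin
  ℚ.∣ seq x n ∣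
    ≡⟨ cong ℚ.∣_∣ (solve 2 (λ a b → a := (a :- b) :+ b) refl (seq x n) (seq x N)) ⟩
  ℚ.∣ (seq x n ℚ.- seq x N) ℚ.+ seq x N ∣
    ≤⟨ ℚ.∣p+q∣≤∣p∣+∣q∣ (seq x n ℚ.- seq x N) (seq x N) ⟩
  ℚ.∣ seq x n ℚ.- seq x N ∣ ℚ.+ ℚ.∣ seq x N ∣
    ≤⟨ ℚ.+-monoˡ-≤ ℚ.∣ seq x N ∣ (p n N n≥ ℕ.≤-refl) ⟩
  1ℚ ℚ.+ ℚ.∣ seq x N ∣ ∎
  where
  open ℚ.≤-Reasoning
  open ℚ.+-*-Solver
  0<K : 0ℚ ℚ.< 1ℚ ℚ.+ ℚ.∣ seq x N ∣
  0<K = ℚ.positive⁻¹ _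
    {{ℚ.pos+nonNeg⇒pos 1ℚ ℚ.∣ seq x N ∣ {{ℚ.∣-∣-nonNeg (seq x N)}}}}

private

  ab-cd : ∀ a b c d → a ℚ.* b ℚ.- c ℚ.* d ≡ (a ℚ.- c) ℚ.* b ℚ.+ (b ℚ.- d) ℚ.* c
  ab-cd = solve 4 (λ a b c d → a :* b :- c :* d := (a :- c) :* b :+ (b :- d) :* c) refl
    where open ℚ.+-*-Solver

  divide : ∀ ε {C} → 0ℚ ℚ.< C → ℚ
  divide ε {C} 0<C = ε ℚ.* (ℚ.1/ C) {{ℚ.>-nonZero 0<C}}

  divide-pos : ∀ ε {C} → 0ℚ ℚ.< ε → (0<C : 0ℚ ℚ.< C) → 0ℚ ℚ.< divide ε 0<C
  divide-pos ε {C} 0<ε 0<C =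
    *-pos 0<ε (ℚ.positive⁻¹ _ {{ℚ.1/pos⇒pos C {{ℚ.positive 0<C}}}})

  divide-* : ∀ ε {C} (0<C : 0ℚ ℚ.< C) → divide ε 0<C ℚ.* C ≡ ε
  divide-* ε {C} 0<C = trans (ℚ.*-assoc ε _ C)
    (trans (cong (ε ℚ.*_) (ℚ.*-inverseˡ C {{ℚ.>-nonZero 0<C}})) (ℚ.*-identityʳ ε))

  ∣u*v∣≤ : ∀ ε {C u v} (0<C : 0ℚ ℚ.< C) → ℚ.∣ u ∣ ℚ.≤ divide ε 0<C → ℚ.∣ v ∣ ℚ.≤ C →
           ℚ.∣ u ℚ.* v ∣ ℚ.≤ ε
  ∣u*v∣≤ ε {C} {u} {v} 0<C hu hv = begin
    ℚ.∣ u ℚ.* v ∣        ≡⟨ ℚ.∣p*q∣≡∣p∣*∣q∣ u v ⟩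
    ℚ.∣ u ∣ ℚ.* ℚ.∣ v ∣  ≤⟨ *-mono-≤ (ℚ.≤-trans (ℚ.0≤∣p∣ u) hu) (ℚ.0≤∣p∣ v) hu hv ⟩
    divide ε 0<C ℚ.* C   ≡⟨ divide-* ε 0<C ⟩
    ε                    ∎
    where open ℚ.≤-Reasoning

  *-cauchy : ∀ x y ε → 0ℚ ℚ.< ε → ∃ λ N → ∀ m n → N ℕ.≤ m → N ℕ.≤ n →
             ℚ.∣ seq x m ℚ.* seq y m ℚ.- seq x n ℚ.* seq y n ∣ ℚ.≤ ε
  *-cauchy x y ε 0<ε =
    let K , 0<K , A , ∣x∣≤K = eventuallyBounded x
        L , 0<L , B , ∣y∣≤L = eventuallyBounded y
        ½ε = ℚ.½ ℚ.* ε
        0<½ε = *-pos 0<½ 0<ε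
        M , p = cauchy x (divide ½ε 0<L) (divide-pos ½ε 0<½ε 0<L)
        N , q = cauchy y (divide ½ε 0<K) (divide-pos ½ε 0<½ε 0<K)
    in (A ℕ.⊔ B) ℕ.⊔ (M ℕ.⊔ N) , λ m n m≥ n≥ →
    let A⊔B≤m = ℕ.m⊔n≤o⇒m≤o (A ℕ.⊔ B) (M ℕ.⊔ N) m≥
        A⊔B≤n = ℕ.m⊔n≤o⇒m≤o (A ℕ.⊔ B) (M ℕ.⊔ N) n≥
        M⊔N≤m = ℕ.m⊔n≤o⇒n≤o (A ℕ.⊔ B) (M ℕ.⊔ N) m≥
        M⊔N≤n = ℕ.m⊔n≤o⇒n≤o (A ℕ.⊔ B) (M ℕ.⊔ N) n≥
    in combine (seq x m) (seq y m) (seq x n) (seq y n)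
         (∣u*v∣≤ ½ε 0<L (p m n (ℕ.m⊔n≤o⇒m≤o M N M⊔N≤m) (ℕ.m⊔n≤o⇒m≤o M N M⊔N≤n))
                        (∣y∣≤L m (ℕ.m⊔n≤o⇒n≤o A B A⊔B≤m)))
         (∣u*v∣≤ ½ε 0<K (q m n (ℕ.m⊔n≤o⇒n≤o M N M⊔N≤m) (ℕ.m⊔n≤o⇒n≤o M N M⊔N≤n))
                        (∣x∣≤K n (ℕ.m⊔n≤o⇒m≤o A B A⊔B≤n)))
    where
    open ℚ.≤-Reasoning
    combine : ∀ a b c d → ℚ.∣ (a ℚ.- c) ℚ.* b ∣ ℚ.≤ ℚ.½ ℚ.* ε →
              ℚ.∣ (b ℚ.- d) ℚ.* c ∣ ℚ.≤ ℚ.½ ℚ.* ε → ℚ.∣ a ℚ.* b ℚ.- c ℚ.* d ∣ ℚ.≤ ε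
    combine a b c d h₁ h₂ = begin
      ℚ.∣ a ℚ.* b ℚ.- c ℚ.* d ∣                        ≡⟨ cong ℚ.∣_∣ (ab-cd a b c d) ⟩
      ℚ.∣ (a ℚ.- c) ℚ.* b ℚ.+ (b ℚ.- d) ℚ.* c ∣        ≤⟨ ℚ.∣p+q∣≤∣p∣+∣q∣ ((a ℚ.- c) ℚ.* b) ((b ℚ.- d) ℚ.* c) ⟩
      ℚ.∣ (a ℚ.- c) ℚ.* b ∣ ℚ.+ ℚ.∣ (b ℚ.- d) ℚ.* c ∣  ≤⟨ ℚ.+-mono-≤ h₁ h₂ ⟩
      ℚ.½ ℚ.* ε ℚ.+ ℚ.½ ℚ.* ε                          ≡⟨ ½p+½p≡p ε ⟩
      ε                                                ∎

_*ℝ_ : ℝ → ℝ → ℝ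
seq    (x *ℝ y) n = seq x n ℚ.* seq y n
cauchy (x *ℝ y)   = *-cauchy x y

-- 0 ↦ 0 is a junk value: a positive real may still have zeros among the
-- early terms of its sequence.
invℚ : ℚ → ℚ
invℚ p with p ℚ.≟ 0ℚ
... | yes _   = 0ℚ
... | no  p≢0 = (ℚ.1/ p) {{ℚ.≢-nonZero p≢0}}

invℚ-inverse : ∀ {p} → 0ℚ ℚ.< p → invℚ p ℚ.* p ≡ 1ℚ
invℚ-inverse {p} 0<p with p ℚ.≟ 0ℚ
... | yes p≡0 = ⊥-elim (ℚ.<-irrefl (sym p≡0) 0<p)
... | no  p≢0 = ℚ.*-inverseˡ p {{ℚ.≢-nonZero p≢0}}

invℚ-nonNeg : ∀ {p} → 0ℚ ℚ.< p → 0ℚ ℚ.≤ invℚ p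
invℚ-nonNeg {p} 0<p with p ℚ.≟ 0ℚ
... | yes _   = ℚ.≤-refl
... | no  p≢0 = ℚ.<⇒≤ (ℚ.positive⁻¹ _ {{ℚ.1/pos⇒pos p {{ℚ.positive 0<p}}}})

private

  factor : ∀ i j u v → i ℚ.* (j ℚ.* v) ℚ.- j ℚ.* (i ℚ.* u) ≡ (v ℚ.- u) ℚ.* (i ℚ.* j)
  factor = solve 4 (λ i j u v → i :* (j :* v) :- j :* (i :* u) := (v :- u) :* (i :* j)) refl
    where open ℚ.+-*-Solver

  regroup : ∀ ε b i j → (ε ℚ.* b) ℚ.* b ℚ.* (i ℚ.* j) ≡ ε ℚ.* ((b ℚ.* i) ℚ.* (b ℚ.* j))
  regroup = solve 4 (λ ε b i j → ε :* b :* b :* (i :* j) := ε :* ((b :* i) :* (b :* j))) refl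
    where open ℚ.+-*-Solver

recip : (x : ℝ) → Positiveℝ x → ℝ
seq    (recip x _) n = invℚ (seq x n)
cauchy (recip x (mkPos b 0<b (A , b≤x))) ε 0<ε
  with cauchy x ((ε ℚ.* b) ℚ.* b) (*-pos (*-pos 0<ε 0<b) 0<b)
... | N , p = A ℕ.⊔ N , λ m n m≥ n≥ → close
  (b≤x m (ℕ.m⊔n≤o⇒m≤o A N m≥)) (b≤x n (ℕ.m⊔n≤o⇒m≤o A N n≥))
  (p n m (ℕ.m⊔n≤o⇒n≤o A N n≥) (ℕ.m⊔n≤o⇒n≤o A N m≥))
  where
  open ℚ.≤-Reasoning
  b*inv≤1 : ∀ {u} → b ℚ.≤ u → b ℚ.* invℚ u ℚ.≤ 1ℚ
  b*inv≤1 {u} b≤u = begin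
    b ℚ.* invℚ u  ≤⟨ ℚ.*-monoʳ-≤-nonNeg (invℚ u) {{ℚ.nonNegative (invℚ-nonNeg 0<u)}} b≤u ⟩
    u ℚ.* invℚ u  ≡⟨ ℚ.*-comm u (invℚ u) ⟩
    invℚ u ℚ.* u  ≡⟨ invℚ-inverse 0<u ⟩
    1ℚ ∎
    where 0<u = ℚ.<-≤-trans 0<b b≤u
  close : ∀ {u v} → b ℚ.≤ u → b ℚ.≤ v → ℚ.∣ v ℚ.- u ∣ ℚ.≤ (ε ℚ.* b) ℚ.* b →
          ℚ.∣ invℚ u ℚ.- invℚ v ∣ ℚ.≤ ε
  close {u} {v} b≤u b≤v h = begin
    ℚ.∣ i ℚ.- j ∣
      ≡⟨ cong ℚ.∣_∣ (cong₂ ℚ._-_ (sym (ℚ.*-identityʳ i)) (sym (ℚ.*-identityʳ j))) ⟩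
    ℚ.∣ i ℚ.* 1ℚ ℚ.- j ℚ.* 1ℚ ∣
      ≡⟨ cong ℚ.∣_∣ (cong₂ (λ s t → i ℚ.* s ℚ.- j ℚ.* t)
           (sym (invℚ-inverse 0<v)) (sym (invℚ-inverse 0<u))) ⟩
    ℚ.∣ i ℚ.* (j ℚ.* v) ℚ.- j ℚ.* (i ℚ.* u) ∣
      ≡⟨ cong ℚ.∣_∣ (factor i j u v) ⟩
    ℚ.∣ (v ℚ.- u) ℚ.* (i ℚ.* j) ∣
      ≡⟨ ℚ.∣p*q∣≡∣p∣*∣q∣ (v ℚ.- u) (i ℚ.* j) ⟩
    ℚ.∣ v ℚ.- u ∣ ℚ.* ℚ.∣ i ℚ.* j ∣
      ≡⟨ cong (ℚ.∣ v ℚ.- u ∣ ℚ.*_) (ℚ.0≤p⇒∣p∣≡p 0≤ij) ⟩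
    ℚ.∣ v ℚ.- u ∣ ℚ.* (i ℚ.* j)
      ≤⟨ ℚ.*-monoʳ-≤-nonNeg (i ℚ.* j) {{ℚ.nonNegative 0≤ij}} h ⟩
    (ε ℚ.* b) ℚ.* b ℚ.* (i ℚ.* j)
      ≡⟨ regroup ε b i j ⟩
    ε ℚ.* ((b ℚ.* i) ℚ.* (b ℚ.* j))
      ≤⟨ ℚ.*-monoˡ-≤-nonNeg ε {{ℚ.nonNegative (ℚ.<⇒≤ 0<ε)}}
           (*-mono-≤ (ℚ.<⇒≤ (ℚ.positive⁻¹ 1ℚ)) 0≤bj (b*inv≤1 b≤u) (b*inv≤1 b≤v)) ⟩
    ε ℚ.* 1ℚ
      ≡⟨ ℚ.*-identityʳ ε ⟩
    ε ∎
    where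
    i = invℚ u
    j = invℚ v
    0<u = ℚ.<-≤-trans 0<b b≤u
    0<v = ℚ.<-≤-trans 0<b b≤v
    0≤ij : 0ℚ ℚ.≤ i ℚ.* j
    0≤ij = *-mono-≤ {0ℚ} {i} {0ℚ} {j} (invℚ-nonNeg 0<u) ℚ.≤-refl
             (invℚ-nonNeg 0<u) (invℚ-nonNeg 0<v)
    0≤bj : 0ℚ ℚ.≤ b ℚ.* j
    0≤bj = *-mono-≤ {0ℚ} {b} {0ℚ} {j} (ℚ.<⇒≤ 0<b) ℚ.≤-refl
             (ℚ.<⇒≤ 0<b) (invℚ-nonNeg 0<v)

-- ⌊√n⌋
isqrt : ℕ → ℕ
isqrt zero    = 0
isqrt (suc n) with suc (isqrt n) ℕ.* suc (isqrt n) ℕ.≤? suc n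
... | yes _ = suc (isqrt n)
... | no  _ = isqrt n

isqrt-lower : ∀ n → isqrt n ℕ.* isqrt n ℕ.≤ n
isqrt-lower zero    = ℕ.z≤n
isqrt-lower (suc n) with suc (isqrt n) ℕ.* suc (isqrt n) ℕ.≤? suc n
... | yes le = le
... | no  _  = ℕ.m≤n⇒m≤1+n (isqrt-lower n)

isqrt-upper : ∀ n → n ℕ.< suc (isqrt n) ℕ.* suc (isqrt n)
isqrt-upper zero    = ℕ.s≤s ℕ.z≤n
isqrt-upper (suc n) with suc (isqrt n) ℕ.* suc (isqrt n) ℕ.≤? suc n
... | yes _  = ℕ.<-≤-trans (ℕ.s≤s (isqrt-upper n))
                 (ℕ.*-mono-< (ℕ.n<1+n (suc (isqrt n))) (ℕ.n<1+n (suc (isqrt n))))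
... | no  ≰ = ℕ.≰⇒> ≰

private

  square-cancel-≤ : ∀ {a b} → a ℕ.* a ℕ.< suc b ℕ.* suc b → a ℕ.≤ b
  square-cancel-≤ {a} {b} lt with a ℕ.≤? b
  ... | yes a≤b = a≤b
  ... | no  a≰b = ⊥-elim (ℕ.<⇒≱ lt (ℕ.*-mono-≤ (ℕ.≰⇒> a≰b) (ℕ.≰⇒> a≰b)))

  square-cancel-< : ∀ {a b} → a ℕ.* a ℕ.< b ℕ.* b → a ℕ.< b
  square-cancel-< {a} {b} lt with b ℕ.≤? a
  ... | yes b≤a = ⊥-elim (ℕ.<⇒≱ lt (ℕ.*-mono-≤ b≤a b≤a))
  ... | no  b≰a = ℕ.≰⇒> b≰a

  -- ⌊M√d⌋ / M ≤ (⌊N√d⌋ + 1) / N, cross-multiplied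
  isqrt-cross : ∀ d m n → let M = suc m; N = suc n in
    isqrt (d ℕ.* (M ℕ.* M)) ℕ.* N ℕ.≤ suc (isqrt (d ℕ.* (N ℕ.* N))) ℕ.* M
  isqrt-cross d m n = ℕ.<⇒≤ (square-cancel-< (begin-strict
    r ℕ.* N ℕ.* (r ℕ.* N)          ≡⟨ solve 2 (λ r N → r :* N :* (r :* N) := r :* r :* (N :* N)) refl r N ⟩
    r ℕ.* r ℕ.* (N ℕ.* N)          ≤⟨ ℕ.*-monoˡ-≤ (N ℕ.* N) (isqrt-lower (d ℕ.* (M ℕ.* M))) ⟩
    d ℕ.* (M ℕ.* M) ℕ.* (N ℕ.* N)  ≡⟨ solve 3 (λ d M N → d :* (M :* M) :* (N :* N) := d :* (N :* N) :* (M :* M)) refl d M N ⟩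
    d ℕ.* (N ℕ.* N) ℕ.* (M ℕ.* M)  <⟨ ℕ.*-monoˡ-< (M ℕ.* M) (isqrt-upper (d ℕ.* (N ℕ.* N))) ⟩
    s ℕ.* s ℕ.* (M ℕ.* M)          ≡⟨ solve 2 (λ s M → s :* s :* (M :* M) := s :* M :* (s :* M)) refl s M ⟩
    s ℕ.* M ℕ.* (s ℕ.* M)          ∎))
    where
    open ℕ.≤-Reasoning
    open ℕ.+-*-Solver
    M = suc m
    N = suc n
    r = isqrt (d ℕ.* (M ℕ.* M))
    s = suc (isqrt (d ℕ.* (N ℕ.* N)))

√-approx : ℕ → ℕ → ℚ
√-approx d k = + isqrt (d ℕ.* (suc k ℕ.* suc k)) ℚ./ suc k

√-approx-close : ∀ d m n → √-approx d m ℚ.≤ √-approx d n ℚ.+ (+ 1 ℚ./ suc n)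
√-approx-close d m n = begin
  + r ℚ./ suc m
    ≤⟨ /-mono-≤ (+ r) (+ (s ℕ.+ 1)) m n
         (subst₂ ℤ._≤_ (ℤ.pos-* r (suc n)) (ℤ.pos-* (s ℕ.+ 1) (suc m))
           (ℤ.+≤+ (subst (λ t → r ℕ.* suc n ℕ.≤ t ℕ.* suc m) (ℕ.+-comm 1 s)
             (isqrt-cross d m n)))) ⟩
  + (s ℕ.+ 1) ℚ./ suc n
    ≡⟨ /-distrib-+ s 1 n ⟩
  (+ s ℚ./ suc n) ℚ.+ (+ 1 ℚ./ suc n) ∎
  where
  open ℚ.≤-Reasoning
  r = isqrt (d ℕ.* (suc m ℕ.* suc m))
  s = isqrt (d ℕ.* (suc n ℕ.* suc n))

-- The k-th approximation is ⌊(k+1)√d⌋ / (k+1).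
√_ : ℕ → ℝ
seq    (√ d) = √-approx d
cauchy (√ d) ε 0<ε with archimedean ε 0<ε
... | N , 1/N≤ε = N , λ m n m≥ n≥ → ∣p∣≤q (half m n n≥)
  (subst (ℚ._≤ ε) (solve 2 (λ a b → b :- a := :- (a :- b)) refl (√-approx d m) (√-approx d n))
    (half n m m≥))
  where
  open ℚ.+-*-Solver
  half : ∀ m n → N ℕ.≤ n → √-approx d m ℚ.- √-approx d n ℚ.≤ ε
  half m n n≥ = begin
    √-approx d m ℚ.- √-approx d n
      ≤⟨ ℚ.+-monoˡ-≤ (ℚ.- √-approx d n) (√-approx-close d m n) ⟩
    √-approx d n ℚ.+ (+ 1 ℚ./ suc n) ℚ.- √-approx d n
      ≡⟨ solve 2 (λ a e → a :+ e :- a := e) refl (√-approx d n) (+ 1 ℚ./ suc n) ⟩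
    + 1 ℚ./ suc n
      ≤⟨ /-mono-≤ (+ 1) (+ 1) n N (ℤ.*-monoˡ-≤-nonNeg (+ 1) (ℤ.+≤+ {suc N} {suc n} (ℕ.s≤s n≥))) ⟩
    + 1 ℚ./ suc N
      ≤⟨ 1/N≤ε ⟩
    ε ∎
    where open ℚ.≤-Reasoning

√-positive : ∀ d .{{_ : NonZero d}} → Positiveℝ (√ d)
√-positive d@(suc _) = mkPos 1ℚ (ℚ.positive⁻¹ 1ℚ) (0 , λ k _ → 1≤√ k)
  where
  1≤√ : ∀ k → 1ℚ ℚ.≤ √-approx d k
  1≤√ k = /-mono-≤ (+ 1) (+ r) 0 k (subst₂ ℤ._≤_ (sym (ℤ.*-identityˡ (+ suc k)))
    (sym (ℤ.*-identityʳ (+ r))) (ℤ.+≤+ (square-cancel-≤ (ℕ.≤-<-trans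
      (ℕ.m≤n*m (suc k ℕ.* suc k) d) (isqrt-upper (d ℕ.* (suc k ℕ.* suc k)))))))
    where r = isqrt (d ℕ.* (suc k ℕ.* suc k))

1/√_ : (d : ℕ) → .{{NonZero d}} → ℝ
1/√ d = recip (√ d) (√-positive d)

infix  4 _≈ℂ_
infixl 6 _+ℂ_
infixl 7 _*ℂ_

record ℂ : Set where
  constructor _+i_
  field
    re im : ℝ

open ℂ public

record _≈ℂ_ (z w : ℂ) : Set where
  constructor mk≈
  field
    re≈ : re z ≈ℝ re w
    im≈ : im z ≈ℝ im w

0ℂ 1ℂ : ℂ
0ℂ = 0ℝ +i 0ℝ
1ℂ = 1ℝ +i 0ℝ

_+ℂ_ _*ℂ_ : ℂ → ℂ → ℂ
z +ℂ w = (re z +ℝ re w) +i (im z +ℝ im w)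
z *ℂ w = (re z *ℝ re w -ℝ im z *ℝ im w) +i (re z *ℝ im w +ℝ im z *ℝ re w)

ℂ-+-rawMonoid : RawMonoid _ _
ℂ-+-rawMonoid = record { _≈_ = _≈ℂ_ ; _∙_ = _+ℂ_ ; ε = 0ℂ }

sumℂ : ∀ {n} → Vector ℂ n → ℂ
sumℂ = RawMonoidDefinitions.sum ℂ-+-rawMonoid

infix 4 _≈ᵛ_ _≈ᴹ_

_≈ᵛ_ : ∀ {n} → Vector ℂ n → Vector ℂ n → Set
v ≈ᵛ w = ∀ i → v i ≈ℂ w i

0ᵛ : ∀ {n} → Vector ℂ n
0ᵛ _ = 0ℂ

_+ᵛ_ : ∀ {n} → Vector ℂ n → Vector ℂ n → Vector ℂ n
(v +ᵛ w) i = v i +ℂ w i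

_*ᵛ_ : ∀ {n} → ℂ → Vector ℂ n → Vector ℂ n
(a *ᵛ v) i = a *ℂ v i

Matrix : ℕ → Set
Matrix n = Fin n → Fin n → ℂ

_≈ᴹ_ : ∀ {n} → Matrix n → Matrix n → Set
A ≈ᴹ B = ∀ i j → A i j ≈ℂ B i j

_*ᴹ_ : ∀ {n} → Matrix n → Matrix n → Matrix n
(A *ᴹ B) i k = sumℂ λ j → A i j *ℂ B j k

1ᴹ : ∀ {n} → Matrix n
1ᴹ i j = if does (i Fin.≟ j) then 1ℂ else 0ℂ

_·_ : ∀ {n} → Matrix n → Vector ℂ n → Vector ℂ n
(A · v) i = sumℂ λ j → A i j *ℂ v j

matrix-rawMonoid : ℕ → RawMonoid _ _
matrix-rawMonoid n = record { Carrier = Matrix n ; _≈_ = _≈ᴹ_ ; _∙_ = _*ᴹ_ ; ε = 1ᴹ }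

record Subspace (n : ℕ) : Set₁ where
  field
    _∈W      : Vector ℂ n → Set
    resp     : ∀ {v w} → v ≈ᵛ w → v ∈W → w ∈W
    0-closed : 0ᵛ ∈W
    +-closed : ∀ {v w} → v ∈W → w ∈W → (v +ᵛ w) ∈W
    *-closed : ∀ a {v} → v ∈W → (a *ᵛ v) ∈W

  NonZeroSubspace : Set
  NonZeroSubspace = ∃ λ v → v ∈W × ¬ (v ≈ᵛ 0ᵛ)

  ProperSubspace : Set
  ProperSubspace = ∃ λ v → ¬ (v ∈W)

record FiniteGroup (c ℓ : Level) : Set (lsuc (c ⊔ ℓ)) where
  field
    group       : Group c ℓ
    order       : ℕ
    enumeration : Inverse (Group.setoid group) (≡.setoid (Fin order))

  open Group group public

  element : Fin order → Carrier
  element = Inverse.from enumeration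

  instance
    order-nonZero : NonZero order
    order-nonZero = Fin.nonZeroIndex (Inverse.to enumeration ε)

module _ {c ℓ} (G : FiniteGroup c ℓ) where

  private module G = FiniteGroup G

  𝔼 : (G.Carrier → ℚ) → ℚ
  𝔼 h = RawMonoidDefinitions.sum ℚ.+-0-rawMonoid (λ i → h (G.element i))
        ℚ.* (+ 1 ℚ./ G.order)

  -- Probability of an event in two independent uniform elements of G
  -- (so each pair has weight 1/|G|²).
  Pr : ∀ {p} {P : G.Carrier → G.Carrier → Set p} → (∀ x y → Dec (P x y)) → ℚ
  Pr P? = 𝔼 λ x → 𝔼 λ y → if does (P? x y) then 1ℚ else 0ℚ

  -- A monoid homomorphism from a group into n × n matrices lands in GLₙ(ℂ).
  record Representation (n : ℕ) : Set (c ⊔ ℓ) where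
    field
      ρ              : G.Carrier → Matrix n
      isHomomorphism : IsMonoidHomomorphism G.rawMonoid (matrix-rawMonoid n) ρ

    -- For irreducible ρ this says exactly that ρ is the trivial
    -- (one-dimensional) representation.
    Trivial : Set c
    Trivial = ∀ g → ρ g ≈ᴹ 1ᴹ

    Invariant : Subspace n → Set c
    Invariant W = ∀ g {v} → v ∈W → (ρ g · v) ∈W
      where open Subspace W

    Irreducible : Set (lsuc Level.zero ⊔ c)
    Irreducible = NonZero n × ¬ (∃ λ (W : Subspace n) →
      Invariant W × Subspace.NonZeroSubspace W × Subspace.ProperSubspace W)

  IsNontrivialIrrepDim : ℕ → Set (lsuc Level.zero ⊔ c ⊔ ℓ)
  IsNontrivialIrrepDim n = ∃ λ (R : Representation n) →
    Representation.Irreducible R × ¬ Representation.Trivial R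

  IsMinNontrivialIrrepDim : ℕ → Set (lsuc Level.zero ⊔ c ⊔ ℓ)
  IsMinNontrivialIrrepDim d =
    IsNontrivialIrrepDim d × (∀ n → IsNontrivialIrrepDim n → d ℕ.≤ n)

signℚ : Sign → ℚ
signℚ Sign.+ = 1ℚ
signℚ Sign.- = ℚ.- 1ℚ

{-# OPTIONS --safe #-}

-- Following Gowers: let S(x,y) = f(x⁻¹y) + f(y⁻¹x), a symmetric matrix that commutes with
-- left translation and kills constants.  With N = |G| and Φ = 2 Pr − 1 we have
-- fᵀSf = 2ΦN², so the top eigenvalue t of S is at least 2ΦN.  Translation acts on the
-- t-eigenspace without fixed vectors, so the eigenspace has dimension at least d, and
-- comparing d·t² with the Hilbert–Schmidt norm ∑S² ≤ 4N² gives dΦ² ≤ 1.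
--
-- This last inequality is decidable, so it may be proved by contradiction, and irreducible
-- subrepresentations, bases and eigenvectors need only exist classically.  Only t itself must
-- be an actual Cauchy sequence: it is found by bisection, since definiteness of a rational
-- symmetric matrix can be decided by elimination.
module Submission where

open import Algebra.Bundles using (CommutativeRing; Semiring; Monoid; Group)
open import Algebra.Bundles.Raw using (RawMonoid)
import Algebra.Definitions.RawMonoid as RawMonoidDefinitions
import Algebra.Properties.Group as GroupProperties
open import Algebra.Solver.Ring.AlmostCommutativeRing
  using (fromCommutativeRing; _-Raw-AlmostCommutative⟶_; Induced-equivalence)
open import Data.Bool.Base using (if_then_else_)
open import Data.Empty using (⊥; ⊥-elim)
open import Data.Fin.Base using (Fin; zero; suc)
open import Data.Fin.Permutation using (permutation)
import Data.Fin.Properties as Fin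
open import Data.Integer.Base as ℤ using (ℤ; +_; -[1+_]; _⊖_)
import Data.Integer.Properties as ℤ
open import Data.Maybe.Base as Maybe using ()
open import Data.Nat.Base as ℕ using (ℕ; zero; suc)
import Data.Nat.Properties as ℕ
open import Data.Product.Base using (∃; _×_; _,_; proj₁; proj₂)
open import Data.Vec.Functional using (Vector)
open import Level using (0ℓ)
open import Relation.Binary.Bundles using (Preorder)
open import Relation.Binary.Consequences using (dec⇒weaklyDec)
open import Relation.Binary.Definitions using (WeaklyDecidable)
import Relation.Binary.PropositionalEquality as ≡
open ≡ using (_≡_; _≢_)
open import Relation.Nullary.Decidable.Core using (yes; no; does; decidable-stable; ¬¬-excluded-middle)
open import Relation.Nullary.Negation.Core using (¬_)

-- Symmetrising replaces singular values by eigenvalues, so that a quadratic form controls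
-- everything. Only Φ > 0 needs an argument, and then t > 0; this positivity keeps the constants,
-- which S maps to 0, out of the t-eigenspace. The obstacle is that t is known only as a limit, so
-- no equation for it can be solved. Instead t·1 - S is nonnegative by construction, and were it
-- definite with explicit constants ε and c, all Rayleigh quotients would stay a fixed amount below
-- t. Elimination therefore has to return such constants. It is used twice, run as a decision over ℚ
-- and argued with classically over ℝ, whence the abstract ordered ring in which positivity is the
-- negation of `x ≤ 0#`. No irreducible subspace is ever selected: an induction on k ≤ d shows that
-- a nonzero invariant space of eigenvectors cannot fail to contain k orthogonal vectors. Dimension
-- appears only as the size of such systems.

-- Ring solver for an arbitrary commutative ring.

module IntegerCoefficientSolver {a ℓ} (R : CommutativeRing a ℓ) where

  open CommutativeRing R
  open import Algebra.Properties.Ring ring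
  open import Algebra.Properties.AbelianGroup +-abelianGroup using (⁻¹-∙-comm)
  open import Algebra.Properties.Group +-group using (ε⁻¹≈ε; ⁻¹-involutive)
  open import Algebra.Properties.Semiring.Mult.TCOptimised semiring
    using (×1-homo-*; ×-homo-+; 1+×) renaming (_×_ to _⋆_)
  open import Relation.Binary.Reasoning.Setoid setoid

  fromℕ : ℕ → Carrier
  fromℕ n = n ⋆ 1#

  fromℤ : ℤ → Carrier
  fromℤ (+ n)    = fromℕ n
  fromℤ -[1+ n ] = - fromℕ (suc n)

  fromℤ-⊖ : ∀ m n → fromℤ (m ⊖ n) ≈ fromℕ m + - fromℕ n
  fromℤ-⊖ m       zero    = sym (trans (+-congˡ ε⁻¹≈ε) (+-identityʳ (fromℕ m)))
  fromℤ-⊖ zero    (suc n) = sym (+-identityˡ (- fromℕ (suc n)))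
  fromℤ-⊖ (suc m) (suc n) = begin
    fromℤ (suc m ⊖ suc n)                 ≡⟨ ≡.cong fromℤ (ℤ.[1+m]⊖[1+n]≡m⊖n m n) ⟩
    fromℤ (m ⊖ n)                         ≈⟨ fromℤ-⊖ m n ⟩
    fromℕ m + - fromℕ n                   ≈⟨ +-congʳ (+-identityʳ (fromℕ m)) ⟨
    (fromℕ m + 0#) + - fromℕ n            ≈⟨ +-congʳ (+-congˡ (-‿inverseʳ 1#)) ⟨
    (fromℕ m + (1# + - 1#)) + - fromℕ n   ≈⟨ +-congʳ (+-assoc (fromℕ m) 1# (- 1#)) ⟨
    ((fromℕ m + 1#) + - 1#) + - fromℕ n   ≈⟨ +-assoc _ (- 1#) (- fromℕ n) ⟩
    (fromℕ m + 1#) + (- 1# + - fromℕ n)   ≈⟨ +-cong (+-comm (fromℕ m) 1#) (⁻¹-∙-comm 1# (fromℕ n)) ⟩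
    (1# + fromℕ m) + - (1# + fromℕ n)     ≈⟨ +-cong (1+× m 1#) (-‿cong (1+× n 1#)) ⟨
    fromℕ (suc m) + - fromℕ (suc n)       ∎

  fromℤ-neg : ∀ i → fromℤ (ℤ.- i) ≈ - fromℤ i
  fromℤ-neg (+ zero)  = sym ε⁻¹≈ε
  fromℤ-neg (+ suc n) = refl
  fromℤ-neg -[1+ n ]  = sym (⁻¹-involutive (fromℕ (suc n)))

  fromℤ-+ : ∀ i j → fromℤ (i ℤ.+ j) ≈ fromℤ i + fromℤ j
  fromℤ-+ (+ m)    (+ n)    = ×-homo-+ 1# m n
  fromℤ-+ (+ m)    -[1+ n ] = fromℤ-⊖ m (suc n)
  fromℤ-+ -[1+ m ] (+ n)    = trans (fromℤ-⊖ n (suc m)) (+-comm (fromℕ n) (- fromℕ (suc m)))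
  fromℤ-+ -[1+ m ] -[1+ n ] = begin
    fromℤ (-[1+ m ] ℤ.+ -[1+ n ])         ≡⟨ ≡.cong fromℤ (ℤ.neg-distrib-+ (+ suc m) (+ suc n)) ⟨
    - fromℕ (suc m ℕ.+ suc n)             ≈⟨ -‿cong (×-homo-+ 1# (suc m) (suc n)) ⟩
    - (fromℕ (suc m) + fromℕ (suc n))     ≈⟨ ⁻¹-∙-comm (fromℕ (suc m)) (fromℕ (suc n)) ⟨
    - fromℕ (suc m) + - fromℕ (suc n)     ∎

  fromℤ-*⁺ : ∀ m j → fromℤ (+ m ℤ.* j) ≈ fromℕ m * fromℤ j
  fromℤ-*⁺ m (+ n)    = trans (reflexive (≡.cong fromℤ (≡.sym (ℤ.pos-* m n)))) (×1-homo-* m n)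
  fromℤ-*⁺ m -[1+ n ] = begin
    fromℤ (+ m ℤ.* (ℤ.- (+ suc n)))       ≡⟨ ≡.cong fromℤ (ℤ.neg-distribʳ-* (+ m) (+ suc n)) ⟨
    fromℤ (ℤ.- (+ m ℤ.* + suc n))         ≈⟨ fromℤ-neg (+ m ℤ.* + suc n) ⟩
    - fromℤ (+ m ℤ.* + suc n)             ≈⟨ -‿cong (fromℤ-*⁺ m (+ suc n)) ⟩
    - (fromℕ m * fromℕ (suc n))           ≈⟨ -‿distribʳ-* (fromℕ m) (fromℕ (suc n)) ⟩
    fromℕ m * - fromℕ (suc n)             ∎

  fromℤ-* : ∀ i j → fromℤ (i ℤ.* j) ≈ fromℤ i * fromℤ j
  fromℤ-* (+ m)    j = fromℤ-*⁺ m j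
  fromℤ-* -[1+ m ] j = begin
    fromℤ ((ℤ.- (+ suc m)) ℤ.* j)         ≡⟨ ≡.cong fromℤ (ℤ.neg-distribˡ-* (+ suc m) j) ⟨
    fromℤ (ℤ.- (+ suc m ℤ.* j))           ≈⟨ fromℤ-neg (+ suc m ℤ.* j) ⟩
    - fromℤ (+ suc m ℤ.* j)               ≈⟨ -‿cong (fromℤ-*⁺ (suc m) j) ⟩
    - (fromℕ (suc m) * fromℤ j)           ≈⟨ -‿distribˡ-* (fromℕ (suc m)) (fromℤ j) ⟩
    - fromℕ (suc m) * fromℤ j             ∎

  fromℤ-morphism : ℤ.+-*-rawRing -Raw-AlmostCommutative⟶ fromCommutativeRing R
  fromℤ-morphism = record
    { ⟦_⟧ = fromℤ ; +-homo = fromℤ-+ ; *-homo = fromℤ-* ; -‿homo = fromℤ-neg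
    ; 0-homo = refl ; 1-homo = refl }

  -- Equality in ℝ and ℂ cannot be tested, so the solver compares coefficients in ℤ, before they are
  -- mapped into the ring.
  _≟ᶜ_ : WeaklyDecidable (Induced-equivalence fromℤ-morphism)
  i ≟ᶜ j = Maybe.map (λ { ≡.refl → refl }) (dec⇒weaklyDec ℤ._≟_ i j)

  open import Algebra.Solver.Ring ℤ.+-*-rawRing (fromCommutativeRing R) fromℤ-morphism _≟ᶜ_ public

-- Ordered rings with a stable order.

-- Positivity is written `¬ (x ≤ 0#)`, which over the reals is weaker than an explicit positive
-- lower bound. Stability of `_≤_` compensates: inequalities may be proved by contradiction although
-- the order is not decidable.
record OrderedRing : Set₁ where
  infix 4 _≤_
  field
    commutativeRing : CommutativeRing 0ℓ 0ℓ
  open CommutativeRing commutativeRing public hiding (zero)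
  field
    _≤_         : Carrier → Carrier → Set
    ≤-reflexive : ∀ {x y} → x ≈ y → x ≤ y
    ≤-trans     : ∀ {x y z} → x ≤ y → y ≤ z → x ≤ z
    ≤-antisym   : ∀ {x y} → x ≤ y → y ≤ x → x ≈ y
    ≤-stable    : ∀ {x y} → ¬ ¬ (x ≤ y) → x ≤ y
    ≰⇒≥         : ∀ {x y} → ¬ (x ≤ y) → y ≤ x
    +-mono-≤    : ∀ {x y u v} → x ≤ y → u ≤ v → x + u ≤ y + v
    *-nonNeg    : ∀ {x y} → 0# ≤ x → 0# ≤ y → 0# ≤ x * y
    *-pos       : ∀ {x y} → ¬ (x ≤ 0#) → ¬ (y ≤ 0#) → ¬ (x * y ≤ 0#)
    1≰0         : ¬ (1# ≤ 0#)

module OrderedRingProperties (K : OrderedRing) where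

  open OrderedRing K
  open IntegerCoefficientSolver commutativeRing

  preorder : Preorder 0ℓ 0ℓ 0ℓ
  preorder = record
    { isPreorder = record
      { isEquivalence = isEquivalence ; reflexive = ≤-reflexive ; trans = ≤-trans } }

  module ≤-Reasoning where
    open import Relation.Binary.Reasoning.Preorder preorder public

  ≤-refl : ∀ {x} → x ≤ x
  ≤-refl = ≤-reflexive refl

  ≤-resp-≈ : ∀ {x y u v} → x ≈ y → u ≈ v → x ≤ u → y ≤ v
  ≤-resp-≈ x≈y u≈v x≤u = ≤-trans (≤-reflexive (sym x≈y)) (≤-trans x≤u (≤-reflexive u≈v))

  +-nonNeg : ∀ {x y} → 0# ≤ x → 0# ≤ y → 0# ≤ x + y
  +-nonNeg 0≤x 0≤y = ≤-trans (≤-reflexive (sym (+-identityˡ 0#))) (+-mono-≤ 0≤x 0≤y)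

  0≤y-x⇒x≤y : ∀ {x y} → 0# ≤ y + - x → x ≤ y
  0≤y-x⇒x≤y {x} {y} h = ≤-resp-≈ (+-identityˡ x)
    (solve 2 (λ x y → y :+ :- x :+ x := y) refl x y) (+-mono-≤ h ≤-refl)

  x≤y⇒0≤y-x : ∀ {x y} → x ≤ y → 0# ≤ y + - x
  x≤y⇒0≤y-x {x} {y} h = ≤-resp-≈ (-‿inverseʳ x) refl (+-mono-≤ h ≤-refl)

  x≤0⇒0≤-x : ∀ {x} → x ≤ 0# → 0# ≤ - x
  x≤0⇒0≤-x {x} h = ≤-resp-≈ refl (+-identityˡ (- x)) (x≤y⇒0≤y-x h)

  0≤-x⇒x≤0 : ∀ {x} → 0# ≤ - x → x ≤ 0#
  0≤-x⇒x≤0 {x} h = 0≤y-x⇒x≤y (≤-resp-≈ refl (sym (+-identityˡ (- x))) h)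

  -- The sign of x is split under the double negation: if the claim failed, `x ≤ 0#` would be
  -- refuted, hence `0# ≤ x`, and then the claim holds after all.
  0≤x*x : ∀ x → 0# ≤ x * x
  0≤x*x x = ≤-stable λ ≰ →
    ≰ (*-nonNeg (≰⇒≥ λ x≤0 → ≰ (nonPos x≤0)) (≰⇒≥ λ x≤0 → ≰ (nonPos x≤0)))
    where
    nonPos : x ≤ 0# → 0# ≤ x * x
    nonPos x≤0 = ≤-resp-≈ refl (solve 1 (λ x → :- x :* :- x := x :* x) refl x)
      (*-nonNeg (x≤0⇒0≤-x x≤0) (x≤0⇒0≤-x x≤0))

  *-monoˡ-≤ : ∀ {x y z} → 0# ≤ z → x ≤ y → z * x ≤ z * y
  *-monoˡ-≤ {x} {y} {z} 0≤z x≤y = 0≤y-x⇒x≤y (≤-resp-≈ refl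
    (solve 3 (λ x y z → z :* (y :+ :- x) := z :* y :+ :- (z :* x)) refl x y z)
    (*-nonNeg 0≤z (x≤y⇒0≤y-x x≤y)))

  *-monoʳ-≤ : ∀ {x y z} → 0# ≤ z → x ≤ y → x * z ≤ y * z
  *-monoʳ-≤ {x} {y} {z} 0≤z x≤y = ≤-resp-≈ (*-comm z x) (*-comm z y) (*-monoˡ-≤ 0≤z x≤y)

  *-cancel-nonNeg : ∀ {a x} → ¬ (a ≤ 0#) → 0# ≤ a * x → 0# ≤ x
  *-cancel-nonNeg {a} {x} a≰0 0≤ax = ≤-stable λ 0≰x →
    *-pos a≰0 (λ -x≤0 → 0≰x (≤-resp-≈ refl (solve 1 (λ x → :- :- x := x) refl x) (x≤0⇒0≤-x -x≤0)))
      (0≤-x⇒x≤0 (≤-resp-≈ refl (solve 2 (λ a x → a :* x := :- (a :* :- x)) refl a x) 0≤ax))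

  x*x≤0⇒x≤0 : ∀ {x} → x * x ≤ 0# → x ≤ 0#
  x*x≤0⇒x≤0 xx≤0 = ≤-stable λ x≰0 → *-pos x≰0 x≰0 xx≤0

  x-y≈0⇒x≈y : ∀ x y → x + - y ≈ 0# → x ≈ y
  x-y≈0⇒x≈y x y h = trans (solve 2 (λ x y → x := x :+ :- y :+ y) refl x y)
    (trans (+-congʳ h) (+-identityˡ y))

  -- The arithmetic of `eigenvector`: a is |v|², s the form of S at v, i is 1/a. From t ≤ l + w and
  -- l·a ≤ s follows t·a - s ≤ w·a, and a cancels.
  cancel-scale : ∀ ε c t l w a s i → 0# ≤ c → ε * a ≤ c * (t * a + - s) → 0# ≤ a →
                 t ≤ l + w → l * a + - s ≤ 0# → 0# ≤ i → i * a ≈ 1# → ε ≤ c * w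
  cancel-scale ε c t l w a s i 0≤c εa≤ 0≤a t≤l+w la≤s 0≤i ia≈1 = 0≤y-x⇒x≤y (≤-resp-≈ refl
    (trans (solve 8 (λ ε c t l w a s i →
        i :* (c :* (t :* a :+ :- s) :+ :- (ε :* a)) :+ i :* (c :* (:- (l :* a :+ :- s) :+ (l :+ w :+ :- t) :* a))
          := (c :* w :+ :- ε) :* (i :* a)) refl ε c t l w a s i)
      (trans (*-congˡ ia≈1) (*-identityʳ _)))
    (+-nonNeg (*-nonNeg 0≤i (x≤y⇒0≤y-x εa≤))
      (*-nonNeg 0≤i (*-nonNeg 0≤c (+-nonNeg (x≤0⇒0≤-x la≤s) (*-nonNeg (x≤y⇒0≤y-x t≤l+w) 0≤a))))))

  x*x≤0⇒x≈0 : ∀ {x} → x * x ≤ 0# → x ≈ 0#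
  x*x≤0⇒x≈0 {x} xx≤0 = ≤-antisym (x*x≤0⇒x≤0 xx≤0) (≤-resp-≈ refl (solve 1 (λ x → :- :- x := x) refl x)
    (x≤0⇒0≤-x (x*x≤0⇒x≤0 (≤-resp-≈ (solve 1 (λ x → x :* x := :- x :* :- x) refl x) refl xx≤0))))

-- Finite sums.

module FiniteSums {c ℓ} (R : Semiring c ℓ) where

  open Semiring R hiding (zero)
  open import Algebra.Properties.Semiring.Sum R public
  open import Relation.Binary.Reasoning.Setoid setoid

  infix 8 _∙_

  δ : ∀ {n} → Fin n → Fin n → Carrier
  δ i j = if does (i Fin.≟ j) then 1# else 0#

  _∙_ : ∀ {n} → Vector Carrier n → Vector Carrier n → Carrier
  v ∙ w = sum λ i → v i * w i

  _⊡_ : ∀ {m n} → (Fin m → Fin n → Carrier) → Vector Carrier n → Vector Carrier m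
  (M ⊡ v) i = M i ∙ v

  sum-cong : ∀ {n} {f g : Vector Carrier n} → (∀ i → f i ≈ g i) → sum f ≈ sum g
  sum-cong = sum-cong-≋

  sum-0 : ∀ {n} {f : Vector Carrier n} → (∀ i → f i ≈ 0#) → sum f ≈ 0#
  sum-0 {n} f≈0 = trans (sum-cong f≈0) (sum-replicate-zero n)

  ∑-linear : ∀ {n} x y (f g : Vector Carrier n) →
             sum (λ i → x * f i + y * g i) ≈ x * sum f + y * sum g
  ∑-linear x y f g = trans (∑-distrib-+ (λ i → x * f i) (λ i → y * g i))
    (+-cong (sym (*-distribˡ-sum x f)) (sym (*-distribˡ-sum y g)))

  ∑-δ : ∀ {n} (i : Fin n) (f : Vector Carrier n) → sum (λ j → δ i j * f j) ≈ f i
  ∑-δ zero    f = begin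
    1# * f zero + sum (λ j → 0# * f (suc j))  ≈⟨ +-cong (*-identityˡ (f zero)) (sum-0 λ j → zeroˡ (f (suc j))) ⟩
    f zero + 0#                               ≈⟨ +-identityʳ (f zero) ⟩
    f zero                                    ∎
  ∑-δ (suc i) f = begin
    0# * f zero + sum (λ j → δ i j * f (suc j))  ≈⟨ +-cong (zeroˡ (f zero)) (∑-δ i (λ j → f (suc j))) ⟩
    0# + f (suc i)                               ≈⟨ +-identityˡ (f (suc i)) ⟩
    f (suc i)                                    ∎

-- No congruence is asked of `h`: taking the k-th term of a Cauchy sequence does not respect `_≈ℝ_`,
-- and yet commutes with sums.
sum-homo : ∀ {a b ℓ₁ ℓ₂} (M : RawMonoid a ℓ₁) (N : Monoid b ℓ₂) →
  let module M = RawMonoid M; module N = Monoid N in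
  (h : M.Carrier → N.Carrier) → h M.ε N.≈ N.ε → (∀ x y → h (x M.∙ y) N.≈ h x N.∙ h y) →
  ∀ {n} (f : Vector M.Carrier n) →
  h (RawMonoidDefinitions.sum M f) N.≈ RawMonoidDefinitions.sum N.rawMonoid (λ i → h (f i))
sum-homo M N h h-ε h-∙ {zero}  f = h-ε
sum-homo M N h h-ε h-∙ {suc n} f = N.trans (h-∙ _ _) (N.∙-congˡ (sum-homo M N h h-ε h-∙ λ i → f (suc i)))
  where module N = Monoid N

-- Quadratic forms and definiteness.

module QuadraticForms (K : OrderedRing) where

  open OrderedRing K
  open OrderedRingProperties K
  open FiniteSums semiring public
  open IntegerCoefficientSolver commutativeRing
    using (solve; _:=_; _:+_; _:*_; :-_; con)
  import Relation.Binary.Reasoning.Setoid setoid as ≈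

  SquareMatrix : ℕ → Set
  SquareMatrix n = Fin n → Fin n → Carrier

  Symmetric : ∀ {n} → SquareMatrix n → Set
  Symmetric M = ∀ i j → M i j ≈ M j i

  form : ∀ {n} → SquareMatrix n → Vector Carrier n → Carrier
  form M v = v ∙ (M ⊡ v)

  sum-nonNeg : ∀ {n} {f : Vector Carrier n} → (∀ i → 0# ≤ f i) → 0# ≤ sum f
  sum-nonNeg {zero}  0≤f = ≤-refl
  sum-nonNeg {suc n} 0≤f = +-nonNeg (0≤f zero) (sum-nonNeg λ i → 0≤f (suc i))

  sum-mono-≤ : ∀ {n} {f g : Vector Carrier n} → (∀ i → f i ≤ g i) → sum f ≤ sum g
  sum-mono-≤ {zero}  f≤g = ≤-refl
  sum-mono-≤ {suc n} f≤g = +-mono-≤ (f≤g zero) (sum-mono-≤ λ i → f≤g (suc i))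

  sum-square-mono : ∀ n {x y z} → 0# ≤ x → x ≤ y → sum {n} (λ _ → y * y) ≤ z → sum {n} (λ _ → x * x) ≤ z
  sum-square-mono n 0≤x x≤y = ≤-trans (sum-mono-≤ {n} λ _ →
    ≤-trans (*-monoˡ-≤ 0≤x x≤y) (*-monoʳ-≤ (≤-trans 0≤x x≤y) x≤y))

  term≤sum : ∀ {n} {f : Vector Carrier n} → (∀ i → 0# ≤ f i) → ∀ i → f i ≤ sum f
  term≤sum {f = f} 0≤f zero    = ≤-resp-≈ (+-identityʳ (f zero)) refl
    (+-mono-≤ ≤-refl (sum-nonNeg λ i → 0≤f (suc i)))
  term≤sum {f = f} 0≤f (suc i) = ≤-resp-≈ (+-identityˡ (f (suc i))) refl
    (+-mono-≤ (0≤f zero) (term≤sum (λ i → 0≤f (suc i)) i))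

  0≤v∙v : ∀ {n} (v : Vector Carrier n) → 0# ≤ v ∙ v
  0≤v∙v v = sum-nonNeg λ i → 0≤x*x (v i)

  v∙v≤0⇒v≈0 : ∀ {n} (v : Vector Carrier n) → v ∙ v ≤ 0# → ∀ i → v i ≈ 0#
  v∙v≤0⇒v≈0 v v∙v≤0 i = x*x≤0⇒x≈0 (≤-trans (term≤sum (λ j → 0≤x*x (v j)) i) v∙v≤0)

  ∙-comm : ∀ {n} (v w : Vector Carrier n) → v ∙ w ≈ w ∙ v
  ∙-comm v w = sum-cong λ i → *-comm (v i) (w i)

  ∙-linearʳ : ∀ {n} x y (u v w : Vector Carrier n) →
              u ∙ (λ i → x * v i + y * w i) ≈ x * (u ∙ v) + y * (u ∙ w)
  ∙-linearʳ x y u v w = trans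
    (sum-cong λ i → solve 5 (λ x y u v w → u :* (x :* v :+ y :* w) := x :* (u :* v) :+ y :* (u :* w))
                      refl x y (u i) (v i) (w i))
    (∑-linear x y (λ i → u i * v i) (λ i → u i * w i))

  ⊡-symmetric : ∀ {n} (M : SquareMatrix n) → Symmetric M → ∀ v w → v ∙ (M ⊡ w) ≈ w ∙ (M ⊡ v)
  ⊡-symmetric M M-sym v w = ≈.begin
    sum (λ i → v i * sum (λ j → M i j * w j))    ≈.≈⟨ sum-cong (λ i → *-distribˡ-sum (v i) (λ j → M i j * w j)) ⟩
    sum (λ i → sum (λ j → v i * (M i j * w j)))  ≈.≈⟨ ∑-comm (λ i j → v i * (M i j * w j)) ⟩
    sum (λ j → sum (λ i → v i * (M i j * w j)))  ≈.≈⟨ sum-cong (λ j → sum-cong λ i → trans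
      (*-congˡ (*-congʳ (M-sym i j)))
      (solve 3 (λ v m w → v :* (m :* w) := w :* (m :* v)) refl (v i) (M j i) (w j))) ⟩
    sum (λ j → sum (λ i → w j * (M j i * v i)))  ≈.≈⟨ sum-cong (λ j → *-distribˡ-sum (w j) (λ i → M j i * v i)) ⟨
    sum (λ j → w j * sum (λ i → M j i * v i))    ≈.∎

  form-linear : ∀ {n} (M : SquareMatrix n) → Symmetric M → ∀ x y v w →
    form M (λ i → x * v i + y * w i) ≈
    x * x * form M v + (x * y * (w ∙ (M ⊡ v)) + x * y * (w ∙ (M ⊡ v))) + y * y * form M w
  form-linear M M-sym x y v w = ≈.begin
    u ∙ (M ⊡ u)
      ≈.≈⟨ sum-cong (λ i → *-congˡ (∙-linearʳ x y (M i) v w)) ⟩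
    u ∙ (λ i → x * (M ⊡ v) i + y * (M ⊡ w) i)
      ≈.≈⟨ ∙-linearʳ x y u (M ⊡ v) (M ⊡ w) ⟩
    x * (u ∙ (M ⊡ v)) + y * (u ∙ (M ⊡ w))
      ≈.≈⟨ +-cong (*-congˡ (expand (M ⊡ v))) (*-congˡ (expand (M ⊡ w))) ⟩
    x * (x * (v ∙ (M ⊡ v)) + y * (w ∙ (M ⊡ v))) + y * (x * (v ∙ (M ⊡ w)) + y * (w ∙ (M ⊡ w)))
      ≈.≈⟨ +-congˡ (*-congˡ (+-congʳ (*-congˡ (⊡-symmetric M M-sym v w)))) ⟩
    x * (x * (v ∙ (M ⊡ v)) + y * (w ∙ (M ⊡ v))) + y * (x * (w ∙ (M ⊡ v)) + y * (w ∙ (M ⊡ w)))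
      ≈.≈⟨ solve 5 (λ x y p q r → x :* (x :* p :+ y :* q) :+ y :* (x :* q :+ y :* r)
             := x :* x :* p :+ (x :* y :* q :+ x :* y :* q) :+ y :* y :* r) refl x y
             (v ∙ (M ⊡ v)) (w ∙ (M ⊡ v)) (w ∙ (M ⊡ w)) ⟩
    x * x * form M v + (x * y * (w ∙ (M ⊡ v)) + x * y * (w ∙ (M ⊡ v))) + y * y * form M w ≈.∎
    where
    u : Vector Carrier _
    u i = x * v i + y * w i
    expand : ∀ z → u ∙ z ≈ x * (v ∙ z) + y * (w ∙ z)
    expand z = trans (∙-comm u z) (trans (∙-linearʳ x y z v w)
      (+-cong (*-congˡ (∙-comm z v)) (*-congˡ (∙-comm z w))))

  record NonPositiveVector {n} (M : SquareMatrix n) : Set where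
    field
      vector  : Vector Carrier n
      nonZero : ¬ (vector ∙ vector ≤ 0#)
      nonPos  : form M vector ≤ 0#

  -- Quantitative definiteness, form ≥ (ε/c)·|v|². The two constants stay separate because the ring
  -- has no division.
  record PositiveDefinite {n} (M : SquareMatrix n) : Set where
    field
      ε c     : Carrier
      ε≰0     : ¬ (ε ≤ 0#)
      0≤c     : 0# ≤ c
      nonNeg  : ∀ v → 0# ≤ form M v
      bounded : ∀ v → ε * (v ∙ v) ≤ c * form M v

  -- A crude stand-in for Cauchy-Schwarz, by (x + p)² ≤ 2x² + 2p² in each coordinate. The constant
  -- roughly doubles every time; for `extend-positiveDefinite` any constant will do.
  ∙²-bounded : ∀ {n} (b : Vector Carrier n) →
    ∃ λ B → 0# ≤ B × (∀ w → (b ∙ w) * (b ∙ w) ≤ B * (w ∙ w))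
  ∙²-bounded {zero}  b = 0# , ≤-refl , λ w → ≤-reflexive (solve 0 (con (+ 0) :* con (+ 0) := con (+ 0) :* con (+ 0)) refl)
  ∙²-bounded {suc n} b with ∙²-bounded (λ i → b (suc i))
  ... | B , 0≤B , h = B′ , +-nonNeg (+-nonNeg 0≤B 0≤B) (+-nonNeg (0≤x*x b₀) (0≤x*x b₀)) , λ w →
    let w₀ = w zero
        p  = (λ i → b (suc i)) ∙ (λ i → w (suc i))
        q  = (λ i → w (suc i)) ∙ (λ i → w (suc i))
    in 0≤y-x⇒x≤y (≤-resp-≈ refl
         (solve 5 (λ B b w p q →
             ((B :* q :+ :- (p :* p)) :+ (B :* q :+ :- (p :* p)) :+ (b :* w :+ :- p) :* (b :* w :+ :- p))
               :+ (B :+ B) :* (w :* w) :+ (b :* b :+ b :* b) :* q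
             := (B :+ B :+ (b :* b :+ b :* b)) :* (w :* w :+ q) :+ :- ((b :* w :+ p) :* (b :* w :+ p)))
           refl B b₀ w₀ p q)
         (+-nonNeg (+-nonNeg
           (+-nonNeg (+-nonNeg (x≤y⇒0≤y-x (h λ i → w (suc i))) (x≤y⇒0≤y-x (h λ i → w (suc i))))
                     (0≤x*x (b₀ * w₀ + - p)))
           (*-nonNeg (+-nonNeg 0≤B 0≤B) (0≤x*x w₀)))
           (*-nonNeg (+-nonNeg (0≤x*x b₀) (0≤x*x b₀)) (0≤v∙v λ i → w (suc i)))))
    where
    b₀ = b zero
    B′ = B + B + (b₀ * b₀ + b₀ * b₀)

  -- Elimination by Schur complements.

  module Schur {n} (M : SquareMatrix (suc n)) (M-sym : Symmetric M) where

    pivot : Carrier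
    pivot = M zero zero

    border : Vector Carrier n
    border i = M (suc i) zero

    block : SquareMatrix n
    block i j = M (suc i) (suc j)

    -- The Schur complement block − border·borderᵀ/pivot, multiplied by the pivot
    -- to avoid division.
    complement : SquareMatrix n
    complement i j = pivot * block i j + - (border i * border j)

    complement-sym : Symmetric complement
    complement-sym i j = +-cong (*-congˡ (M-sym (suc i) (suc j))) (-‿cong (*-comm (border i) (border j)))

    form-complement : ∀ w → form complement w ≈ pivot * form block w + - ((border ∙ w) * (border ∙ w))
    form-complement w = ≈.begin
      sum (λ i → w i * sum (λ j → complement i j * w j))
        ≈.≈⟨ sum-cong (λ i → *-congˡ (trans
               (sum-cong λ j → solve 5 (λ a c b b′ w →
                   (a :* c :+ :- (b :* b′)) :* w := a :* (c :* w) :+ (:- b) :* (b′ :* w))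
                 refl pivot (block i j) (border i) (border j) (w j))
               (∑-linear pivot (- border i) (λ j → block i j * w j) (λ j → border j * w j)))) ⟩
      sum (λ i → w i * (pivot * (block ⊡ w) i + - border i * β))
        ≈.≈⟨ sum-cong (λ i → solve 5 (λ w a y b β →
               w :* (a :* y :+ (:- b) :* β) := a :* (w :* y) :+ (:- β) :* (b :* w))
             refl (w i) pivot ((block ⊡ w) i) (border i) β) ⟩
      sum (λ i → pivot * (w i * (block ⊡ w) i) + - β * (border i * w i))
        ≈.≈⟨ ∑-linear pivot (- β) (λ i → w i * (block ⊡ w) i) (λ i → border i * w i) ⟩
      pivot * form block w + - β * β
        ≈.≈⟨ solve 2 (λ x β → x :+ (:- β) :* β := x :+ :- (β :* β)) refl (pivot * form block w) β ⟩
      pivot * form block w + - (β * β) ≈.∎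
      where β = border ∙ w

    form-suc : ∀ v → let t = v zero; w = λ i → v (suc i); β = border ∙ w in
      form M v ≈ pivot * (t * t) + (t * β + t * β) + form block w
    form-suc v = ≈.begin
      t * (pivot * t + sum (λ j → M zero (suc j) * w j)) + sum (λ i → w i * (border i * t + (block ⊡ w) i))
        ≈.≈⟨ +-cong (*-congˡ (+-congˡ (sum-cong λ j → *-congʳ (M-sym zero (suc j)))))
               (trans (sum-cong λ i → solve 4 (λ w b t y →
                   w :* (b :* t :+ y) := t :* (b :* w) :+ con (+ 1) :* (w :* y))
                 refl (w i) (border i) t ((block ⊡ w) i))
               (∑-linear t 1# (λ i → border i * w i) (λ i → w i * (block ⊡ w) i))) ⟩
      t * (pivot * t + β) + (t * β + 1# * form block w)
        ≈.≈⟨ solve 4 (λ t a β q → t :* (a :* t :+ β) :+ (t :* β :+ con (+ 1) :* q)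
               := a :* (t :* t) :+ (t :* β :+ t :* β) :+ q) refl t pivot β (form block w) ⟩
      pivot * (t * t) + (t * β + t * β) + form block w ≈.∎
      where
      t = v zero
      w : Vector Carrier n
      w i = v (suc i)
      β = border ∙ w

    -- With a positive pivot this transfers definiteness both ways: solving s = 0 lifts a
    -- nonpositive vector of `complement` to `M`, and s² ≥ 0 lifts lower bounds.
    complete-square : ∀ v → let t = v zero; w = λ i → v (suc i); s = pivot * t + border ∙ w in
      pivot * form M v ≈ s * s + form complement w
    complete-square v = ≈.begin
      pivot * form M v
        ≈.≈⟨ *-congˡ (form-suc v) ⟩
      pivot * (pivot * (t * t) + (t * β + t * β) + form block w)
        ≈.≈⟨ solve 4 (λ a t β q → a :* (a :* (t :* t) :+ (t :* β :+ t :* β) :+ q)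
               := (a :* t :+ β) :* (a :* t :+ β) :+ (a :* q :+ :- (β :* β))) refl pivot t β (form block w) ⟩
      (pivot * t + β) * (pivot * t + β) + (pivot * form block w + - (β * β))
        ≈.≈⟨ +-congˡ (form-complement w) ⟨
      (pivot * t + β) * (pivot * t + β) + form complement w ≈.∎
      where
      t = v zero
      w : Vector Carrier n
      w i = v (suc i)
      β = border ∙ w

    nonPosPivot⇒nonPositiveVector : pivot ≤ 0# → NonPositiveVector M
    nonPosPivot⇒nonPositiveVector pivot≤0 = record
      { vector  = e₀
      ; nonZero = λ h → 1≰0 (≤-resp-≈ (trans (+-cong (*-identityˡ 1#) (sum-0 {n} λ i → zeroˡ 0#)) (+-identityʳ 1#)) refl h)
      ; nonPos  = ≤-resp-≈ (sym eq) refl pivot≤0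
      }
      where
      e₀ : Vector Carrier (suc n)
      e₀ zero    = 1#
      e₀ (suc _) = 0#
      eq : form M e₀ ≈ pivot
      eq = ≈.begin
        form M e₀
          ≈.≈⟨ form-suc e₀ ⟩
        pivot * (1# * 1#) + (1# * (border ∙ (λ _ → 0#)) + 1# * (border ∙ (λ _ → 0#))) + form block (λ _ → 0#)
          ≈.≈⟨ +-cong (+-congˡ (+-cong (*-congˡ z) (*-congˡ z))) (sum-0 {n} λ i → zeroˡ _) ⟩
        pivot * (1# * 1#) + (1# * 0# + 1# * 0#) + 0#
          ≈.≈⟨ solve 1 (λ a → a :* (con (+ 1) :* con (+ 1)) :+ (con (+ 1) :* con (+ 0) :+ con (+ 1) :* con (+ 0)) :+ con (+ 0) := a) refl pivot ⟩
        pivot ≈.∎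
        where z = sum-0 {n} λ i → zeroʳ (border i)

    extend-nonPositiveVector : ¬ (pivot ≤ 0#) → NonPositiveVector complement → NonPositiveVector M
    extend-nonPositiveVector pivot≰0 record { vector = w ; nonZero = w≠0 ; nonPos = form≤0 } = record
      { vector  = v
      ; nonZero = λ h → *-pos (*-pos pivot≰0 pivot≰0) w≠0 (≤-trans (≤-resp-≈ (+-identityˡ _)
          (+-congˡ (sym aw∙aw)) (+-mono-≤ (0≤x*x (- β)) ≤-refl)) h)
      ; nonPos  = 0≤-x⇒x≤0 (*-cancel-nonNeg pivot≰0 (≤-resp-≈ refl eq
          (*-nonNeg (*-nonNeg 0≤pivot 0≤pivot) (x≤0⇒0≤-x form≤0))))
      }
      where
      0≤pivot = ≰⇒≥ pivot≰0
      β = border ∙ w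
      aw : Vector Carrier n
      aw i = pivot * w i
      -- The solution (-β/pivot, w) of s = 0, multiplied by the pivot to avoid division.
      v : Vector Carrier (suc n)
      v zero    = - β
      v (suc i) = aw i
      aw∙aw : aw ∙ aw ≈ pivot * pivot * (w ∙ w)
      aw∙aw = trans (sum-cong λ i → solve 2 (λ a w → a :* w :* (a :* w) := a :* a :* (w :* w)) refl pivot (w i))
        (sym (*-distribˡ-sum (pivot * pivot) (λ i → w i * w i)))
      pull : ∀ u → u ∙ aw ≈ pivot * (u ∙ w)
      pull u = trans (sum-cong λ i → solve 3 (λ a u w → u :* (a :* w) := a :* (u :* w)) refl pivot (u i) (w i))
        (sym (*-distribˡ-sum pivot (λ i → u i * w i)))
      form-aw : form complement aw ≈ pivot * pivot * form complement w
      form-aw = ≈.begin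
        aw ∙ (complement ⊡ aw)
          ≈.≈⟨ sum-cong (λ i → *-congˡ (pull (complement i))) ⟩
        sum (λ i → pivot * w i * (pivot * (complement ⊡ w) i))
          ≈.≈⟨ sum-cong (λ i → solve 3 (λ a w y → a :* w :* (a :* y) := a :* a :* (w :* y)) refl pivot (w i) ((complement ⊡ w) i)) ⟩
        sum (λ i → pivot * pivot * (w i * (complement ⊡ w) i))
          ≈.≈⟨ *-distribˡ-sum (pivot * pivot) (λ i → w i * (complement ⊡ w) i) ⟨
        pivot * pivot * form complement w ≈.∎
      eq : pivot * pivot * - form complement w ≈ pivot * - form M v
      eq = ≈.begin
        pivot * pivot * - form complement w
          ≈.≈⟨ solve 3 (λ a q β → a :* a :* :- q := :- ((a :* :- β :+ a :* β) :* (a :* :- β :+ a :* β) :+ a :* a :* q)) refl pivot (form complement w) β ⟩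
        - ((pivot * - β + pivot * β) * (pivot * - β + pivot * β) + pivot * pivot * form complement w)
          ≈.≈⟨ -‿cong (+-cong (*-cong (+-congˡ (pull border)) (+-congˡ (pull border))) form-aw) ⟨
        - ((pivot * - β + border ∙ aw) * (pivot * - β + border ∙ aw) + form complement aw)
          ≈.≈⟨ -‿cong (complete-square v) ⟨
        - (pivot * form M v)
          ≈.≈⟨ solve 2 (λ a q → :- (a :* q) := a :* :- q) refl pivot (form M v) ⟩
        pivot * - form M v ≈.∎

    -- Write a for the pivot. From a·t = s - β follows a²(t² + r) ≤ 2s² + 2β² + a²r ≤ 2s² + D·r,
    -- where D = 2B + a² by `∙²-bounded`. Multiplying by ε and using ε·r ≤ c·q leaves at most C·(s²
    -- + q), which is C·a times the form of `M`. The summands of `slack` are the losses in these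
    -- estimates.
    extend-positiveDefinite : ¬ (pivot ≤ 0#) → PositiveDefinite complement → PositiveDefinite M
    extend-positiveDefinite pivot≰0 P with ∙²-bounded border
    ... | B , 0≤B , β²≤ = record
      { ε = ε * (pivot * pivot)
      ; c = C * pivot
      ; ε≰0 = *-pos ε≰0 (*-pos pivot≰0 pivot≰0)
      ; 0≤c = *-nonNeg (+-nonNeg (+-nonNeg 0≤ε 0≤ε) (*-nonNeg 0≤D 0≤c)) 0≤pivot
      ; nonNeg = λ v → *-cancel-nonNeg pivot≰0 (≤-resp-≈ refl (sym (complete-square v))
          (+-nonNeg (0≤x*x _) (nonNeg _)))
      ; bounded = λ v → 0≤y-x⇒x≤y (≤-resp-≈ refl (sym (eq v)) (main v))
      }
      where
      open PositiveDefinite P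
      0≤pivot = ≰⇒≥ pivot≰0
      0≤ε = ≰⇒≥ ε≰0
      D = B + B + pivot * pivot
      C = ε + ε + D * c
      0≤D : 0# ≤ D
      0≤D = +-nonNeg (+-nonNeg 0≤B 0≤B) (0≤x*x pivot)
      module _ (v : Vector Carrier (suc n)) where
        t = v zero
        w : Vector Carrier n
        w i = v (suc i)
        β = border ∙ w
        s = pivot * t + β
        q = form complement w
        r = w ∙ w
        slack = (D * (c * q + - (ε * r)) + D * c * (s * s) + (ε + ε) * q)
              + ((ε + ε) * (B * r + - (β * β)) + ε * ((s + β) * (s + β)))
        main : 0# ≤ slack
        main = +-nonNeg
          (+-nonNeg (+-nonNeg (*-nonNeg 0≤D (x≤y⇒0≤y-x (bounded w))) (*-nonNeg (*-nonNeg 0≤D 0≤c) (0≤x*x s)))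
                    (*-nonNeg (+-nonNeg 0≤ε 0≤ε) (nonNeg w)))
          (+-nonNeg (*-nonNeg (+-nonNeg 0≤ε 0≤ε) (x≤y⇒0≤y-x (β²≤ w))) (*-nonNeg 0≤ε (0≤x*x (s + β))))
        eq : C * pivot * form M v + - (ε * (pivot * pivot) * (t * t + r)) ≈ slack
        eq = ≈.begin
          C * pivot * form M v + - (ε * (pivot * pivot) * (t * t + r))
            ≈.≈⟨ +-congʳ (trans (*-assoc C pivot (form M v)) (*-congˡ (complete-square v))) ⟩
          C * (s * s + q) + - (ε * (pivot * pivot) * (t * t + r))
            ≈.≈⟨ solve 8 (λ e c B a t β q r →
              let D = B :+ B :+ a :* a; s = a :* t :+ β in
              (e :+ e :+ D :* c) :* (s :* s :+ q) :+ :- (e :* (a :* a) :* (t :* t :+ r))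
              := (D :* (c :* q :+ :- (e :* r)) :+ D :* c :* (s :* s) :+ (e :+ e) :* q)
                 :+ ((e :+ e) :* (B :* r :+ :- (β :* β)) :+ e :* ((s :+ β) :* (s :+ β))))
              refl ε c B pivot t β q r ⟩
          slack ≈.∎

  -- In continuation-passing style, so that the order may be decidable (R arbitrary)
  -- or only classically so (R = ⊥).
  definiteness : ∀ {ℓ} {R : Set ℓ} → (∀ x → (x ≤ 0# → R) → (¬ (x ≤ 0#) → R) → R) →
                 ∀ {n} (M : SquareMatrix n) → Symmetric M →
                 (NonPositiveVector M → R) → (PositiveDefinite M → R) → R
  definiteness decide {zero}  M M-sym _ posDef = posDef record
    { ε = 1# ; c = 1# ; ε≰0 = 1≰0 ; 0≤c = ≰⇒≥ 1≰0 ; nonNeg = λ _ → ≤-refl ; bounded = λ _ → ≤-refl }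
  definiteness decide {suc n} M M-sym nonPos posDef = decide pivot
    (λ pivot≤0 → nonPos (nonPosPivot⇒nonPositiveVector pivot≤0))
    (λ pivot≰0 → definiteness decide complement complement-sym
      (λ x → nonPos (extend-nonPositiveVector pivot≰0 x))
      (λ x → posDef (extend-positiveDefinite pivot≰0 x)))
    where open Schur M M-sym

  -- Testing nonnegativity on (r+1)v − s·Mv, where s = |Mv|² and r is the form at Mv,
  -- gives (r+2)s² ≤ 0.
  isotropic⇒kernel : ∀ {n} (M : SquareMatrix n) → Symmetric M → (∀ v → 0# ≤ form M v) →
                     ∀ v → form M v ≤ 0# → (M ⊡ v) ∙ (M ⊡ v) ≤ 0#
  isotropic⇒kernel M M-sym M≥0 v v≤0 = x*x≤0⇒x≤0 (0≤-x⇒x≤0 (≤-resp-≈ refl eq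
    (+-nonNeg
      (+-nonNeg (M≥0 (λ i → x * v i + y * w i)) (*-nonNeg (0≤x*x x) (x≤0⇒0≤-x v≤0)))
      (*-nonNeg 0≤x (0≤x*x s)))))
    where
    w = M ⊡ v
    s = w ∙ w
    r = form M w
    x = r + 1#
    y = - s
    0≤x : 0# ≤ x
    0≤x = +-nonNeg (M≥0 w) (≰⇒≥ 1≰0)
    eq : form M (λ i → x * v i + y * w i) + x * x * - form M v + x * (s * s) ≈ - (s * s)
    eq = trans (+-congʳ (+-congʳ (form-linear M M-sym x y v w)))
      (solve 3 (λ r s p → let x = r :+ con (+ 1); y = :- s in
         x :* x :* p :+ (x :* y :* s :+ x :* y :* s) :+ y :* y :* r :+ x :* x :* :- p :+ x :* (s :* s)
         := :- (s :* s)) refl r s (form M v))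

  _·1-_ : ∀ {n} → Carrier → SquareMatrix n → SquareMatrix n
  (x ·1- M) i j = x * δ i j + - M i j

  ·1--⊡ : ∀ {n} x (M : SquareMatrix n) v i → ((x ·1- M) ⊡ v) i ≈ x * v i + - (M ⊡ v) i
  ·1--⊡ x M v i = ≈.begin
    sum (λ j → (x * δ i j + - M i j) * v j)
      ≈.≈⟨ sum-cong (λ j → solve 4 (λ x d m v → (x :* d :+ :- m) :* v := x :* (d :* v) :+ (:- con (+ 1)) :* (m :* v))
             refl x (δ i j) (M i j) (v j)) ⟩
    sum (λ j → x * (δ i j * v j) + - 1# * (M i j * v j))
      ≈.≈⟨ ∑-linear x (- 1#) (λ j → δ i j * v j) (λ j → M i j * v j) ⟩
    x * sum (λ j → δ i j * v j) + - 1# * (M ⊡ v) i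
      ≈.≈⟨ +-cong (*-congˡ (∑-δ i v)) (solve 1 (λ y → (:- con (+ 1)) :* y := :- y) refl ((M ⊡ v) i)) ⟩
    x * v i + - (M ⊡ v) i ≈.∎

  form-·1- : ∀ {n} x (M : SquareMatrix n) v → form (x ·1- M) v ≈ x * (v ∙ v) + - form M v
  form-·1- x M v = ≈.begin
    sum (λ i → v i * ((x ·1- M) ⊡ v) i)
      ≈.≈⟨ sum-cong (λ i → trans (*-congˡ (·1--⊡ x M v i))
             (solve 3 (λ x v y → v :* (x :* v :+ :- y) := x :* (v :* v) :+ (:- con (+ 1)) :* (v :* y)) refl x (v i) ((M ⊡ v) i))) ⟩
    sum (λ i → x * (v i * v i) + - 1# * (v i * (M ⊡ v) i))
      ≈.≈⟨ ∑-linear x (- 1#) (λ i → v i * v i) (λ i → v i * (M ⊡ v) i) ⟩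
    x * (v ∙ v) + - 1# * form M v
      ≈.≈⟨ +-congˡ (solve 1 (λ y → (:- con (+ 1)) :* y := :- y) refl (form M v)) ⟩
    x * (v ∙ v) + - form M v ≈.∎

  form-·1-≥0 : ∀ {n} x (M : SquareMatrix n) v → 0# ≤ x * (v ∙ v) + - form M v → 0# ≤ form (x ·1- M) v
  form-·1-≥0 x M v = ≤-resp-≈ refl (sym (form-·1- x M v))

  ·1--sym : ∀ {n} x (M : SquareMatrix n) → Symmetric M → Symmetric (x ·1- M)
  ·1--sym x M M-sym i j = +-cong (*-congˡ (reflexive (δ-sym i j))) (-‿cong (M-sym i j))
    where
    δ-sym : ∀ {n} (i j : Fin n) → δ i j ≡ δ j i
    δ-sym zero    zero    = ≡.refl
    δ-sym zero    (suc j) = ≡.refl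
    δ-sym (suc i) zero    = ≡.refl
    δ-sym (suc i) (suc j) = δ-sym i j

  -- What the bisection of the top of the spectrum of S yields: top bounds the form of S, and
  -- each lower k, which is at most width k below top, is reached by the Rayleigh quotient of
  -- vector k.
  record TopOfSpectrum {n} (S : SquareMatrix n) (top : Carrier) : Set where
    field
      vector        : ℕ → Vector Carrier n
      lower width   : ℕ → Carrier
      inverse       : ℕ → Carrier
      form≤top      : ∀ v → 0# ≤ top * (v ∙ v) + - form S v
      top≤          : ∀ k → top ≤ lower k + width k
      lower≤form    : ∀ k → lower k * (vector k ∙ vector k) + - form S (vector k) ≤ 0#
      0≤inverse     : ∀ k → 0# ≤ inverse k
      inverse-*     : ∀ k → inverse k * (vector k ∙ vector k) ≈ 1#
      width→0       : ∀ ε c → (∀ k → ε ≤ c * width k) → ε ≤ 0#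

  -- Elimination is applied to top·1 - S. Definiteness would give ε ≤ c·width k for every k, against
  -- ε > 0. The remaining outcome is a nonzero v on which this nonnegative form is at most 0, hence
  -- isotropic, and `isotropic⇒kernel` puts it into the kernel.
  eigenvector : ∀ {n} (S : SquareMatrix n) → Symmetric S → ∀ {top} → TopOfSpectrum S top →
                ¬ ¬ (∃ λ v → ¬ (v ∙ v ≤ 0#) × (∀ i → (S ⊡ v) i ≈ top * v i))
  -- The case distinction with target `⊥`: the first branch is itself the refutation of `x ≤ 0#`
  -- that the second one expects.
  eigenvector S S-sym {top} T found = definiteness (λ x f g → g λ x≤0 → f x≤0) M M-sym
    (λ N → let open NonPositiveVector N renaming (vector to v) in found (v , nonZero , λ i →
      sym (x-y≈0⇒x≈y _ _ (trans (sym (·1--⊡ top S v i))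
        (v∙v≤0⇒v≈0 (M ⊡ v) (isotropic⇒kernel M M-sym M≥0 v nonPos) i)))))
    (λ P → let open PositiveDefinite P in ε≰0 (width→0 ε c λ k →
      cancel-scale ε c top (lower k) (width k) (vector k ∙ vector k) (form S (vector k)) (inverse k)
        0≤c (≤-resp-≈ refl (*-congˡ (form-·1- top S (vector k))) (bounded (vector k)))
        (0≤v∙v (vector k)) (top≤ k) (lower≤form k) (0≤inverse k) (inverse-* k)))
    where
    open TopOfSpectrum T
    M = top ·1- S
    M-sym = ·1--sym top S S-sym
    M≥0 : ∀ v → 0# ≤ form M v
    M≥0 v = form-·1-≥0 top S v (form≤top v)

-- Orthogonal systems over a complexification, and Bessel's inequality.

-- Norms enter as `re (z * conj z)`, so no imaginary part is mentioned. `inverse` is doubly negated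
-- because a real reciprocal takes an explicit positive lower bound, while `¬ (x ≤ 0#)` provides one
-- only classically.
record Complexification (K : OrderedRing) : Set₁ where
  private module K = OrderedRing K
  field
    complexRing : CommutativeRing 0ℓ 0ℓ
  open CommutativeRing complexRing public hiding (zero)
  field
    re          : Carrier → K.Carrier
    ι           : K.Carrier → Carrier
    conj        : Carrier → Carrier
    re-cong     : ∀ {z w} → z ≈ w → re z K.≈ re w
    re-+        : ∀ z w → re (z + w) K.≈ re z K.+ re w
    re-0        : re 0# K.≈ K.0#
    re-ι*       : ∀ a z → re (ι a * z) K.≈ a K.* re z
    re-1        : re 1# K.≈ K.1#
    ι-cong      : ∀ {a b} → a K.≈ b → ι a ≈ ι b
    ι-+         : ∀ a b → ι (a K.+ b) ≈ ι a + ι b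
    ι-0         : ι K.0# ≈ 0#
    ι-1         : ι K.1# ≈ 1#
    ι-*         : ∀ a b → ι (a K.* b) ≈ ι a * ι b
    conj-cong   : ∀ {z w} → z ≈ w → conj z ≈ conj w
    conj-+      : ∀ z w → conj (z + w) ≈ conj z + conj w
    conj-0      : conj 0# ≈ 0#
    conj-*      : ∀ z w → conj (z * w) ≈ conj z * conj w
    conj-conj   : ∀ z → conj (conj z) ≈ z
    conj-ι      : ∀ a → conj (ι a) ≈ ι a
    0≤z*z̄       : ∀ z → K.0# K.≤ re (z * conj z)
    z*z̄≤0⇒z≈0   : ∀ {z} → re (z * conj z) K.≤ K.0# → z ≈ 0#
    z*z̄-real    : ∀ z → ι (re (z * conj z)) ≈ z * conj z
    ≈-stable    : ∀ {z w} → ¬ ¬ (z ≈ w) → z ≈ w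
    inverse     : ∀ {x} → ¬ (x K.≤ K.0#) → ¬ ¬ (∃ λ y → K.0# K.≤ y × y K.* x K.≈ K.1#)

record LinearSubspace (C : CommutativeRing 0ℓ 0ℓ) (n : ℕ) : Set₁ where
  open CommutativeRing C hiding (zero)
  field
    _∈      : Vector Carrier n → Set
    resp     : ∀ {v w} → (∀ i → v i ≈ w i) → v ∈ → w ∈
    0-closed : (λ _ → 0#) ∈
    +-closed : ∀ {v w} → v ∈ → w ∈ → (λ i → v i + w i) ∈
    *-closed : ∀ a {v} → v ∈ → (λ i → a * v i) ∈

module HermitianSystems {K : OrderedRing} (𝒞 : Complexification K) where

  private
    module K  = OrderedRing K
    module KP = OrderedRingProperties K
    module KQ = QuadraticForms K
  open Complexification 𝒞
  open FiniteSums semiring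
  open IntegerCoefficientSolver complexRing using (solve; _:=_; _:+_; _:*_; :-_; con)
  import Relation.Binary.Reasoning.Setoid setoid as ≈
  import Relation.Binary.Reasoning.Setoid K.setoid as K≈

  V : ℕ → Set
  V n = Vector Carrier n

  ⟪_,_⟫ : ∀ {n} → V n → V n → Carrier
  ⟪ v , w ⟫ = v ∙ λ i → conj (w i)

  ∥_∥² : ∀ {n} → V n → K.Carrier
  ∥ v ∥² = re ⟪ v , v ⟫

  re-sum : ∀ {n} (f : V n) → re (sum f) K.≈ KQ.sum (λ i → re (f i))
  re-sum = sum-homo +-rawMonoid K.+-monoid re re-0 re-+

  ι-sum : ∀ {n} (f : Vector K.Carrier n) → ι (KQ.sum f) ≈ sum (λ i → ι (f i))
  ι-sum = sum-homo K.+-rawMonoid +-monoid ι ι-0 ι-+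

  conj-sum : ∀ {n} (f : V n) → conj (sum f) ≈ sum (λ i → conj (f i))
  conj-sum = sum-homo +-rawMonoid +-monoid conj conj-0 conj-+

  ⟪,⟫-cong : ∀ {n} {v v′ w w′ : V n} → (∀ i → v i ≈ v′ i) → (∀ i → w i ≈ w′ i) → ⟪ v , w ⟫ ≈ ⟪ v′ , w′ ⟫
  ⟪,⟫-cong v≈ w≈ = sum-cong λ i → *-cong (v≈ i) (conj-cong (w≈ i))

  ⟪,⟫-conj : ∀ {n} (v w : V n) → conj ⟪ v , w ⟫ ≈ ⟪ w , v ⟫
  ⟪,⟫-conj v w = trans (conj-sum (λ i → v i * conj (w i)))
    (sum-cong λ i → trans (conj-* (v i) (conj (w i))) (trans (*-congˡ (conj-conj (w i))) (*-comm _ _)))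

  ⟪,⟫-linearˡ : ∀ {n} x y (u v w : V n) → ⟪ (λ i → x * u i + y * v i) , w ⟫ ≈ x * ⟪ u , w ⟫ + y * ⟪ v , w ⟫
  ⟪,⟫-linearˡ x y u v w = trans
    (sum-cong λ i → solve 5 (λ x y u v w → (x :* u :+ y :* v) :* w := x :* (u :* w) :+ y :* (v :* w))
      refl x y (u i) (v i) (conj (w i)))
    (∑-linear x y (λ i → u i * conj (w i)) (λ i → v i * conj (w i)))

  ⟪,⟫-∑ˡ : ∀ {k n} (a : V k) (u : Fin k → V n) w →
           ⟪ (λ x → sum λ i → a i * u i x) , w ⟫ ≈ sum (λ i → a i * ⟪ u i , w ⟫)
  ⟪,⟫-∑ˡ a u w = ≈.begin
    sum (λ x → sum (λ i → a i * u i x) * conj (w x))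
      ≈.≈⟨ sum-cong (λ x → *-distribʳ-sum (conj (w x)) (λ i → a i * u i x)) ⟩
    sum (λ x → sum (λ i → a i * u i x * conj (w x)))
      ≈.≈⟨ ∑-comm (λ x i → a i * u i x * conj (w x)) ⟩
    sum (λ i → sum (λ x → a i * u i x * conj (w x)))
      ≈.≈⟨ sum-cong (λ i → trans (sum-cong λ x → *-assoc (a i) (u i x) (conj (w x)))
             (sym (*-distribˡ-sum (a i) (λ x → u i x * conj (w x))))) ⟩
    sum (λ i → a i * ⟪ u i , w ⟫) ≈.∎

  0≤∥v∥² : ∀ {n} (v : V n) → K.0# K.≤ ∥ v ∥²
  0≤∥v∥² v = KP.≤-resp-≈ K.refl (K.sym (re-sum (λ i → v i * conj (v i)))) (KQ.sum-nonNeg λ i → 0≤z*z̄ (v i))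

  ∥v∥²≤0⇒v≈0 : ∀ {n} (v : V n) → ∥ v ∥² K.≤ K.0# → ∀ i → v i ≈ 0#
  ∥v∥²≤0⇒v≈0 v h i = z*z̄≤0⇒z≈0 (K.≤-trans (KQ.term≤sum (λ j → 0≤z*z̄ (v j)) i)
    (KP.≤-resp-≈ (re-sum (λ i → v i * conj (v i))) K.refl h))

  ∥v∥²-real : ∀ {n} (v : V n) → ι ∥ v ∥² ≈ ⟪ v , v ⟫
  ∥v∥²-real v = trans (ι-cong (re-sum (λ i → v i * conj (v i))))
    (trans (ι-sum (λ i → re (v i * conj (v i)))) (sum-cong λ i → z*z̄-real (v i)))

  -- Orthogonal vectors uᵢ together with the scalars cᵢ = 1/|uᵢ|², which replace the square
  -- roots of an orthonormal system.
  record System (k n : ℕ) : Set where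
    field
      u      : Fin k → V n
      c      : Fin k → K.Carrier
      0≤c    : ∀ i → K.0# K.≤ c i
      normal : ∀ i → ι (c i) * ⟪ u i , u i ⟫ ≈ 1#
      orth   : ∀ i j → i ≢ j → ⟪ u i , u j ⟫ ≈ 0#

    -- The coefficient along `u i` of the orthogonal projection onto the span of the system.
    φ : Fin k → V n → Carrier
    φ i v = ι (c i) * ⟪ v , u i ⟫

    φ-u : ∀ i j → φ i (u j) ≈ δ i j
    φ-u i j with i Fin.≟ j
    ... | yes ≡.refl = normal i
    ... | no  i≢j    = trans (*-congˡ (orth j i λ j≡i → i≢j (≡.sym j≡i))) (zeroʳ (ι (c i)))

    φ-cong : ∀ i {v w} → (∀ x → v x ≈ w x) → φ i v ≈ φ i w
    φ-cong i v≈w = *-congˡ (⟪,⟫-cong v≈w λ _ → refl)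

    φ-linear : ∀ i x y v w → φ i (λ j → x * v j + y * w j) ≈ x * φ i v + y * φ i w
    φ-linear i x y v w = trans (*-congˡ (⟪,⟫-linearˡ x y v w (u i)))
      (solve 5 (λ c x y p q → c :* (x :* p :+ y :* q) := x :* (c :* p) :+ y :* (c :* q))
        refl (ι (c i)) x y ⟪ v , u i ⟫ ⟪ w , u i ⟫)

    φ-∑ : ∀ {m} i (a : V m) (w : Fin m → V n) → φ i (λ x → sum λ j → a j * w j x) ≈ sum (λ j → a j * φ i (w j))
    φ-∑ i a w = trans (*-congˡ (⟪,⟫-∑ˡ a w (u i)))
      (trans (*-distribˡ-sum (ι (c i)) (λ j → a j * ⟪ w j , u i ⟫))
        (sum-cong λ j → solve 3 (λ c a p → c :* (a :* p) := a :* (c :* p)) refl (ι (c i)) (a j) ⟪ w j , u i ⟫))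

    combine : V k → V n
    combine a x = sum λ i → a i * u i x

    φ-combine : ∀ i (a : V k) → φ i (combine a) ≈ a i
    φ-combine i a = trans (φ-∑ i a u)
      (trans (sum-cong λ j → trans (*-congˡ (φ-u i j)) (*-comm (a j) (δ i j))) (∑-δ i a))

    -- Written as 1·v + (-1)·p so that `φ-linear` and the closure properties of subspaces apply
    -- literally.
    residue : V n → V n
    residue v x = 1# * v x + - 1# * combine (λ i → φ i v) x

    residue-orth : ∀ v j → ⟪ residue v , u j ⟫ ≈ 0#
    residue-orth v j = ≈.begin
      ⟪ residue v , u j ⟫
        ≈.≈⟨ *-identityˡ _ ⟨
      1# * ⟪ residue v , u j ⟫
        -- Inserting 1 = c·|u|² for the index j exhibits `φ j` of the residue, which vanishes by
        -- linearity.
        ≈.≈⟨ *-congʳ (normal j) ⟨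
      ι (c j) * ⟪ u j , u j ⟫ * ⟪ residue v , u j ⟫
        ≈.≈⟨ solve 3 (λ c n p → c :* n :* p := n :* (c :* p)) refl (ι (c j)) ⟪ u j , u j ⟫ ⟪ residue v , u j ⟫ ⟩
      ⟪ u j , u j ⟫ * φ j (residue v)
        ≈.≈⟨ *-congˡ (φ-linear j 1# (- 1#) v (combine λ i → φ i v)) ⟩
      ⟪ u j , u j ⟫ * (1# * φ j v + - 1# * φ j (combine λ i → φ i v))
        ≈.≈⟨ *-congˡ (+-congˡ (*-congˡ (φ-combine j λ i → φ i v))) ⟩
      ⟪ u j , u j ⟫ * (1# * φ j v + - 1# * φ j v)
        ≈.≈⟨ solve 2 (λ n p → n :* (con (+ 1) :* p :+ (:- con (+ 1)) :* p) := con (+ 0)) refl ⟪ u j , u j ⟫ (φ j v) ⟩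
      0# ≈.∎

    ≈combine : ∀ v → (∀ x → residue v x ≈ 0#) → ∀ x → v x ≈ combine (λ i → φ i v) x
    ≈combine v r≈0 x = ≈.begin
      v x              ≈.≈⟨ solve 2 (λ v s → v := con (+ 1) :* v :+ (:- con (+ 1)) :* s :+ s) refl (v x) s ⟩
      residue v x + s  ≈.≈⟨ +-congʳ (r≈0 x) ⟩
      0# + s           ≈.≈⟨ +-identityˡ s ⟩
      s                ≈.∎
      where s = combine (λ i → φ i v) x

  emptySystem : ∀ {n} → System 0 n
  emptySystem = record { u = λ () ; c = λ () ; 0≤c = λ () ; normal = λ () ; orth = λ () }

  tailSystem : ∀ {k n} → System (suc k) n → System k n
  tailSystem s = record
    { u = λ i → u (suc i) ; c = λ i → c (suc i) ; 0≤c = λ i → 0≤c (suc i)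
    ; normal = λ i → normal (suc i) ; orth = λ i j i≢j → orth (suc i) (suc j) λ eq → i≢j (Fin.suc-injective eq) }
    where open System s

  -- A Gram-Schmidt step; the doubly negated 1/|r|² forces the doubly negated conclusion. The
  -- propositional equations allow membership in a subspace to be transported to the new system.
  extendSystem : ∀ {k n} (s : System k n) (r : V n) → (∀ j → ⟪ r , System.u s j ⟫ ≈ 0#) →
                 ¬ (∥ r ∥² K.≤ K.0#) → ¬ ¬ (∃ λ (s′ : System (suc k) n) →
                   (System.u s′ zero ≡ r) × (∀ i → System.u s′ (suc i) ≡ System.u s i))
  extendSystem {k} {n} s r r⊥u r≠0 found = inverse r≠0 λ (y , 0≤y , y*∥r∥²) → found (record
    { u = u′
    ; c = λ { zero → y ; (suc i) → c i }
    ; 0≤c = λ { zero → 0≤y ; (suc i) → 0≤c i }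
    ; normal = λ { zero → trans (*-congˡ (sym (∥v∥²-real r)))
                     (trans (sym (ι-* y ∥ r ∥²)) (trans (ι-cong y*∥r∥²) ι-1))
                 ; (suc i) → normal i }
    ; orth = orth′
    } , ≡.refl , λ _ → ≡.refl)
    where
    open System s
    u′ : Fin (suc k) → V n
    u′ zero    = r
    u′ (suc i) = u i
    orth′ : ∀ i j → i ≢ j → ⟪ u′ i , u′ j ⟫ ≈ 0#
    orth′ zero    zero    0≢0 = ⊥-elim (0≢0 ≡.refl)
    orth′ zero    (suc j) _   = r⊥u j
    orth′ (suc i) zero    _   = trans (sym (⟪,⟫-conj r (u i))) (trans (conj-cong (r⊥u i)) conj-0)
    orth′ (suc i) (suc j) i≢j = orth i j λ eq → i≢j (≡.cong suc eq)

  -- Induction on the system: removing from v its component along `u zero` leaves a v′ with the same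
  -- inner products against the other vectors, and by Pythagoras |v|² drops by exactly the first
  -- term of the sum.
  bessel : ∀ {k n} (s : System k n) (v : V n) → let open System s in
           KQ.sum (λ i → c i K.* re (⟪ v , u i ⟫ * conj ⟪ v , u i ⟫)) K.≤ ∥ v ∥²
  bessel {zero}  s v = 0≤∥v∥² v
  bessel {suc k} s v = KP.≤-resp-≈
    (K.+-congˡ (KQ.sum-cong λ i → K.*-congˡ (re-cong (*-cong (same i) (conj-cong (same i))))))
    (K.sym norm-v) (K.+-mono-≤ KP.≤-refl (bessel (tailSystem s) v′))
    where
    open System s
    p = ⟪ v , u zero ⟫
    a = φ zero v
    v′ : V _
    v′ x = 1# * v x + - a * u zero x
    same : ∀ i → ⟪ v′ , u (suc i) ⟫ ≈ ⟪ v , u (suc i) ⟫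
    same i = ≈.begin
      ⟪ v′ , u (suc i) ⟫                                        ≈.≈⟨ ⟪,⟫-linearˡ 1# (- a) v (u zero) (u (suc i)) ⟩
      1# * ⟪ v , u (suc i) ⟫ + - a * ⟪ u zero , u (suc i) ⟫     ≈.≈⟨ +-congˡ (*-congˡ (orth zero (suc i) λ ())) ⟩
      1# * ⟪ v , u (suc i) ⟫ + - a * 0#                         ≈.≈⟨ solve 2 (λ p a → con (+ 1) :* p :+ (:- a) :* con (+ 0) := p) refl _ a ⟩
      ⟪ v , u (suc i) ⟫                                         ≈.∎
    v′⊥u : ⟪ v′ , u zero ⟫ ≈ 0#
    v′⊥u = ≈.begin
      ⟪ v′ , u zero ⟫
        ≈.≈⟨ ⟪,⟫-linearˡ 1# (- a) v (u zero) (u zero) ⟩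
      1# * p + - (ι (c zero) * p) * ⟪ u zero , u zero ⟫
        ≈.≈⟨ solve 3 (λ p c n → con (+ 1) :* p :+ (:- (c :* p)) :* n := p :+ :- (p :* (c :* n))) refl p (ι (c zero)) ⟪ u zero , u zero ⟫ ⟩
      p + - (p * (ι (c zero) * ⟪ u zero , u zero ⟫))
        ≈.≈⟨ +-congˡ (-‿cong (*-congˡ (normal zero))) ⟩
      p + - (p * 1#)
        ≈.≈⟨ solve 1 (λ p → p :+ :- (p :* con (+ 1)) := con (+ 0)) refl p ⟩
      0# ≈.∎
    v≈ : ∀ x → v x ≈ 1# * v′ x + a * u zero x
    v≈ x = solve 3 (λ v a u → v := con (+ 1) :* (con (+ 1) :* v :+ (:- a) :* u) :+ a :* u) refl (v x) a (u zero x)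
    ⟪u,v⟫ : ⟪ u zero , v ⟫ ≈ conj p
    ⟪u,v⟫ = sym (⟪,⟫-conj v (u zero))
    ⟪v,v⟫ : ⟪ v , v ⟫ ≈ ι (c zero) * (p * conj p) + ⟪ v′ , v′ ⟫
    ⟪v,v⟫ = ≈.begin
      ⟪ v , v ⟫
        ≈.≈⟨ ⟪,⟫-cong v≈ (λ _ → refl) ⟩
      ⟪ (λ x → 1# * v′ x + a * u zero x) , v ⟫
        ≈.≈⟨ ⟪,⟫-linearˡ 1# a v′ (u zero) v ⟩
      1# * ⟪ v′ , v ⟫ + a * ⟪ u zero , v ⟫
        ≈.≈⟨ +-cong (*-congˡ ⟪v′,v⟫) (*-congˡ ⟪u,v⟫) ⟩
      1# * ⟪ v′ , v′ ⟫ + ι (c zero) * p * conj p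
        ≈.≈⟨ solve 4 (λ q c p r → con (+ 1) :* q :+ c :* p :* r := c :* (p :* r) :+ q) refl ⟪ v′ , v′ ⟫ (ι (c zero)) p (conj p) ⟩
      ι (c zero) * (p * conj p) + ⟪ v′ , v′ ⟫ ≈.∎
      where
      ⟪v′,v⟫ : ⟪ v′ , v ⟫ ≈ ⟪ v′ , v′ ⟫
      ⟪v′,v⟫ = ≈.begin
        ⟪ v′ , v ⟫
          ≈.≈⟨ ⟪,⟫-conj v v′ ⟨
        conj ⟪ v , v′ ⟫
          ≈.≈⟨ conj-cong (trans (⟪,⟫-cong v≈ (λ _ → refl)) (⟪,⟫-linearˡ 1# a v′ (u zero) v′)) ⟩
        conj (1# * ⟪ v′ , v′ ⟫ + a * ⟪ u zero , v′ ⟫)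
          ≈.≈⟨ conj-cong (+-congˡ (*-congˡ (trans (sym (⟪,⟫-conj v′ (u zero))) (trans (conj-cong v′⊥u) conj-0)))) ⟩
        conj (1# * ⟪ v′ , v′ ⟫ + a * 0#)
          ≈.≈⟨ conj-cong (solve 2 (λ q a → con (+ 1) :* q :+ a :* con (+ 0) := q) refl ⟪ v′ , v′ ⟫ a) ⟩
        conj ⟪ v′ , v′ ⟫
          ≈.≈⟨ ⟪,⟫-conj v′ v′ ⟩
        ⟪ v′ , v′ ⟫ ≈.∎
    norm-v : ∥ v ∥² K.≈ c zero K.* re (p * conj p) K.+ ∥ v′ ∥²
    norm-v = K.trans (re-cong ⟪v,v⟫) (K.trans (re-+ _ _) (K.+-congʳ (re-ι* (c zero) (p * conj p))))

  -- Bessel's inequality for the rows of S, summed over all rows.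
  eigenSystem-bound : ∀ {k n} (S : Fin n → Fin n → K.Carrier) t (s : System k n) →
    (∀ i x → sum (λ y → ι (S x y) * System.u s i y) ≈ ι t * System.u s i x) →
    KQ.sum {k} (λ _ → t K.* t) K.≤ KQ.sum (λ x → KQ.sum λ y → S x y K.* S x y)
  eigenSystem-bound {k} {n} S t s eigen = KP.≤-resp-≈ lhs (KQ.sum-cong λ x → ∥row∥² x)
    (KQ.sum-mono-≤ λ x → bessel s (λ y → ι (S x y)))
    where
    open System s
    ∥row∥² : ∀ x → ∥ (λ y → ι (S x y)) ∥² K.≈ KQ.sum (λ y → S x y K.* S x y)
    ∥row∥² x = K.trans (re-sum (λ y → ι (S x y) * conj (ι (S x y)))) (KQ.sum-cong λ y →
      K.trans (re-cong (*-congˡ (trans (conj-ι (S x y)) (sym (*-identityʳ _)))))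
        (K.trans (re-ι* (S x y) (ι (S x y) * 1#)) (K.*-congˡ (K.trans (re-ι* (S x y) 1#)
          (K.trans (K.*-congˡ re-1) (K.*-identityʳ (S x y)))))))
    N : V n → Fin n → K.Carrier
    N v x = re (v x * conj (v x))
    -- Since S is real, pairing its row x with `u i` gives the conjugate of entry x of S·uᵢ, and
    -- that entry is t·uᵢ(x).
    coefficient : ∀ i x → let p = ⟪ (λ y → ι (S x y)) , u i ⟫ in
                  re (p * conj p) K.≈ t K.* t K.* N (u i) x
    coefficient i x = K.trans (re-cong (≈.begin
      p * conj p
        ≈.≈⟨ *-cong p≈ (trans (conj-cong p≈) (conj-conj (ι t * u i x))) ⟩
      conj (ι t * u i x) * (ι t * u i x)
        ≈.≈⟨ *-congʳ (trans (conj-* (ι t) (u i x)) (*-congʳ (conj-ι t))) ⟩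
      ι t * conj (u i x) * (ι t * u i x)
        ≈.≈⟨ solve 3 (λ t z w → t :* w :* (t :* z) := t :* t :* (z :* w)) refl (ι t) (u i x) (conj (u i x)) ⟩
      ι t * ι t * (u i x * conj (u i x))
        ≈.≈⟨ *-congʳ (ι-* t t) ⟨
      ι (t K.* t) * (u i x * conj (u i x)) ≈.∎))
      (re-ι* (t K.* t) (u i x * conj (u i x)))
      where
      p = ⟪ (λ y → ι (S x y)) , u i ⟫
      p≈ : p ≈ conj (ι t * u i x)
      p≈ = ≈.begin
        sum (λ y → ι (S x y) * conj (u i y))
          ≈.≈⟨ sum-cong (λ y → trans (*-congʳ (sym (conj-ι (S x y)))) (sym (conj-* (ι (S x y)) (u i y)))) ⟩
        sum (λ y → conj (ι (S x y) * u i y))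
          ≈.≈⟨ conj-sum (λ y → ι (S x y) * u i y) ⟨
        conj (sum (λ y → ι (S x y) * u i y))
          ≈.≈⟨ conj-cong (eigen i x) ⟩
        conj (ι t * u i x) ≈.∎
    -- Once the sum over the rows is taken first, c·|u|² = 1 lets every vector of the system
    -- contribute exactly t².
    column : ∀ i → KQ.sum (λ x → c i K.* (t K.* t K.* N (u i) x)) K.≈ t K.* t
    column i = K≈.begin
      KQ.sum (λ x → c i K.* (t K.* t K.* N (u i) x))
        K≈.≈⟨ KQ.sum-cong (λ x → K.trans (K.sym (K.*-assoc (c i) (t K.* t) (N (u i) x)))
                (K.trans (K.*-congʳ (K.*-comm (c i) (t K.* t))) (K.*-assoc (t K.* t) (c i) (N (u i) x)))) ⟩
      KQ.sum (λ x → t K.* t K.* (c i K.* N (u i) x))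
        K≈.≈⟨ KQ.*-distribˡ-sum (t K.* t) (λ x → c i K.* N (u i) x) ⟨
      t K.* t K.* KQ.sum (λ x → c i K.* N (u i) x)
        K≈.≈⟨ K.*-congˡ (KQ.*-distribˡ-sum (c i) (N (u i))) ⟨
      t K.* t K.* (c i K.* KQ.sum (N (u i)))
        K≈.≈⟨ K.*-congˡ (K.*-congˡ (re-sum (λ x → u i x * conj (u i x)))) ⟨
      t K.* t K.* (c i K.* ∥ u i ∥²)
        K≈.≈⟨ K.*-congˡ (K.trans (K.sym (re-ι* (c i) ⟪ u i , u i ⟫)) (K.trans (re-cong (normal i)) re-1)) ⟩
      t K.* t K.* K.1#
        K≈.≈⟨ K.*-identityʳ _ ⟩
      t K.* t K≈.∎
    lhs : KQ.sum (λ x → KQ.sum λ i → c i K.* re (⟪ (λ y → ι (S x y)) , u i ⟫ * conj ⟪ (λ y → ι (S x y)) , u i ⟫))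
          K.≈ KQ.sum {k} (λ _ → t K.* t)
    lhs = K.trans (KQ.sum-cong λ x → KQ.sum-cong λ i → K.*-congˡ (coefficient i x))
      (K.trans (KQ.∑-comm (λ x i → c i K.* (t K.* t K.* N (u i) x))) (KQ.sum-cong column))

-- Invariant subspaces of a permutation action.

module PermutationAction {K : OrderedRing} (𝒞 : Complexification K) {a ℓ} (G : Group a ℓ) {n : ℕ}
  (σ : Group.Carrier G → Fin n → Fin n)
  (σ-cong : ∀ {g h} → Group._≈_ G g h → ∀ x → σ g x ≡ σ h x)
  (σ-∙ : ∀ g h x → σ (Group._∙_ G g h) x ≡ σ h (σ g x))
  (σ-ε : ∀ x → σ (Group.ε G) x ≡ x)
  where

  private
    module G  = Group G
    module K  = OrderedRing K
    module KP = OrderedRingProperties K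
    module KQ = QuadraticForms K
  open Complexification 𝒞
  open FiniteSums semiring
  open HermitianSystems 𝒞
  import Relation.Binary.Reasoning.Setoid setoid as ≈

  Subspace : ℕ → Set₁
  Subspace = LinearSubspace complexRing

  -- A left action on functions, because `σ-∙` makes σ a right action on points.
  act : G.Carrier → V n → V n
  act g v x = v (σ g x)

  Invariant : Subspace n → Set a
  Invariant W = ∀ g {v} → v ∈ → act g v ∈
    where open LinearSubspace W

  NonZero : ∀ {k} → Subspace k → Set
  NonZero W = ∃ λ v → v ∈ × ¬ (∀ i → v i ≈ 0#)
    where open LinearSubspace W

  -- Plays the role of dim W ≥ k, and its negation that of dim W < k.
  SystemIn : ∀ {n} → Subspace n → ℕ → Set
  SystemIn {n} W k = ∃ λ (s : System k n) → ∀ i → System.u s i ∈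
    where open LinearSubspace W

  sum-closed : ∀ {n k} (W : Subspace n) (b : V k) (w : Fin k → V n) →
               (∀ i → LinearSubspace._∈ W (w i)) → LinearSubspace._∈ W (λ x → sum λ i → b i * w i x)
  sum-closed {k = zero}  W b w w∈ = LinearSubspace.0-closed W
  sum-closed {k = suc k} W b w w∈ = +-closed (*-closed (b zero) (w∈ zero))
    (sum-closed W (λ i → b (suc i)) (λ i → w (suc i)) λ i → w∈ (suc i))
    where open LinearSubspace W

  -- A nonzero residue of v would lie in W, orthogonal to the system, and enlarge it. That the norm
  -- of the residue is at most 0 is a stable statement, so the merely classical enlargement is
  -- enough.
  maximal⇒complete : ∀ {k n} (W : Subspace n) → ¬ SystemIn W (suc k) → ((s , _) : SystemIn W k) →
    ∀ {v} → LinearSubspace._∈ W v → ∀ x → v x ≈ System.combine s (λ i → System.φ s i v) x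
  maximal⇒complete W maximal (s , u∈) {v} v∈ = ≈combine v (∥v∥²≤0⇒v≈0 (residue v)
    (K.≤-stable λ r≰0 → extendSystem s (residue v) (residue-orth v) r≰0 λ (s′ , u₀ , u₊) →
      maximal (s′ , λ { zero    → ≡.subst _∈ (≡.sym u₀) residue∈
                      ; (suc i) → ≡.subst _∈ (≡.sym (u₊ i)) (u∈ i) })))
    where
    open System s
    open LinearSubspace W
    residue∈ : residue v ∈
    residue∈ = +-closed (*-closed 1# v∈) (*-closed (- 1#) (sum-closed W (λ i → φ i v) u u∈))

  1≉0 : ¬ (1# ≈ 0#)
  1≉0 1≈0 = K.1≰0 (K.≤-reflexive (K.trans (K.sym re-1) (K.trans (re-cong 1≈0) re-0)))

  -- Spells out the axioms over an arbitrary complexification. Being a refutation, it can be applied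
  -- to a representation that exists only under a double negation.
  NoNontrivialIrrepBelow : ℕ → Set _
  NoNontrivialIrrepBelow d = ∀ k → .{{ℕ.NonZero k}} → k ℕ.< d →
    (ρ : G.Carrier → Fin k → Fin k → Carrier) →
    (∀ {g h} → g G.≈ h → ∀ i j → ρ g i j ≈ ρ h i j) →
    (∀ g h i j → ρ (g G.∙ h) i j ≈ sum λ l → ρ g i l * ρ h l j) →
    (∀ i j → ρ G.ε i j ≈ δ i j) →
    (∀ (W : Subspace k) → let open LinearSubspace W in
      (∀ g {v} → v ∈ → (ρ g ⊡ v) ∈) → NonZero W → (∃ λ v → ¬ (v ∈)) → ⊥) →
    ¬ (∀ g i j → ρ g i j ≈ δ i j) → ⊥

  -- The last two hypotheses say that W has dimension exactly k; the system serves as its basis and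
  -- ρ is the matrix of the action in it.
  module Restriction {k} (W : Subspace n) (W-invariant : Invariant W)
    (maximal : ¬ SystemIn W (suc k)) (system : SystemIn W k) where

    s  = proj₁ system
    u∈ = proj₂ system
    open System s
    open LinearSubspace W

    complete : ∀ {v} → v ∈ → ∀ x → v x ≈ combine (λ i → φ i v) x
    complete = maximal⇒complete W maximal system

    coordinates : V n → V k
    coordinates v i = φ i v

    combine∈ : ∀ b → combine b ∈
    combine∈ b = sum-closed W b u u∈

    ρ : G.Carrier → Fin k → Fin k → Carrier
    ρ g i j = φ i (act g (u j))

    -- Expand v in the basis and use linearity of `φ i`. At v = act h (u j) it becomes the
    -- multiplicativity of ρ.
    coordinates-act : ∀ g {v} → v ∈ → ∀ i → φ i (act g v) ≈ (ρ g ⊡ coordinates v) i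
    coordinates-act g {v} v∈ i = trans (φ-cong i λ x → complete v∈ (σ g x))
      (trans (φ-∑ i (coordinates v) (λ j → act g (u j))) (sum-cong λ j → *-comm (φ j v) (ρ g i j)))

    ρ-cong : ∀ {g h} → g G.≈ h → ∀ i j → ρ g i j ≈ ρ h i j
    ρ-cong g≈h i j = φ-cong i λ x → reflexive (≡.cong (u j) (σ-cong g≈h x))

    ρ-∙ : ∀ g h i j → ρ (g G.∙ h) i j ≈ sum λ l → ρ g i l * ρ h l j
    ρ-∙ g h i j = trans (φ-cong i λ x → reflexive (≡.cong (u j) (σ-∙ g h x)))
      (coordinates-act g (W-invariant h (u∈ j)) i)

    ρ-ε : ∀ i j → ρ G.ε i j ≈ δ i j
    ρ-ε i j = trans (φ-cong i λ x → reflexive (≡.cong (u j) (σ-ε x))) (φ-u i j)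

    trivial⇒fixed : (∀ g i j → ρ g i j ≈ δ i j) → ∀ g j x → act g (u j) x ≈ u j x
    trivial⇒fixed ρ≈δ g j x = ≈.begin
      act g (u j) x                        ≈.≈⟨ complete (W-invariant g (u∈ j)) x ⟩
      combine (λ i → ρ g i j) x            ≈.≈⟨ sum-cong (λ i → *-congʳ (trans (ρ≈δ g i j) (sym (φ-u i j)))) ⟩
      combine (coordinates (u j)) x        ≈.≈⟨ complete (u∈ j) x ⟨
      u j x                                ≈.∎

    φ-0 : ∀ i → φ i (λ _ → 0#) ≈ 0#
    φ-0 i = trans (*-congˡ (sum-0 {n} λ x → zeroˡ (conj (u i x)))) (zeroʳ (ι (c i)))

    φ-+ : ∀ i v w → φ i v + φ i w ≈ φ i (λ x → v x + w x)
    φ-+ i v w = trans (+-cong (sym (*-identityˡ _)) (sym (*-identityˡ _)))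
      (trans (sym (φ-linear i 1# 1# v w)) (φ-cong i λ x → +-cong (*-identityˡ _) (*-identityˡ _)))

    φ-* : ∀ i b v → b * φ i v ≈ φ i (λ x → b * v x)
    φ-* i b v = trans (sym (trans (+-congˡ (zeroˡ _)) (+-identityʳ _)))
      (trans (sym (φ-linear i b 0# v v)) (φ-cong i λ x → trans (+-congˡ (zeroˡ _)) (+-identityʳ _)))

    -- Carries a subspace of the coordinate space back into W, where the induction on dimension can
    -- take it up.
    preimage : Subspace k → Subspace n
    preimage W′ = record
      { _∈       = λ v → v ∈ × coordinates v ∈′
      ; resp     = λ v≈w (v∈ , v∈′) → resp v≈w v∈ , resp′ (λ i → φ-cong i v≈w) v∈′
      ; 0-closed = 0-closed , resp′ (λ i → sym (φ-0 i)) 0-closed′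
      ; +-closed = λ (v∈ , v∈′) (w∈ , w∈′) → +-closed v∈ w∈ , resp′ (λ i → φ-+ i _ _) (+-closed′ v∈′ w∈′)
      ; *-closed = λ b (v∈ , v∈′) → *-closed b v∈ , resp′ (λ i → φ-* i b _) (*-closed′ b v∈′)
      }
      where open LinearSubspace W′ renaming (_∈ to _∈′; resp to resp′; 0-closed to 0-closed′;
                                        +-closed to +-closed′; *-closed to *-closed′)

    module _ (W′ : Subspace k) where

      open LinearSubspace W′ using () renaming (_∈ to _∈′; resp to resp′)

      preimage-invariant : (∀ g {v} → v ∈′ → (ρ g ⊡ v) ∈′) → Invariant (preimage W′)
      preimage-invariant inv g (v∈ , v∈′) =
        W-invariant g v∈ , resp′ (λ i → sym (coordinates-act g v∈ i)) (inv g v∈′)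

      combine∈preimage : ∀ {b} → b ∈′ → LinearSubspace._∈ (preimage W′) (combine b)
      combine∈preimage {b} b∈′ = combine∈ b , resp′ (λ i → sym (φ-combine i b)) b∈′

      preimage-nonZero : NonZero W′ → NonZero (preimage W′)
      preimage-nonZero (b , b∈′ , b≉0) = combine b , combine∈preimage b∈′ , λ v≈0 →
        b≉0 λ i → trans (sym (φ-combine i b)) (trans (φ-cong i v≈0) (φ-0 i))

      -- A proper subspace has smaller dimension: k orthogonal vectors in the preimage would be
      -- maximal in W and so span it. Then `combine b` would lie in the preimage, and b in W′.
      proper⇒¬SystemIn : (∃ λ b → ¬ (b ∈′)) → ¬ SystemIn (preimage W′) k
      proper⇒¬SystemIn (b , b∉) (s′ , u′∈) = b∉ (resp′ (λ i → φ-combine i b) (proj₂ (LinearSubspace.resp (preimage W′)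
        (λ x → sym (maximal⇒complete W maximal (s′ , λ i → proj₁ (u′∈ i)) (combine∈ b) x))
        (sum-closed (preimage W′) (λ i → System.φ s′ i (combine b)) (System.u s′) u′∈))))

  module _ (S : Fin n → Fin n → K.Carrier) (t : K.Carrier)
    (S-invariant : ∀ g x y → S (σ g x) (σ g y) ≡ S x y)
    (fixed⇒0 : ∀ (v : V n) → (∀ g x → v (σ g x) ≈ v x) →
               (∀ x → sum (λ y → ι (S x y) * v y) ≈ ι t * v x) → ∀ x → v x ≈ 0#)
    (d : ℕ) (noIrrep : NoNontrivialIrrepBelow d)
    where

    Eigen : V n → Set
    Eigen v = ∀ x → sum (λ y → ι (S x y) * v y) ≈ ι t * v x

    -- The lower bound k on the dimension of every nonzero invariant space of eigenvectors.
    -- Quantifying over W lets the induction pass to a smaller space.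
    NoInvariant : ℕ → Set _
    NoInvariant k = (W : Subspace n) → (∀ {v} → LinearSubspace._∈ W v → Eigen v) →
                    Invariant W → NonZero W → ¬ SystemIn W k → ⊥

    -- If W has no system of size k, the induction hypothesis refutes W itself. Otherwise dim W = k:
    -- for k = 0 this contradicts W ≠ 0, and for k > 0 the action on W has dimension below d, so it
    -- is reducible or trivial. A reducing subspace pulls back to a smaller W; triviality makes a
    -- basis vector fixed, hence zero, against its normalisation.
    noInvariant-step : ∀ k → suc k ℕ.≤ d → NoInvariant k → NoInvariant (suc k)
    noInvariant-step k k<d smaller W eigen inv nz maximal = ¬¬-excluded-middle λ
      { (no  ¬system)  → smaller W eigen inv nz ¬system
      ; (yes system)   → fromSystem k k<d smaller maximal system }
      where
      fromSystem : ∀ k → suc k ℕ.≤ d → NoInvariant k → ¬ SystemIn W (suc k) → SystemIn W k → ⊥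
      fromSystem zero    _   _       maximal system =
        let v , v∈ , v≉0 = nz in v≉0 (Restriction.complete W inv maximal system v∈)
      fromSystem (suc k) k<d smaller maximal system = noIrrep (suc k) k<d ρ ρ-cong ρ-∙ ρ-ε
        (λ W′ inv′ nz′ proper → smaller (preimage W′) (λ (v∈ , _) → eigen v∈)
          (preimage-invariant W′ inv′) (preimage-nonZero W′ nz′) (proper⇒¬SystemIn W′ proper))
        (λ trivial → 1≉0 (trans (sym (normal zero)) (trans (φ-cong zero
          (fixed⇒0 (u zero) (λ g → trivial⇒fixed trivial g zero) (eigen (u∈ zero)))) (φ-0 zero))))
        where
        open Restriction W inv maximal system
        open System s

    noInvariant : ∀ k → k ℕ.≤ d → NoInvariant k
    noInvariant zero    _   W eigen inv nz ¬empty = ¬empty (emptySystem , λ ())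
    noInvariant (suc k) k<d = noInvariant-step k k<d (noInvariant k (ℕ.<⇒≤ k<d))

    sum-σ : ∀ g (f : V n) → sum f ≈ sum (λ y → f (σ g y))
    sum-σ g f = sum-permute f (permutation (σ g) (σ (g G.⁻¹))
      (λ x → ≡.trans (≡.sym (σ-∙ (g G.⁻¹) g x)) (≡.trans (σ-cong (G.inverseˡ g) x) (σ-ε x)))
      (λ x → ≡.trans (≡.sym (σ-∙ g (g G.⁻¹) x)) (≡.trans (σ-cong (G.inverseʳ g) x) (σ-ε x))))

    eigenspace : Subspace n
    eigenspace = record
      { _∈       = Eigen
      ; resp     = λ v≈w v∈ x → trans (sum-cong λ y → *-congˡ (sym (v≈w y))) (trans (v∈ x) (*-congˡ (v≈w x)))
      ; 0-closed = λ x → trans (sum-0 {n} λ y → zeroʳ (ι (S x y))) (sym (zeroʳ (ι t)))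
      ; +-closed = λ {v} {w} v∈ w∈ x → trans (sum-cong λ y → distribˡ (ι (S x y)) (v y) (w y))
          (trans (∑-distrib-+ (λ y → ι (S x y) * v y) (λ y → ι (S x y) * w y))
            (trans (+-cong (v∈ x) (w∈ x)) (sym (distribˡ _ _ _))))
      ; *-closed = λ b {v} v∈ x → trans (sum-cong λ y → swap (ι (S x y)) b (v y))
          (trans (sym (*-distribˡ-sum b (λ y → ι (S x y) * v y))) (trans (*-congˡ (v∈ x)) (swap b (ι t) (v x))))
      }
      where
      swap : ∀ x y z → x * (y * z) ≈ y * (x * z)
      swap x y z = trans (sym (*-assoc x y z)) (trans (*-congʳ (*-comm x y)) (*-assoc y x z))

    eigenspace-invariant : Invariant eigenspace
    eigenspace-invariant g {v} v∈ x = ≈.begin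
      sum (λ y → ι (S x y) * v (σ g y))
        ≈.≈⟨ sum-cong (λ y → *-congʳ (reflexive (≡.cong ι (S-invariant g x y)))) ⟨
      sum (λ y → ι (S (σ g x) (σ g y)) * v (σ g y))
        ≈.≈⟨ sum-σ g (λ y → ι (S (σ g x) y) * v y) ⟨
      sum (λ y → ι (S (σ g x) y) * v y)
        ≈.≈⟨ v∈ (σ g x) ⟩
      ι t * v (σ g x) ≈.∎

    -- The real eigenvector, read through ι, makes the complex eigenspace nonzero. That space
    -- therefore cannot lack d orthogonal vectors, while `eigenSystem-bound` shows that d of them
    -- contradict the hypothesis.
    no-eigenvector : ¬ (KQ.sum {d} (λ _ → t K.* t) K.≤ KQ.sum (λ x → KQ.sum λ y → S x y K.* S x y)) →
      ∀ v → ¬ (v KQ.∙ v K.≤ K.0#) → (∀ x → (S KQ.⊡ v) x K.≈ t K.* v x) → ⊥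
    no-eigenvector large v v≠0 eigen = noInvariant d ℕ.≤-refl eigenspace (λ v∈ → v∈) (λ g {v} → eigenspace-invariant g {v})
      ( (λ x → ι (v x))
      , (λ x → trans (sum-cong λ y → sym (ι-* (S x y) (v y)))
          (trans (sym (ι-sum (λ y → S x y K.* v y))) (trans (ι-cong (eigen x)) (ι-* t (v x)))))
      , λ ιv≈0 → v≠0 (K.≤-reflexive (KQ.sum-0 λ x → K.trans (K.*-congʳ (v≈0 (ιv≈0 x))) (K.zeroˡ (v x)))) )
      (λ (s , eigen) → large (eigenSystem-bound S t s eigen))
      where
      v≈0 : ∀ {a} → ι a ≈ 0# → a K.≈ K.0#
      v≈0 {a} ιa≈0 = K.trans (K.sym (K.*-identityʳ a)) (K.trans (K.*-congˡ (K.sym re-1))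
        (K.trans (K.sym (re-ι* a 1#)) (K.trans (re-cong (trans (*-identityʳ (ι a)) ιa≈0)) re-0)))

  -- An eigenvector fixed by a transitive action is constant, so S multiplies it by its row sums.
  transitive⇒fixed⇒0 : (S : Fin n → Fin n → K.Carrier) (t : K.Carrier) →
    (∀ (x y : Fin n) → ∃ λ g → σ g x ≡ y) → (∀ x → KQ.sum (S x) K.≈ K.0#) → ¬ (t K.≤ K.0#) →
    ∀ (v : V n) → (∀ g x → v (σ g x) ≈ v x) →
    (∀ x → sum (λ y → ι (S x y) * v y) ≈ ι t * v x) → ∀ x → v x ≈ 0#
  transitive⇒fixed⇒0 S t transitive row-sum t≰0 v fixed eigen x = ≈-stable λ vx≉0 →
    inverse t≰0 λ (i , _ , i*t) → vx≉0 (≈.begin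
      v x                       ≈.≈⟨ *-identityˡ (v x) ⟨
      1# * v x                  ≈.≈⟨ *-congʳ ι-1 ⟨
      ι K.1# * v x              ≈.≈⟨ *-congʳ (ι-cong i*t) ⟨
      ι (i K.* t) * v x         ≈.≈⟨ *-congʳ (ι-* i t) ⟩
      ι i * ι t * v x           ≈.≈⟨ *-assoc (ι i) (ι t) (v x) ⟩
      ι i * (ι t * v x)         ≈.≈⟨ *-congˡ tv≈0 ⟩
      ι i * 0#                  ≈.≈⟨ zeroʳ (ι i) ⟩
      0#                        ≈.∎)
    where
    constant : ∀ y → v y ≈ v x
    constant y with transitive x y
    ... | g , ≡.refl = fixed g x
    tv≈0 : ι t * v x ≈ 0#
    tv≈0 = ≈.begin
      ι t * v x                           ≈.≈⟨ eigen x ⟨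
      sum (λ y → ι (S x y) * v y)         ≈.≈⟨ sum-cong (λ y → *-congˡ (constant y)) ⟩
      sum (λ y → ι (S x y) * v x)         ≈.≈⟨ *-distribʳ-sum (v x) (λ y → ι (S x y)) ⟨
      sum (λ y → ι (S x y)) * v x         ≈.≈⟨ *-congʳ (ι-sum (S x)) ⟨
      ι (KQ.sum (S x)) * v x              ≈.≈⟨ *-congʳ (trans (ι-cong (row-sum x)) ι-0) ⟩
      0# * v x                            ≈.≈⟨ zeroˡ (v x) ⟩
      0#                                  ≈.∎

  -- The size hypothesis concerns an explicit lower bound q, since t itself is only a limit.
  -- Positivity of q passes to t, and d·t² ≤ ∑S² would imply d·q² ≤ ∑S².
  ¬topOfSpectrum : ∀ (S : Fin n → Fin n → K.Carrier) t → KQ.Symmetric S → KQ.TopOfSpectrum S t →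
    (∀ g x y → S (σ g x) (σ g y) ≡ S x y) → (∀ (x y : Fin n) → ∃ λ g → σ g x ≡ y) →
    (∀ x → KQ.sum (S x) K.≈ K.0#) → ∀ d → NoNontrivialIrrepBelow d →
    ∀ q → q K.≤ t → ¬ (q K.≤ K.0#) →
    ¬ (KQ.sum {d} (λ _ → q K.* q) K.≤ KQ.sum (λ x → KQ.sum λ y → S x y K.* S x y)) → ⊥
  ¬topOfSpectrum S t S-sym T S-invariant transitive row-sum d noIrrep q q≤t q≰0 large =
    KQ.eigenvector S S-sym T λ (v , v≠0 , eigen) →
    no-eigenvector S t S-invariant
      (transitive⇒fixed⇒0 S t transitive row-sum λ t≤0 → q≰0 (K.≤-trans q≤t t≤0))
      d noIrrep (λ h → large (KQ.sum-square-mono d (K.≰⇒≥ q≰0) q≤t h)) v v≠0 eigen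

open import Defs
open import Data.Nat.Base using (ℕ; NonZero)
open import Data.Rational.Base using (0ℚ; ½)
open import Data.Sign.Base using (Sign; _*_)
open import Data.Sign.Properties using (_≟_)
open import Function.Bundles using (Func; _⟨$⟩_)
open import Relation.Binary.PropositionalEquality using (_≡_; setoid)

open import Data.Rational.Base as ℚ using (ℚ; 1ℚ; mkℚ)
import Data.Rational.Properties as ℚ
import Data.Rational.Solver as ℚ
open import Data.Rational.Unnormalised.Base as ℚᵘ using (mkℚᵘ)
import Data.Rational.Unnormalised.Properties as ℚᵘ
open import Data.Sum.Base using (_⊎_; inj₁; inj₂)
open import Function.Bundles using (Inverse)
open import Relation.Binary.PropositionalEquality using (refl; sym; trans; cong; cong₂; subst; subst₂; module ≡-Reasoning)

-- The rationals as an ordered ring.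

<⇒≱ : ∀ {p q} → p ℚ.< q → ¬ (q ℚ.≤ p)
<⇒≱ p<q q≤p = ℚ.<-irrefl refl (ℚ.<-≤-trans p<q q≤p)

ℚ-orderedRing : OrderedRing
ℚ-orderedRing = record
  { commutativeRing = ℚ.+-*-commutativeRing
  ; _≤_             = ℚ._≤_
  ; ≤-reflexive     = ℚ.≤-reflexive
  ; ≤-trans         = ℚ.≤-trans
  ; ≤-antisym       = ℚ.≤-antisym
  ; ≤-stable        = decidable-stable (_ ℚ.≤? _)
  ; ≰⇒≥             = λ x≰y → ℚ.<⇒≤ (ℚ.≰⇒> x≰y)
  ; +-mono-≤        = ℚ.+-mono-≤
  ; *-nonNeg        = λ {x} {y} 0≤x 0≤y → subst (ℚ._≤ x ℚ.* y) (ℚ.*-zeroʳ x)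
                        (ℚ.*-monoˡ-≤-nonNeg x {{ℚ.nonNegative 0≤x}} 0≤y)
  ; *-pos           = λ {x} {y} x≰0 y≰0 → <⇒≱ (ℚ.positive⁻¹ _
                        {{ℚ.pos*pos⇒pos x {{ℚ.positive (ℚ.≰⇒> x≰0)}} y {{ℚ.positive (ℚ.≰⇒> y≰0)}}}})
  ; 1≰0             = <⇒≱ (ℚ.positive⁻¹ 1ℚ)
  }

module ℚ-Order where

  open OrderedRingProperties ℚ-orderedRing public
  open ℚ.+-*-Solver public using (solve; _:=_; _:+_; _:*_; _:-_; :-_; con)

  *-pos : ∀ {p q} → 0ℚ ℚ.< p → 0ℚ ℚ.< q → 0ℚ ℚ.< p ℚ.* q
  *-pos 0<p 0<q = ℚ.≰⇒> (OrderedRing.*-pos ℚ-orderedRing (<⇒≱ 0<p) (<⇒≱ 0<q))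

  ⅓ : ℚ
  ⅓ = + 1 ℚ./ 3

  ½-pos : ∀ {ε} → 0ℚ ℚ.< ε → 0ℚ ℚ.< ½ ℚ.* ε
  ½-pos = *-pos (ℚ.positive⁻¹ ½)

  ⅓-pos : ∀ {ε} → 0ℚ ℚ.< ε → 0ℚ ℚ.< ⅓ ℚ.* ε
  ⅓-pos = *-pos (ℚ.positive⁻¹ ⅓)

  ∣p∣≤q : ∀ {p q} → p ℚ.≤ q → ℚ.- p ℚ.≤ q → ℚ.∣ p ∣ ℚ.≤ q
  ∣p∣≤q {p} {q} p≤q -p≤q with ℚ.∣p∣≡p∨∣p∣≡-p p
  ... | inj₁ eq = subst (ℚ._≤ q) (sym eq) p≤q
  ... | inj₂ eq = subst (ℚ._≤ q) (sym eq) -p≤q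

  p≤∣p∣ : ∀ p → p ℚ.≤ ℚ.∣ p ∣
  p≤∣p∣ p with 0ℚ ℚ.≤? p
  ... | yes 0≤p = ℚ.≤-reflexive (sym (ℚ.0≤p⇒∣p∣≡p 0≤p))
  ... | no  0≰p = ℚ.≤-trans (ℚ.<⇒≤ (ℚ.≰⇒> 0≰p)) (ℚ.0≤∣p∣ p)

  ∣p-q∣≤ε⇒p≤q+ε : ∀ {p q ε} → ℚ.∣ p ℚ.- q ∣ ℚ.≤ ε → p ℚ.≤ q ℚ.+ ε
  ∣p-q∣≤ε⇒p≤q+ε {p} {q} {ε} h = 0≤y-x⇒x≤y (subst (0ℚ ℚ.≤_)
    (solve 3 (λ p q e → e :+ :- (p :- q) := q :+ e :+ :- p) refl p q ε)
    (x≤y⇒0≤y-x (ℚ.≤-trans (p≤∣p∣ (p ℚ.- q)) h)))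

  ∣-∣-comm : ∀ p q → ℚ.∣ p ℚ.- q ∣ ≡ ℚ.∣ q ℚ.- p ∣
  ∣-∣-comm p q = trans (sym (ℚ.∣-p∣≡∣p∣ (p ℚ.- q)))
    (cong ℚ.∣_∣ (solve 2 (λ p q → :- (p :- q) := q :- p) refl p q))

  ∣p-q∣≤ε⇐ : ∀ {p q ε} → p ℚ.≤ q ℚ.+ ε → q ℚ.≤ p ℚ.+ ε → ℚ.∣ p ℚ.- q ∣ ℚ.≤ ε
  ∣p-q∣≤ε⇐ {p} {q} {ε} h₁ h₂ = ∣p∣≤q (0≤y-x⇒x≤y (subst (0ℚ ℚ.≤_)
      (solve 3 (λ p q e → q :+ e :+ :- p := e :+ :- (p :- q)) refl p q ε) (x≤y⇒0≤y-x h₁)))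
    (0≤y-x⇒x≤y (subst (0ℚ ℚ.≤_)
      (solve 3 (λ p q e → p :+ e :+ :- q := e :+ :- :- (p :- q)) refl p q ε) (x≤y⇒0≤y-x h₂)))

∃-both : ∀ {P Q : ℕ → Set} → Eventually P → Eventually Q → Eventually λ n → P n × Q n
∃-both (M , p) (N , q) = M ℕ.⊔ N , λ n n≥ → p n (ℕ.m⊔n≤o⇒m≤o M N n≥) , q n (ℕ.m⊔n≤o⇒n≤o M N n≥)

-- The Cauchy reals as an ordered ring.

module ℝ-Order where

  open ℚ-Order

  ≤ℝ-pointwise : ∀ {x y} → (∀ n → seq x n ℚ.≤ seq y n) → x ≤ℝ y
  ≤ℝ-pointwise {x} {y} h = mk≤ λ ε 0<ε → 0 , λ n _ → ℚ.≤-trans (h n)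
    (subst (ℚ._≤ seq y n ℚ.+ ε) (ℚ.+-identityʳ (seq y n)) (ℚ.+-monoʳ-≤ (seq y n) (ℚ.<⇒≤ 0<ε)))

  ≤ℝ-trans : ∀ {x y z} → x ≤ℝ y → y ≤ℝ z → x ≤ℝ z
  ≤ℝ-trans {x} {y} {z} (mk≤ x≤y) (mk≤ y≤z) = mk≤ λ ε 0<ε →
    let N , h = ∃-both (x≤y (½ ℚ.* ε) (½-pos 0<ε)) (y≤z (½ ℚ.* ε) (½-pos 0<ε))
    in N , λ n n≥ → let p , q = h n n≥ in ℚ.≤-trans p (subst (seq y n ℚ.+ ½ ℚ.* ε ℚ.≤_)
         (solve 2 (λ z e → z :+ con ½ :* e :+ con ½ :* e := z :+ e) refl (seq z n) ε)
         (ℚ.+-monoˡ-≤ (½ ℚ.* ε) q))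

  ≈⇒≤ : ∀ {x y} → x ≈ℝ y → x ≤ℝ y
  ≈⇒≤ (mk≈ h) = mk≤ λ ε 0<ε → let N , p = h ε 0<ε in N , λ n n≥ → ∣p-q∣≤ε⇒p≤q+ε (p n n≥)

  ≈ℝ-sym : ∀ {x y} → x ≈ℝ y → y ≈ℝ x
  ≈ℝ-sym {x} {y} (mk≈ h) = mk≈ λ ε 0<ε → let N , p = h ε 0<ε in
    N , λ n n≥ → subst (ℚ._≤ ε) (∣-∣-comm (seq x n) (seq y n)) (p n n≥)

  ≤ℝ-antisym : ∀ {x y} → x ≤ℝ y → y ≤ℝ x → x ≈ℝ y
  ≤ℝ-antisym (mk≤ x≤y) (mk≤ y≤x) = mk≈ λ ε 0<ε →
    let N , h = ∃-both (x≤y ε 0<ε) (y≤x ε 0<ε)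
    in N , λ n n≥ → let p , q = h n n≥ in ∣p-q∣≤ε⇐ p q

  ≈ℝ-trans : ∀ {x y z} → x ≈ℝ y → y ≈ℝ z → x ≈ℝ z
  ≈ℝ-trans p q = ≤ℝ-antisym (≤ℝ-trans (≈⇒≤ p) (≈⇒≤ q))
                            (≤ℝ-trans (≈⇒≤ (≈ℝ-sym q)) (≈⇒≤ (≈ℝ-sym p)))

  ≈ℝ-pointwise : ∀ {x y} → (∀ n → seq x n ≡ seq y n) → x ≈ℝ y
  ≈ℝ-pointwise h = ≤ℝ-antisym (≤ℝ-pointwise λ n → ℚ.≤-reflexive (h n))
                              (≤ℝ-pointwise λ n → ℚ.≤-reflexive (sym (h n)))

  +-mono-≤ℝ : ∀ {x y u v} → x ≤ℝ y → u ≤ℝ v → x +ℝ u ≤ℝ y +ℝ v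
  +-mono-≤ℝ {x} {y} {u} {v} (mk≤ x≤y) (mk≤ u≤v) = mk≤ λ ε 0<ε →
    let N , h = ∃-both (x≤y (½ ℚ.* ε) (½-pos 0<ε)) (u≤v (½ ℚ.* ε) (½-pos 0<ε))
    in N , λ n n≥ → let p , q = h n n≥ in subst (seq x n ℚ.+ seq u n ℚ.≤_)
         (solve 3 (λ y v e → y :+ con ½ :* e :+ (v :+ con ½ :* e) := y :+ v :+ e) refl (seq y n) (seq v n) ε)
         (ℚ.+-mono-≤ p q)

  neg-mono-≤ℝ : ∀ {x y} → x ≤ℝ y → -ℝ y ≤ℝ -ℝ x
  neg-mono-≤ℝ {x} {y} (mk≤ x≤y) = mk≤ λ ε 0<ε → let N , h = x≤y ε 0<ε in N , λ n n≥ →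
    0≤y-x⇒x≤y (subst (0ℚ ℚ.≤_)
      (solve 3 (λ x y e → y :+ e :+ :- x := :- x :+ e :+ :- :- y) refl (seq x n) (seq y n) ε)
      (x≤y⇒0≤y-x (h n n≥)))

  +-cong-ℝ : ∀ {x y u v} → x ≈ℝ y → u ≈ℝ v → x +ℝ u ≈ℝ y +ℝ v
  +-cong-ℝ p q = ≤ℝ-antisym (+-mono-≤ℝ (≈⇒≤ p) (≈⇒≤ q))
                            (+-mono-≤ℝ (≈⇒≤ (≈ℝ-sym p)) (≈⇒≤ (≈ℝ-sym q)))

  neg-cong-ℝ : ∀ {x y} → x ≈ℝ y → -ℝ x ≈ℝ -ℝ y
  neg-cong-ℝ p = ≤ℝ-antisym (neg-mono-≤ℝ (≈⇒≤ (≈ℝ-sym p))) (neg-mono-≤ℝ (≈⇒≤ p))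

  *-congʳ-ℝ : ∀ {x y} z → x ≈ℝ y → x *ℝ z ≈ℝ y *ℝ z
  *-congʳ-ℝ {x} {y} z (mk≈ x≈y) = mk≈ λ ε 0<ε →
    let K , 0<K , z≤K = eventuallyBounded z
        K⁻¹ = (ℚ.1/ K) {{ℚ.>-nonZero 0<K}}
        0<K⁻¹ = ℚ.positive⁻¹ K⁻¹ {{ℚ.1/pos⇒pos K {{ℚ.positive 0<K}}}}
        N , h = ∃-both z≤K (x≈y (ε ℚ.* K⁻¹) (*-pos 0<ε 0<K⁻¹))
    in N , λ n n≥ → let ∣z∣≤K , ∣x-y∣≤ = h n n≥ in begin
      ℚ.∣ seq x n ℚ.* seq z n ℚ.- seq y n ℚ.* seq z n ∣
        ≡⟨ cong ℚ.∣_∣ (solve 3 (λ x y z → x :* z :- y :* z := (x :- y) :* z) refl (seq x n) (seq y n) (seq z n)) ⟩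
      ℚ.∣ (seq x n ℚ.- seq y n) ℚ.* seq z n ∣
        ≡⟨ ℚ.∣p*q∣≡∣p∣*∣q∣ (seq x n ℚ.- seq y n) (seq z n) ⟩
      ℚ.∣ seq x n ℚ.- seq y n ∣ ℚ.* ℚ.∣ seq z n ∣
        ≤⟨ *-monoˡ-≤ (ℚ.0≤∣p∣ (seq x n ℚ.- seq y n)) ∣z∣≤K ⟩
      ℚ.∣ seq x n ℚ.- seq y n ∣ ℚ.* K
        ≤⟨ ℚ.*-monoʳ-≤-nonNeg K {{ℚ.nonNegative (ℚ.<⇒≤ 0<K)}} ∣x-y∣≤ ⟩
      ε ℚ.* K⁻¹ ℚ.* K
        ≡⟨ trans (ℚ.*-assoc ε K⁻¹ K) (cong (ε ℚ.*_) (ℚ.*-inverseˡ K {{ℚ.>-nonZero 0<K}})) ⟩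
      ε ℚ.* 1ℚ
        ≡⟨ ℚ.*-identityʳ ε ⟩
      ε ∎
    where open ℚ.≤-Reasoning

  *-comm-ℝ : ∀ x y → x *ℝ y ≈ℝ y *ℝ x
  *-comm-ℝ x y = ≈ℝ-pointwise λ n → ℚ.*-comm (seq x n) (seq y n)

  *-cong-ℝ : ∀ {x y u v} → x ≈ℝ y → u ≈ℝ v → x *ℝ u ≈ℝ y *ℝ v
  *-cong-ℝ {x} {y} {u} {v} p q = ≈ℝ-trans (*-congʳ-ℝ u p)
    (≈ℝ-trans (*-comm-ℝ y u) (≈ℝ-trans (*-congʳ-ℝ y q) (*-comm-ℝ v y)))

  ℝ-commutativeRing : CommutativeRing 0ℓ 0ℓ
  ℝ-commutativeRing = record
    { Carrier = ℝ ; _≈_ = _≈ℝ_ ; _+_ = _+ℝ_ ; _*_ = _*ℝ_ ; -_ = -ℝ_ ; 0# = 0ℝ ; 1# = 1ℝ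
    ; isCommutativeRing = record
      { isRing = record
        { +-isAbelianGroup = record
          { isGroup = record
            { isMonoid = record
              { isSemigroup = record
                { isMagma = record
                  { isEquivalence = record
                    { refl = ≈ℝ-pointwise λ _ → refl ; sym = ≈ℝ-sym ; trans = ≈ℝ-trans }
                  ; ∙-cong = +-cong-ℝ }
                ; assoc = λ x y z → ≈ℝ-pointwise λ n → ℚ.+-assoc (seq x n) (seq y n) (seq z n) }
              ; identity = (λ x → ≈ℝ-pointwise λ n → ℚ.+-identityˡ (seq x n))
                         , (λ x → ≈ℝ-pointwise λ n → ℚ.+-identityʳ (seq x n)) }
            ; inverse = (λ x → ≈ℝ-pointwise λ n → ℚ.+-inverseˡ (seq x n))
                      , (λ x → ≈ℝ-pointwise λ n → ℚ.+-inverseʳ (seq x n))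
            ; ⁻¹-cong = neg-cong-ℝ }
          ; comm = λ x y → ≈ℝ-pointwise λ n → ℚ.+-comm (seq x n) (seq y n) }
        ; *-cong = *-cong-ℝ
        ; *-assoc = λ x y z → ≈ℝ-pointwise λ n → ℚ.*-assoc (seq x n) (seq y n) (seq z n)
        ; *-identity = (λ x → ≈ℝ-pointwise λ n → ℚ.*-identityˡ (seq x n))
                     , (λ x → ≈ℝ-pointwise λ n → ℚ.*-identityʳ (seq x n))
        ; distrib = (λ x y z → ≈ℝ-pointwise λ n → ℚ.*-distribˡ-+ (seq x n) (seq y n) (seq z n))
                  , (λ x y z → ≈ℝ-pointwise λ n → ℚ.*-distribʳ-+ (seq x n) (seq y n) (seq z n)) }
      ; *-comm = *-comm-ℝ } }

  0≤y-x⇒x≤y-ℝ : ∀ {x y} → 0ℝ ≤ℝ y -ℝ x → x ≤ℝ y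
  0≤y-x⇒x≤y-ℝ {x} {y} (mk≤ h) = mk≤ λ ε 0<ε → let N , p = h ε 0<ε in N , λ n n≥ →
    0≤y-x⇒x≤y (subst (0ℚ ℚ.≤_)
      (solve 3 (λ x y e → y :- x :+ e := y :+ e :+ :- x) refl (seq x n) (seq y n) ε) (p n n≥))

  -- One term, known to precision ε/3, is compared with 2ε/3. Later terms differ from it by at most
  -- ε/3, so they stay below ε in one case and above ε/3 in the other.
  Positive-or-small : ∀ x ε → 0ℚ ℚ.< ε → Positiveℝ x ⊎ Eventually (λ n → seq x n ℚ.≤ ε)
  Positive-or-small x ε 0<ε with cauchy x (⅓ ℚ.* ε) (⅓-pos 0<ε)
  ... | N , h with seq x N ℚ.≤? ⅓ ℚ.* ε ℚ.+ ⅓ ℚ.* ε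
  ...   | yes small = inj₂ (N , λ n n≥ → begin
    seq x n                                    ≤⟨ ∣p-q∣≤ε⇒p≤q+ε (h n N n≥ ℕ.≤-refl) ⟩
    seq x N ℚ.+ ⅓ ℚ.* ε                        ≤⟨ ℚ.+-monoˡ-≤ (⅓ ℚ.* ε) small ⟩
    ⅓ ℚ.* ε ℚ.+ ⅓ ℚ.* ε ℚ.+ ⅓ ℚ.* ε            ≡⟨ solve 1 (λ e → con ⅓ :* e :+ con ⅓ :* e :+ con ⅓ :* e := e) refl ε ⟩
    ε                                          ∎)
    where open ℚ.≤-Reasoning
  ...   | no  large = inj₁ (mkPos (⅓ ℚ.* ε) (⅓-pos 0<ε) (N , λ n n≥ → 0≤y-x⇒x≤y (subst (0ℚ ℚ.≤_)
      (solve 3 (λ x y e → y :+ e :+ :- x :+ (x :+ :- (e :+ e)) := y :+ :- e) refl (seq x N) (seq x n) (⅓ ℚ.* ε))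
      (+-nonNeg (x≤y⇒0≤y-x {seq x N} {seq x n ℚ.+ ⅓ ℚ.* ε} (∣p-q∣≤ε⇒p≤q+ε {seq x N} (h N n ℕ.≤-refl n≥)))
                 (x≤y⇒0≤y-x {⅓ ℚ.* ε ℚ.+ ⅓ ℚ.* ε} {seq x N} (ℚ.<⇒≤ (ℚ.≰⇒> large)))))))

  Positive⇒≰0 : ∀ {x} → Positiveℝ x → ¬ (x ≤ℝ 0ℝ)
  Positive⇒≰0 {x} (mkPos b 0<b ev) (mk≤ h) =
    let N , p = ∃-both ev (h (½ ℚ.* b) (½-pos 0<b))
        b≤x , x≤½b = p N ℕ.≤-refl
    in <⇒≱ (½-pos 0<b) (0≤-x⇒x≤0 (subst (0ℚ ℚ.≤_)
         (solve 1 (λ b → con 0ℚ :+ con ½ :* b :+ :- b := :- (con ½ :* b)) refl b)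
         (x≤y⇒0≤y-x (ℚ.≤-trans b≤x x≤½b))))

  ¬Positive⇒≤0 : ∀ {x} → ¬ Positiveℝ x → x ≤ℝ 0ℝ
  ¬Positive⇒≤0 {x} ¬pos = mk≤ λ ε 0<ε → small ε 0<ε (Positive-or-small x ε 0<ε)
    where
    small : ∀ ε → 0ℚ ℚ.< ε → Positiveℝ x ⊎ Eventually (λ n → seq x n ℚ.≤ ε) →
            Eventually λ n → seq x n ℚ.≤ 0ℚ ℚ.+ ε
    small ε 0<ε (inj₁ pos)     = ⊥-elim (¬pos pos)
    small ε 0<ε (inj₂ (N , h)) = N , λ n n≥ → subst (seq x n ℚ.≤_) (sym (ℚ.+-identityˡ ε)) (h n n≥)

  Positive⇒≥0 : ∀ {x} → Positiveℝ x → 0ℝ ≤ℝ x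
  Positive⇒≥0 (mkPos b 0<b (N , h)) = mk≤ λ ε 0<ε → N , λ n n≥ →
    ℚ.+-mono-≤ (ℚ.≤-trans (ℚ.<⇒≤ 0<b) (h n n≥)) (ℚ.<⇒≤ 0<ε)

  Positive-* : ∀ {x y} → Positiveℝ x → Positiveℝ y → Positiveℝ (x *ℝ y)
  Positive-* {x} {y} (mkPos b 0<b p) (mkPos c 0<c q) = let N , h = ∃-both p q in
    mkPos (b ℚ.* c) (*-pos 0<b 0<c) (N , λ n n≥ → let b≤x , c≤y = h n n≥ in
      ℚ.≤-trans (*-monoˡ-≤ (ℚ.<⇒≤ 0<b) c≤y)
        (ℚ.*-monoʳ-≤-nonNeg (seq y n) {{ℚ.nonNegative (ℚ.≤-trans (ℚ.<⇒≤ 0<c) c≤y)}} b≤x))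

  x≤y⇒x-y≤0 : ∀ {x y} → x ≤ℝ y → x -ℝ y ≤ℝ 0ℝ
  x≤y⇒x-y≤0 {x} {y} (mk≤ h) = mk≤ λ ε 0<ε → let N , p = h ε 0<ε in N , λ n n≥ →
    0≤y-x⇒x≤y (subst (0ℚ ℚ.≤_)
      (solve 3 (λ x y e → y :+ e :+ :- x := con 0ℚ :+ e :+ :- (x :- y)) refl (seq x n) (seq y n) ε)
      (x≤y⇒0≤y-x (p n n≥)))

  x-y≤0⇒x≤y : ∀ {x y} → x -ℝ y ≤ℝ 0ℝ → x ≤ℝ y
  x-y≤0⇒x≤y {x} {y} (mk≤ h) = mk≤ λ ε 0<ε → let N , p = h ε 0<ε in N , λ n n≥ →
    0≤y-x⇒x≤y (subst (0ℚ ℚ.≤_)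
      (solve 3 (λ x y e → con 0ℚ :+ e :+ :- (x :- y) := y :+ e :+ :- x) refl (seq x n) (seq y n) ε)
      (x≤y⇒0≤y-x (p n n≥)))

  -- By `¬Positive⇒≤0` the relation x ≤ y amounts to the negation of positivity of x - y, and
  -- negations are stable.
  ≤ℝ-stable : ∀ {x y} → ¬ ¬ (x ≤ℝ y) → x ≤ℝ y
  ≤ℝ-stable ¬¬x≤y = x-y≤0⇒x≤y (¬Positive⇒≤0 λ pos → ¬¬x≤y λ x≤y → Positive⇒≰0 pos (x≤y⇒x-y≤0 x≤y))

  ≰0⇒¬¬Positive : ∀ {x} → ¬ (x ≤ℝ 0ℝ) → ¬ ¬ Positiveℝ x
  ≰0⇒¬¬Positive x≰0 ¬pos = x≰0 (¬Positive⇒≤0 ¬pos)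

  ≰⇒≥-ℝ : ∀ {x y} → ¬ (x ≤ℝ y) → y ≤ℝ x
  ≰⇒≥-ℝ x≰y = x-y≤0⇒x≤y (¬Positive⇒≤0 λ pos → x≰y (0≤y-x⇒x≤y-ℝ (Positive⇒≥0 pos)))

  ≈0-*ℝ : ∀ {x} y → x ≈ℝ 0ℝ → x *ℝ y ≈ℝ 0ℝ
  ≈0-*ℝ {x} y x≈0 = ≈ℝ-trans {x *ℝ y} {0ℝ *ℝ y} {0ℝ} (*-congʳ-ℝ {x} {0ℝ} y x≈0)
    (≈ℝ-pointwise λ n → ℚ.*-zeroˡ (seq y n))

  x≤0⇒0≤x*y : ∀ x y → 0ℝ ≤ℝ x → x ≤ℝ 0ℝ → 0ℝ ≤ℝ x *ℝ y
  x≤0⇒0≤x*y x y 0≤x x≤0 = ≈⇒≤ {0ℝ} {x *ℝ y} (≈ℝ-sym {x *ℝ y} {0ℝ} (≈0-*ℝ {x} y (≤ℝ-antisym {x} {0ℝ} x≤0 0≤x)))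

  y≤0⇒0≤x*y : ∀ x y → 0ℝ ≤ℝ y → y ≤ℝ 0ℝ → 0ℝ ≤ℝ x *ℝ y
  y≤0⇒0≤x*y x y 0≤y y≤0 = ≤ℝ-trans {0ℝ} {y *ℝ x} {x *ℝ y} (x≤0⇒0≤x*y y x 0≤y y≤0) (≈⇒≤ {y *ℝ x} {x *ℝ y} (*-comm-ℝ y x))

  Positive-*-nonNeg : ∀ x y → Positiveℝ x → Positiveℝ y → 0ℝ ≤ℝ x *ℝ y
  Positive-*-nonNeg x y px py = Positive⇒≥0 {x *ℝ y} (Positive-* {x} {y} px py)

  -- Under the double negation each factor is either zero or positive with an explicit bound.
  *-nonNeg-ℝ : ∀ {x y} → 0ℝ ≤ℝ x → 0ℝ ≤ℝ y → 0ℝ ≤ℝ x *ℝ y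
  *-nonNeg-ℝ {x} {y} 0≤x 0≤y = ≤ℝ-stable {0ℝ} {x *ℝ y} λ ≰ →
    ≰0⇒¬¬Positive {x} (λ x≤0 → ≰ (x≤0⇒0≤x*y x y 0≤x x≤0)) λ px →
    ≰0⇒¬¬Positive {y} (λ y≤0 → ≰ (y≤0⇒0≤x*y x y 0≤y y≤0)) λ py →
    ≰ (Positive-*-nonNeg x y px py)

  ℝ-orderedRing : OrderedRing
  ℝ-orderedRing = record
    { commutativeRing = ℝ-commutativeRing
    ; _≤_             = _≤ℝ_
    ; ≤-reflexive     = ≈⇒≤
    ; ≤-trans         = ≤ℝ-trans
    ; ≤-antisym       = ≤ℝ-antisym
    ; ≤-stable        = ≤ℝ-stable
    ; ≰⇒≥             = ≰⇒≥-ℝ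
    ; +-mono-≤        = +-mono-≤ℝ
    ; *-nonNeg        = *-nonNeg-ℝ
    ; *-pos           = λ x≰0 y≰0 xy≤0 → ≰0⇒¬¬Positive x≰0 λ px → ≰0⇒¬¬Positive y≰0 λ py →
                          Positive⇒≰0 (Positive-* px py) xy≤0
    ; 1≰0             = Positive⇒≰0 (mkPos 1ℚ (ℚ.positive⁻¹ 1ℚ) (0 , λ _ _ → ℚ.≤-refl))
    }

  recip-inverse : ∀ x (pos : Positiveℝ x) → recip x pos *ℝ x ≈ℝ 1ℝ
  -- From index N on the terms are at least b > 0, so the junk value of `invℚ` does not occur.
  recip-inverse x (mkPos b 0<b (N , h)) = mk≈ λ ε 0<ε → N , λ n n≥ →
    subst (λ p → ℚ.∣ p ℚ.- 1ℚ ∣ ℚ.≤ ε) (sym (invℚ-inverse (ℚ.<-≤-trans 0<b (h n n≥)))) (ℚ.<⇒≤ 0<ε)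

  recip-nonNeg : ∀ x (pos : Positiveℝ x) → 0ℝ ≤ℝ recip x pos
  recip-nonNeg x (mkPos b 0<b (N , h)) = mk≤ λ ε 0<ε → N , λ n n≥ →
    ℚ.+-mono-≤ (invℚ-nonNeg (ℚ.<-≤-trans 0<b (h n n≥))) (ℚ.<⇒≤ 0<ε)

  fromℚ-mono-≤ : ∀ {p q} → p ℚ.≤ q → fromℚ p ≤ℝ fromℚ q
  fromℚ-mono-≤ p≤q = ≤ℝ-pointwise λ _ → p≤q

  fromℚ-cancel-≤ : ∀ {p q} → fromℚ p ≤ℝ fromℚ q → p ℚ.≤ q
  fromℚ-cancel-≤ {p} {q} (mk≤ h) = decidable-stable (p ℚ.≤? q) λ p≰q →
    let ε = p ℚ.- q
        0<ε = ℚ.≰⇒> λ p-q≤0 → p≰q (0≤y-x⇒x≤y (subst (0ℚ ℚ.≤_)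
                (solve 2 (λ p q → :- (p :- q) := q :+ :- p) refl p q) (x≤0⇒0≤-x p-q≤0)))
        N , k = h (½ ℚ.* ε) (½-pos 0<ε)
    in <⇒≱ (½-pos 0<ε) (0≤-x⇒x≤0 (subst (0ℚ ℚ.≤_)
         (solve 2 (λ p q → q :+ con ½ :* (p :- q) :+ :- p := :- (con ½ :* (p :- q))) refl p q)
         (x≤y⇒0≤y-x (k N ℕ.≤-refl))))
--

module Naturals where

  open ℚ-Order

  -- Recursive, unlike the normalised fraction `+ n ℚ./ 1`, so that sums of constants can be
  -- evaluated by induction.
  natℚ : ℕ → ℚ
  natℚ zero    = 0ℚ
  natℚ (suc n) = 1ℚ ℚ.+ natℚ n

  n/1≡natℚ : ∀ n → + n ℚ./ 1 ≡ natℚ n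
  n/1≡natℚ zero    = refl
  n/1≡natℚ (suc n) = trans (ℚ.toℚᵘ-injective
    (ℚᵘ.≃-trans (ℚ.toℚᵘ-fromℚᵘ (mkℚᵘ (+ suc n) 0))
    (ℚᵘ.≃-trans (ℚᵘ.*≡* {mkℚᵘ (+ suc n) 0} {mkℚᵘ (+ 1) 0 ℚᵘ.+ mkℚᵘ (+ n) 0} (cong (ℤ._* + 1) (cong₂ ℤ._+_ (sym (ℤ.*-identityʳ (+ 1))) (sym (ℤ.*-identityʳ (+ n))))))
    (ℚᵘ.≃-trans (ℚᵘ.+-congʳ (mkℚᵘ (+ 1) 0) (ℚᵘ.≃-sym (ℚ.toℚᵘ-fromℚᵘ (mkℚᵘ (+ n) 0))))
    (ℚᵘ.≃-sym (ℚ.toℚᵘ-homo-+ 1ℚ (+ n ℚ./ 1)))))))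
    (cong (1ℚ ℚ.+_) (n/1≡natℚ n))

  0≤natℚ : ∀ n → 0ℚ ℚ.≤ natℚ n
  0≤natℚ zero    = ℚ.≤-refl
  0≤natℚ (suc n) = +-nonNeg (ℚ.<⇒≤ (ℚ.positive⁻¹ 1ℚ)) (0≤natℚ n)

  natℚ-mono-≤ : ∀ {m n} → m ℕ.≤ n → natℚ m ℚ.≤ natℚ n
  natℚ-mono-≤ {n = n} ℕ.z≤n     = 0≤natℚ n
  natℚ-mono-≤         (ℕ.s≤s h) = ℚ.+-monoʳ-≤ 1ℚ (natℚ-mono-≤ h)

  archimedean : ∀ p → ∃ λ n → p ℚ.≤ natℚ n
  archimedean p@(mkℚ (+ a) d _)    = a , subst (p ℚ.≤_) (n/1≡natℚ a) (ℚ.toℚᵘ-cancel-≤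
    (ℚᵘ.≤-trans (ℚᵘ.*≤* {ℚ.toℚᵘ p} {mkℚᵘ (+ a) 0} (ℤ.*-monoˡ-≤-nonNeg (+ a) (ℤ.+≤+ (ℕ.s≤s ℕ.z≤n))))
                (ℚᵘ.≤-reflexive (ℚᵘ.≃-sym (ℚ.toℚᵘ-fromℚᵘ (mkℚᵘ (+ a) 0))))))
  archimedean p@(mkℚ -[1+ _ ] _ _) = 0 , ℚ.<⇒≤ (ℚ.negative⁻¹ p)

  1/_ : ∀ {p} → 0ℚ ℚ.< p → ∃ λ q → 0ℚ ℚ.< q × q ℚ.* p ≡ 1ℚ
  1/_ {p} 0<p = (ℚ.1/ p) {{ℚ.>-nonZero 0<p}} , ℚ.positive⁻¹ _ {{ℚ.1/pos⇒pos p {{ℚ.positive 0<p}}}}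
              , ℚ.*-inverseˡ p {{ℚ.>-nonZero 0<p}}

module ℝ-Archimedean where

  open ℚ-Order

  ≤η⇒≤0 : ∀ x → (∀ η → 0ℚ ℚ.< η → x ≤ℝ fromℚ η) → x ≤ℝ 0ℝ
  ≤η⇒≤0 x h = mk≤ λ ε 0<ε →
    let N , p = _≤ℝ_.below (h (½ ℚ.* ε) (½-pos 0<ε)) (½ ℚ.* ε) (½-pos 0<ε)
    in N , λ n n≥ → subst (seq x n ℚ.≤_)
         (solve 1 (λ e → con ½ :* e :+ con ½ :* e := con 0ℚ :+ e) refl ε) (p n n≥)

  ≤ℝ-bounded : ∀ x → ∃ λ K → 0ℚ ℚ.< K × x ≤ℝ fromℚ K
  ≤ℝ-bounded x = let K , 0<K , N , h = eventuallyBounded x in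
    K , 0<K , mk≤ λ ε 0<ε → N , λ n n≥ → ℚ.≤-trans (p≤∣p∣ (seq x n)) (ℚ.≤-trans (h n n≥)
      (subst (ℚ._≤ K ℚ.+ ε) (ℚ.+-identityʳ K) (ℚ.+-monoʳ-≤ K (ℚ.<⇒≤ 0<ε))))

-- Bisection for the top of the spectrum.

module TopEigenvalue where

  open Naturals
  open ℚ-Order
  open ℝ-Order
  open ℝ-Archimedean
  private
    module Q  = QuadraticForms ℚ-orderedRing
    module R  = OrderedRing ℝ-orderedRing
    module RP = OrderedRingProperties ℝ-orderedRing
    module RQ = QuadraticForms ℝ-orderedRing
  open Q using () renaming (_∙_ to _∙q_)
  open RQ using () renaming (_∙_ to _∙r_)

  seq-∙ : ∀ {n} (v w : Vector ℝ n) k → seq (v ∙r w) k ≡ (λ i → seq (v i) k) ∙q (λ i → seq (w i) k)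
  seq-∙ v w k = sum-homo R.+-rawMonoid (OrderedRing.+-monoid ℚ-orderedRing) (λ x → seq x k)
    refl (λ _ _ → refl) (λ i → v i *ℝ w i)

  module _ {n} (S : Fin n → Fin n → ℚ) (S-sym : Q.Symmetric S) where

    Sᴿ : Fin n → Fin n → ℝ
    Sᴿ i j = fromℚ (S i j)

    Sᴿ-sym : RQ.Symmetric Sᴿ
    Sᴿ-sym i j = R.reflexive (cong fromℚ (S-sym i j))

    seq-form : ∀ (v : Vector ℝ n) k → seq (RQ.form Sᴿ v) k ≡ Q.form S (λ i → seq (v i) k)
    seq-form v k = trans (seq-∙ v (Sᴿ RQ.⊡ v) k)
      (Q.sum-cong λ i → cong (seq (v i) k ℚ.*_) (seq-∙ (Sᴿ i) v k))

    -- If q < p, then at the vector v with p·|v|² ≤ form S v the form of q·1 - S is also at most 0,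
    -- so ε·|v|² ≤ 0.
    crossing : ∀ {p q} → Q.NonPositiveVector (p Q.·1- S) → Q.PositiveDefinite (q Q.·1- S) → p ℚ.≤ q
    crossing {p} {q} record { vector = v ; nonZero = v≠0 ; nonPos = form≤0 }
             record { ε = ε ; c = c ; ε≰0 = ε≰0 ; 0≤c = 0≤c ; bounded = bounded } =
      decidable-stable (p ℚ.≤? q) λ p≰q →
        let vv = v ∙q v
            sv = Q.form S v
        in OrderedRing.*-pos ℚ-orderedRing ε≰0 v≠0 (0≤-x⇒x≤0 (subst (0ℚ ℚ.≤_)
          (solve 6 (λ e c p q v s →
            (c :* (q :* v :+ :- s) :+ :- (e :* v)) :+ c :* (:- (p :* v :+ :- s) :+ (p :+ :- q) :* v)
              := :- (e :* v)) refl ε c p q vv sv)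
          (+-nonNeg
            (x≤y⇒0≤y-x {ε ℚ.* vv} {c ℚ.* (q ℚ.* vv ℚ.+ ℚ.- sv)}
              (subst (λ t → ε ℚ.* vv ℚ.≤ c ℚ.* t) (Q.form-·1- q S v) (bounded v)))
            (OrderedRing.*-nonNeg ℚ-orderedRing 0≤c (+-nonNeg
              (x≤0⇒0≤-x {p ℚ.* vv ℚ.+ ℚ.- sv} (subst (ℚ._≤ 0ℚ) (Q.form-·1- p S v) form≤0))
              (OrderedRing.*-nonNeg ℚ-orderedRing (x≤y⇒0≤y-x {q} {p} (ℚ.<⇒≤ (ℚ.≰⇒> p≰q))) (Q.0≤v∙v v)))))))

    -- Certifies both ends: some Rayleigh quotient is at least `lo`, and all of them lie below
    -- `lo + width`.
    record Bracket (width : ℚ) : Set where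
      field
        lo     : ℚ
        nonPos : Q.NonPositiveVector (lo Q.·1- S)
        posDef : Q.PositiveDefinite ((lo ℚ.+ width) Q.·1- S)

    bisect : ∀ {w} → Bracket w → Bracket (½ ℚ.* w)
    bisect {w} record { lo = lo ; nonPos = nonPos ; posDef = posDef } =
      Q.definiteness decide (mid Q.·1- S) (Q.·1--sym mid S S-sym)
        (λ nonPos′ → record { lo = mid ; nonPos = nonPos′ ; posDef = subst (λ q → Q.PositiveDefinite (q Q.·1- S))
          (solve 2 (λ l w → l :+ w := l :+ con ½ :* w :+ con ½ :* w) refl lo w) posDef })
        (λ posDef′ → record { lo = lo ; nonPos = nonPos ; posDef = posDef′ })
      where
      mid = lo ℚ.+ ½ ℚ.* w
      decide : ∀ x → (x ℚ.≤ 0ℚ → Bracket (½ ℚ.* w)) → (¬ (x ℚ.≤ 0ℚ) → Bracket (½ ℚ.* w)) → Bracket (½ ℚ.* w)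
      decide x f g with x ℚ.≤? 0ℚ
      ... | yes x≤0 = f x≤0
      ... | no  x≰0 = g x≰0

    module _ {w₀ : ℚ} (0≤w₀ : 0ℚ ℚ.≤ w₀) (bracket₀ : Bracket w₀) where

      width : ℕ → ℚ
      width zero    = w₀
      width (suc k) = ½ ℚ.* width k

      bracket : ∀ k → Bracket (width k)
      bracket zero    = bracket₀
      bracket (suc k) = bisect (bracket k)

      lo : ℕ → ℚ
      lo k = Bracket.lo (bracket k)

      -- `crossing` compares any two stages directly; from this come both the Cauchy property of the
      -- lower ends and the bounds on `top`.
      lo≤hi : ∀ j k → lo j ℚ.≤ lo k ℚ.+ width k
      lo≤hi j k = crossing (Bracket.nonPos (bracket j)) (Bracket.posDef (bracket k))

      0≤width : ∀ k → 0ℚ ℚ.≤ width k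
      0≤width zero    = 0≤w₀
      0≤width (suc k) = OrderedRing.*-nonNeg ℚ-orderedRing (ℚ.<⇒≤ (ℚ.positive⁻¹ ½)) (0≤width k)

      -- Harmonic decay, from k + 2 ≤ 2(k + 1), takes the place of powers of two.
      width-bound : ∀ k → width k ℚ.* natℚ (suc k) ℚ.≤ w₀
      width-bound zero    = ℚ.≤-reflexive (trans (cong (w₀ ℚ.*_) (ℚ.+-identityʳ 1ℚ)) (ℚ.*-identityʳ w₀))
      width-bound (suc k) = ℚ.≤-trans (0≤y-x⇒x≤y (subst (0ℚ ℚ.≤_)
        (solve 2 (λ w n → con ½ :* (w :* n)
            := w :* (con 1ℚ :+ n) :+ :- (con ½ :* w :* (con 1ℚ :+ (con 1ℚ :+ n)))) refl (width k) (natℚ k))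
        (OrderedRing.*-nonNeg ℚ-orderedRing (ℚ.<⇒≤ (ℚ.positive⁻¹ ½)) (OrderedRing.*-nonNeg ℚ-orderedRing (0≤width k) (0≤natℚ k)))))
        (width-bound k)

      width-small : ∀ ε → 0ℚ ℚ.< ε → Eventually λ k → width k ℚ.≤ ε
      width-small ε 0<ε with 1/ 0<ε
      ... | ε⁻¹ , 0<ε⁻¹ , inverse with archimedean (ε⁻¹ ℚ.* w₀)
      -- Otherwise w₀ ≥ width k·(k + 1) ≥ ε·(k + 1) ≥ w₀ + ε.
      ...   | N , ε⁻¹w₀≤N = N , λ k N≤k → decidable-stable (width k ℚ.≤? ε) λ w≰ε →
        <⇒≱ 0<ε (0≤-x⇒x≤0 (subst (0ℚ ℚ.≤_)
          (trans (solve 5 (λ w₀ w e i n →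
             (w₀ :+ :- (w :* (con 1ℚ :+ n))) :+ (w :+ :- e) :* (con 1ℚ :+ n) :+ e :* (n :+ :- (i :* w₀))
               := :- e :+ (con 1ℚ :+ :- (i :* e)) :* w₀) refl w₀ (width k) ε ε⁻¹ (natℚ k))
            (trans (cong (λ t → ℚ.- ε ℚ.+ (1ℚ ℚ.+ ℚ.- t) ℚ.* w₀) inverse)
              (solve 2 (λ e w → :- e :+ (con 1ℚ :+ :- con 1ℚ) :* w := :- e) refl ε w₀)))
          (+-nonNeg
            (+-nonNeg (x≤y⇒0≤y-x {width k ℚ.* natℚ (suc k)} {w₀} (width-bound k))
              (OrderedRing.*-nonNeg ℚ-orderedRing (x≤y⇒0≤y-x {ε} {width k} (ℚ.<⇒≤ (ℚ.≰⇒> w≰ε))) (0≤natℚ (suc k))))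
            (OrderedRing.*-nonNeg ℚ-orderedRing (ℚ.<⇒≤ 0<ε)
              (x≤y⇒0≤y-x {ε⁻¹ ℚ.* w₀} {natℚ k} (ℚ.≤-trans ε⁻¹w₀≤N (natℚ-mono-≤ N≤k)))))))

      top : ℝ
      seq    top = lo
      cauchy top ε 0<ε = let N , small = width-small ε 0<ε in N , λ j k j≥ k≥ → ∣p-q∣≤ε⇐
        (ℚ.≤-trans (lo≤hi j k) (ℚ.+-monoʳ-≤ (lo k) (small k k≥)))
        (ℚ.≤-trans (lo≤hi k j) (ℚ.+-monoʳ-≤ (lo j) (small j j≥)))

      lo₀≤top : fromℚ (lo 0) ≤ℝ top
      lo₀≤top = mk≤ λ ε 0<ε → let N , small = width-small ε 0<ε in
        N , λ k k≥ → ℚ.≤-trans (lo≤hi 0 k) (ℚ.+-monoʳ-≤ (lo k) (small k k≥))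

      -- The form is nonnegative at the upper end of the bracket; moving to the lower end costs
      -- width k·|x|² ≤ width k·K ≤ ε.
      lo-form≥-ε : ∀ k x K K⁻¹ ε → 0ℚ ℚ.< K → K⁻¹ ℚ.* K ≡ 1ℚ → x ∙q x ℚ.≤ K → width k ℚ.≤ ε ℚ.* K⁻¹ →
                   0ℚ ℚ.≤ lo k ℚ.* (x ∙q x) ℚ.- Q.form S x ℚ.+ ε
      lo-form≥-ε k x K K⁻¹ ε 0<K inverse xx≤K w≤ = subst (0ℚ ℚ.≤_)
        (trans (solve 7 (λ l w x s K i e →
            (l :+ w) :* x :+ :- s :+ (w :* (K :+ :- x) :+ (e :* i :+ :- w) :* K)
              := l :* x :- s :+ e :* (i :* K)) refl (lo k) (width k) (x ∙q x) (Q.form S x) K K⁻¹ ε)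
          (cong (lo k ℚ.* (x ∙q x) ℚ.- Q.form S x ℚ.+_)
            (trans (cong (ε ℚ.*_) inverse) (ℚ.*-identityʳ ε))))
        (+-nonNeg
          (subst (0ℚ ℚ.≤_) (Q.form-·1- (lo k ℚ.+ width k) S x)
            (Q.PositiveDefinite.nonNeg (Bracket.posDef (bracket k)) x))
          (+-nonNeg
            (OrderedRing.*-nonNeg ℚ-orderedRing (0≤width k) (x≤y⇒0≤y-x {x ∙q x} {K} xx≤K))
            (OrderedRing.*-nonNeg ℚ-orderedRing (x≤y⇒0≤y-x {width k} {ε ℚ.* K⁻¹} w≤) (ℚ.<⇒≤ 0<K))))

      topOfSpectrum : RQ.TopOfSpectrum Sᴿ top
      topOfSpectrum = record
        { vector     = λ k i → fromℚ (x k i)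
        ; lower      = λ k → fromℚ (lo k)
        ; width      = λ k → fromℚ (width k)
        ; inverse    = λ k → fromℚ (proj₁ (1/ 0<xx k))
        -- The k-th terms of a real vector form a rational vector, and the k-th term of `top` is
        -- `lo k`, so the k-th bracket applies to the k-th term of the claim.
        ; form≤top   = λ v → mk≤ λ ε 0<ε →
            let K , 0<K , vv≤K = eventuallyBounded (v ∙r v)
                K⁻¹ , 0<K⁻¹ , inverse = 1/ 0<K
                N , h = ∃-both vv≤K (width-small (ε ℚ.* K⁻¹) (*-pos 0<ε 0<K⁻¹))
            in N , λ k k≥ →
              let ∣vv∣≤K , w≤ = h k k≥
              in subst (0ℚ ℚ.≤_)
                (cong₂ (λ a b → lo k ℚ.* a ℚ.- b ℚ.+ ε) (sym (seq-∙ v v k)) (sym (seq-form v k)))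
                (lo-form≥-ε k (λ i → seq (v i) k) K K⁻¹ ε 0<K inverse
                  (subst (ℚ._≤ K) (seq-∙ v v k) (ℚ.≤-trans (p≤∣p∣ (seq (v ∙r v) k)) ∣vv∣≤K)) w≤)
        ; top≤       = λ k → ≤ℝ-pointwise λ j → lo≤hi j k
        ; lower≤form = λ k → ≤ℝ-pointwise λ j →
            subst (ℚ._≤ 0ℚ) (trans (Q.form-·1- (lo k) S (x k))
              (cong₂ (λ a b → lo k ℚ.* a ℚ.- b)
                (sym (seq-∙ (λ i → fromℚ (x k i)) (λ i → fromℚ (x k i)) j))
                (sym (seq-form (λ i → fromℚ (x k i)) j))))
              (Q.NonPositiveVector.nonPos (Bracket.nonPos (bracket k)))
        ; 0≤inverse  = λ k → ≤ℝ-pointwise λ _ → ℚ.<⇒≤ (proj₁ (proj₂ (1/ 0<xx k)))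
        ; inverse-*  = λ k → ≈ℝ-pointwise λ j →
            trans (cong (proj₁ (1/ 0<xx k) ℚ.*_) (seq-∙ (λ i → fromℚ (x k i)) (λ i → fromℚ (x k i)) j))
                  (proj₂ (proj₂ (1/ 0<xx k)))
        -- The real c is first replaced by a rational bound K, so that N can be chosen with width N
        -- ≤ η/K.
        ; width→0    = λ ε c ε≤ → ≤η⇒≤0 ε λ η 0<η →
            let K , 0<K , c≤K = ≤ℝ-bounded c
                K⁻¹ , 0<K⁻¹ , inverse = 1/ 0<K
                N , w≤ = width-small (η ℚ.* K⁻¹) (*-pos 0<η 0<K⁻¹)
                w = width N
            in ≤ℝ-trans {ε} {fromℚ K *ℝ fromℚ w} {fromℚ η}
                 (≤ℝ-trans {ε} {c *ℝ fromℚ w} {fromℚ K *ℝ fromℚ w} (ε≤ N) (RP.*-monoʳ-≤ {c} {fromℚ K} {fromℚ w}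
                   (fromℚ-mono-≤ (0≤width N)) c≤K))
                 (≤ℝ-pointwise {fromℚ K *ℝ fromℚ w} {fromℚ η} λ _ → ℚ.≤-trans (*-monoˡ-≤ (ℚ.<⇒≤ 0<K) (w≤ N ℕ.≤-refl))
                   (ℚ.≤-reflexive (trans (solve 3 (λ K e i → K :* (e :* i) := e :* (i :* K)) refl K η K⁻¹)
                     (trans (cong (η ℚ.*_) inverse) (ℚ.*-identityʳ η)))))
        }
        where
        x : ℕ → Vector ℚ n
        x k = Q.NonPositiveVector.vector (Bracket.nonPos (bracket k))
        0<xx : ∀ k → 0ℚ ℚ.< x k ∙q x k
        0<xx k = ℚ.≰⇒> (Q.NonPositiveVector.nonZero (Bracket.nonPos (bracket k)))

-- The complex numbers over the Cauchy reals.

module ℂ-Complexification where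

  open ℝ-Order
  open ℚ-Order using (solve; _:=_; _:+_; _:*_; _:-_; :-_; con)

  ≈ℂ-pointwise : ∀ {z w} → (∀ n → seq (re z) n ≡ seq (re w) n) → (∀ n → seq (im z) n ≡ seq (im w) n) → z ≈ℂ w
  ≈ℂ-pointwise re≡ im≡ = mk≈ (≈ℝ-pointwise re≡) (≈ℝ-pointwise im≡)

  ≈ℂ-trans : ∀ {x y z} → x ≈ℂ y → y ≈ℂ z → x ≈ℂ z
  ≈ℂ-trans {x} {y} {z} (mk≈ p q) (mk≈ p′ q′) = mk≈ (≈ℝ-trans {re x} {re y} {re z} p p′) (≈ℝ-trans {im x} {im y} {im z} q q′)

  -ℂ_ conj : ℂ → ℂ
  -ℂ z   = (-ℝ re z) +i (-ℝ im z)
  conj z = re z +i (-ℝ im z)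

  ι : ℝ → ℂ
  ι a = a +i 0ℝ

  +-congℂ : ∀ {x y u v} → x ≈ℂ y → u ≈ℂ v → x +ℂ u ≈ℂ y +ℂ v
  +-congℂ {x} {y} {u} {v} (mk≈ p q) (mk≈ p′ q′) =
    mk≈ (+-cong-ℝ {re x} {re y} {re u} {re v} p p′) (+-cong-ℝ {im x} {im y} {im u} {im v} q q′)

  *-congℂ : ∀ {x y u v} → x ≈ℂ y → u ≈ℂ v → x *ℂ u ≈ℂ y *ℂ v
  *-congℂ {x} {y} {u} {v} (mk≈ p q) (mk≈ p′ q′) = mk≈
    (+-cong-ℝ {re x *ℝ re u} {re y *ℝ re v} { -ℝ (im x *ℝ im u)} { -ℝ (im y *ℝ im v)}
      (*-cong-ℝ {re x} {re y} {re u} {re v} p p′)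
      (neg-cong-ℝ {im x *ℝ im u} {im y *ℝ im v} (*-cong-ℝ {im x} {im y} {im u} {im v} q q′)))
    (+-cong-ℝ {re x *ℝ im u} {re y *ℝ im v} {im x *ℝ re u} {im y *ℝ re v}
      (*-cong-ℝ {re x} {re y} {im u} {im v} p q′) (*-cong-ℝ {im x} {im y} {re u} {re v} q p′))

  ℂ-commutativeRing : CommutativeRing 0ℓ 0ℓ
  ℂ-commutativeRing = record
    { Carrier = ℂ ; _≈_ = _≈ℂ_ ; _+_ = _+ℂ_ ; _*_ = _*ℂ_ ; -_ = -ℂ_ ; 0# = 0ℂ ; 1# = 1ℂ
    ; isCommutativeRing = record
      { isRing = record
        { +-isAbelianGroup = record
          { isGroup = record
            { isMonoid = record
              { isSemigroup = record
                { isMagma = record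
                  { isEquivalence = record
                    { refl = ≈ℂ-pointwise (λ _ → refl) (λ _ → refl)
                    ; sym = λ (mk≈ p q) → mk≈ (≈ℝ-sym p) (≈ℝ-sym q)
                    ; trans = ≈ℂ-trans }
                  ; ∙-cong = +-congℂ }
                ; assoc = λ x y z → ≈ℂ-pointwise
                    (λ n → ℚ.+-assoc (seq (re x) n) (seq (re y) n) (seq (re z) n))
                    (λ n → ℚ.+-assoc (seq (im x) n) (seq (im y) n) (seq (im z) n)) }
              ; identity = (λ x → ≈ℂ-pointwise (λ n → ℚ.+-identityˡ (seq (re x) n)) (λ n → ℚ.+-identityˡ (seq (im x) n)))
                         , (λ x → ≈ℂ-pointwise (λ n → ℚ.+-identityʳ (seq (re x) n)) (λ n → ℚ.+-identityʳ (seq (im x) n))) }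
            ; inverse = (λ x → ≈ℂ-pointwise (λ n → ℚ.+-inverseˡ (seq (re x) n)) (λ n → ℚ.+-inverseˡ (seq (im x) n)))
                      , (λ x → ≈ℂ-pointwise (λ n → ℚ.+-inverseʳ (seq (re x) n)) (λ n → ℚ.+-inverseʳ (seq (im x) n)))
            ; ⁻¹-cong = λ (mk≈ p q) → mk≈ (neg-cong-ℝ p) (neg-cong-ℝ q) }
          ; comm = λ x y → ≈ℂ-pointwise (λ n → ℚ.+-comm (seq (re x) n) (seq (re y) n))
                                        (λ n → ℚ.+-comm (seq (im x) n) (seq (im y) n)) }
        ; *-cong = *-congℂ
        ; *-assoc = λ x y z → ≈ℂ-pointwise
            (λ n → solve 6 (λ a b c d e f → (a :* c :- b :* d) :* e :- (a :* d :+ b :* c) :* f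
                                          := a :* (c :* e :- d :* f) :- b :* (c :* f :+ d :* e)) refl
              (seq (re x) n) (seq (im x) n) (seq (re y) n) (seq (im y) n) (seq (re z) n) (seq (im z) n))
            (λ n → solve 6 (λ a b c d e f → (a :* c :- b :* d) :* f :+ (a :* d :+ b :* c) :* e
                                          := a :* (c :* f :+ d :* e) :+ b :* (c :* e :- d :* f)) refl
              (seq (re x) n) (seq (im x) n) (seq (re y) n) (seq (im y) n) (seq (re z) n) (seq (im z) n))
        ; *-identity = (λ x → ≈ℂ-pointwise
              (λ n → solve 2 (λ a b → con 1ℚ :* a :- con 0ℚ :* b := a) refl (seq (re x) n) (seq (im x) n))
              (λ n → solve 2 (λ a b → con 1ℚ :* b :+ con 0ℚ :* a := b) refl (seq (re x) n) (seq (im x) n)))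
          , (λ x → ≈ℂ-pointwise
              (λ n → solve 2 (λ a b → a :* con 1ℚ :- b :* con 0ℚ := a) refl (seq (re x) n) (seq (im x) n))
              (λ n → solve 2 (λ a b → a :* con 0ℚ :+ b :* con 1ℚ := b) refl (seq (re x) n) (seq (im x) n)))
        ; distrib = (λ x y z → ≈ℂ-pointwise
            (λ n → solve 6 (λ a b c d e f → a :* (c :+ e) :- b :* (d :+ f)
                                          := (a :* c :- b :* d) :+ (a :* e :- b :* f)) refl
              (seq (re x) n) (seq (im x) n) (seq (re y) n) (seq (im y) n) (seq (re z) n) (seq (im z) n))
            (λ n → solve 6 (λ a b c d e f → a :* (d :+ f) :+ b :* (c :+ e)
                                          := (a :* d :+ b :* c) :+ (a :* f :+ b :* e)) refl
              (seq (re x) n) (seq (im x) n) (seq (re y) n) (seq (im y) n) (seq (re z) n) (seq (im z) n)))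
          , (λ x y z → ≈ℂ-pointwise
            (λ n → solve 6 (λ a b c d e f → (c :+ e) :* a :- (d :+ f) :* b
                                          := (c :* a :- d :* b) :+ (e :* a :- f :* b)) refl
              (seq (re x) n) (seq (im x) n) (seq (re y) n) (seq (im y) n) (seq (re z) n) (seq (im z) n))
            (λ n → solve 6 (λ a b c d e f → (c :+ e) :* b :+ (d :+ f) :* a
                                          := (c :* b :+ d :* a) :+ (e :* b :+ f :* a)) refl
              (seq (re x) n) (seq (im x) n) (seq (re y) n) (seq (im y) n) (seq (re z) n) (seq (im z) n))) }
      ; *-comm = λ x y → ≈ℂ-pointwise
          (λ n → solve 4 (λ a b c d → a :* c :- b :* d := c :* a :- d :* b) refl
            (seq (re x) n) (seq (im x) n) (seq (re y) n) (seq (im y) n))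
          (λ n → solve 4 (λ a b c d → a :* d :+ b :* c := c :* b :+ d :* a) refl
            (seq (re x) n) (seq (im x) n) (seq (re y) n) (seq (im y) n)) } }

  -- The shape with the double sign is what `re (z * conj z)` unfolds to at each index.
  0≤a²+b² : ∀ a b → 0ℚ ℚ.≤ a ℚ.* a ℚ.- b ℚ.* (ℚ.- b)
  0≤a²+b² a b = subst (0ℚ ℚ.≤_) (solve 2 (λ a b → a :* a :+ b :* b := a :* a :- b :* :- b) refl a b)
    (ℚ-Order.+-nonNeg (ℚ-Order.0≤x*x a) (ℚ-Order.0≤x*x b))

  a²≤a²+b² : ∀ a b → a ℚ.* a ℚ.≤ a ℚ.* a ℚ.- b ℚ.* (ℚ.- b)
  a²≤a²+b² a b = ℚ-Order.0≤y-x⇒x≤y (subst (0ℚ ℚ.≤_)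
    (solve 2 (λ a b → b :* b := a :* a :- b :* :- b :+ :- (a :* a)) refl a b) (ℚ-Order.0≤x*x b))

  b²≤a²+b² : ∀ a b → b ℚ.* b ℚ.≤ a ℚ.* a ℚ.- b ℚ.* (ℚ.- b)
  b²≤a²+b² a b = ℚ-Order.0≤y-x⇒x≤y (subst (0ℚ ℚ.≤_)
    (solve 2 (λ a b → a :* a := a :* a :- b :* :- b :+ :- (b :* b)) refl a b) (ℚ-Order.0≤x*x a))

  ≈ℝ-stable : ∀ {x y} → ¬ ¬ (x ≈ℝ y) → x ≈ℝ y
  ≈ℝ-stable {x} {y} ¬¬x≈y = ≤ℝ-antisym
    (≤ℝ-stable {x} {y} λ ≰ → ¬¬x≈y λ p → ≰ (≈⇒≤ p))
    (≤ℝ-stable {y} {x} λ ≰ → ¬¬x≈y λ p → ≰ (≈⇒≤ (≈ℝ-sym p)))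

  x*x≤0⇒x≈0 : ∀ x → x *ℝ x ≤ℝ 0ℝ → x ≈ℝ 0ℝ
  x*x≤0⇒x≈0 x h = OrderedRingProperties.x*x≤0⇒x≈0 ℝ-orderedRing {x} h

  ℂ-complexification : Complexification ℝ-orderedRing
  ℂ-complexification = record
    { complexRing = ℂ-commutativeRing
    ; re = re
    ; ι = ι
    ; conj = conj
    ; re-cong = _≈ℂ_.re≈
    ; re-+ = λ z w → ≈ℝ-pointwise λ _ → refl
    ; re-0 = ≈ℝ-pointwise λ _ → refl
    ; re-ι* = λ a z → ≈ℝ-pointwise λ n →
        solve 3 (λ a b c → a :* b :- con 0ℚ :* c := a :* b) refl (seq a n) (seq (re z) n) (seq (im z) n)
    ; re-1 = ≈ℝ-pointwise λ _ → refl
    ; ι-cong = λ p → mk≈ p (≈ℝ-pointwise λ _ → refl)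
    ; ι-+ = λ a b → ≈ℂ-pointwise (λ _ → refl) (λ _ → refl)
    ; ι-0 = ≈ℂ-pointwise (λ _ → refl) (λ _ → refl)
    ; ι-1 = ≈ℂ-pointwise (λ _ → refl) (λ _ → refl)
    ; ι-* = λ a b → ≈ℂ-pointwise
        (λ n → solve 2 (λ a b → a :* b := a :* b :- con 0ℚ :* con 0ℚ) refl (seq a n) (seq b n))
        (λ n → solve 2 (λ a b → con 0ℚ := a :* con 0ℚ :+ con 0ℚ :* b) refl (seq a n) (seq b n))
    ; conj-cong = λ (mk≈ p q) → mk≈ p (neg-cong-ℝ q)
    ; conj-+ = λ z w → ≈ℂ-pointwise (λ _ → refl)
        (λ n → solve 2 (λ a b → :- (a :+ b) := :- a :+ :- b) refl (seq (im z) n) (seq (im w) n))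
    ; conj-0 = ≈ℂ-pointwise (λ _ → refl) (λ _ → refl)
    ; conj-* = λ z w → ≈ℂ-pointwise
        (λ n → solve 4 (λ a b c d → a :* c :- b :* d := a :* c :- (:- b) :* (:- d)) refl
          (seq (re z) n) (seq (im z) n) (seq (re w) n) (seq (im w) n))
        (λ n → solve 4 (λ a b c d → :- (a :* d :+ b :* c) := a :* (:- d) :+ (:- b) :* c) refl
          (seq (re z) n) (seq (im z) n) (seq (re w) n) (seq (im w) n))
    ; conj-conj = λ z → ≈ℂ-pointwise (λ _ → refl) (λ n → solve 1 (λ a → :- :- a := a) refl (seq (im z) n))
    ; conj-ι = λ a → ≈ℂ-pointwise (λ _ → refl) (λ _ → refl)
    ; 0≤z*z̄ = λ z → ≤ℝ-pointwise λ n → 0≤a²+b² (seq (re z) n) (seq (im z) n)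
    ; z*z̄≤0⇒z≈0 = λ {z} h → mk≈
        (x*x≤0⇒x≈0 (re z) (≤ℝ-trans (≤ℝ-pointwise λ n → a²≤a²+b² (seq (re z) n) (seq (im z) n)) h))
        (x*x≤0⇒x≈0 (im z) (≤ℝ-trans (≤ℝ-pointwise λ n → b²≤a²+b² (seq (re z) n) (seq (im z) n)) h))
    ; z*z̄-real = λ z → ≈ℂ-pointwise (λ _ → refl)
        (λ n → solve 2 (λ a b → con 0ℚ := a :* (:- b) :+ b :* a) refl (seq (re z) n) (seq (im z) n))
    ; ≈-stable = λ {z} {w} ¬¬z≈w → mk≈
        (≈ℝ-stable {re z} {re w} λ ≉ → ¬¬z≈w λ p → ≉ (_≈ℂ_.re≈ p))
        (≈ℝ-stable {im z} {im w} λ ≉ → ¬¬z≈w λ p → ≉ (_≈ℂ_.im≈ p))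
    ; inverse = λ {x} x≰0 found → ≰0⇒¬¬Positive {x} x≰0 λ pos →
        found (recip x pos , recip-nonNeg x pos , recip-inverse x pos)
    }

-- The symmetrised convolution matrix of f.

module ConvolutionMatrix {c ℓ} (G : FiniteGroup c ℓ) (f : Func (FiniteGroup.setoid G) (setoid Sign)) where

  open FiniteGroup G hiding (refl; sym; trans; setoid)
  private module G = FiniteGroup G
  open GroupProperties group using (⁻¹-anti-homo-∙; ⁻¹-involutive)
  open QuadraticForms ℚ-orderedRing hiding (_∙_)
  open ℚ-Order using (solve; _:=_; _:+_; _:*_; _:-_; :-_; con)
  open Naturals using (natℚ)
  private module Q = QuadraticForms ℚ-orderedRing

  N : ℕ
  N = order

  index : Carrier → Fin N
  index = Inverse.to enumeration

  index-element : ∀ i → index (element i) ≡ i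
  index-element = Inverse.strictlyInverseˡ enumeration

  element-index : ∀ g → element (index g) ≈ g
  element-index = Inverse.strictlyInverseʳ enumeration

  index-cong : ∀ {g h} → g ≈ h → index g ≡ index h
  index-cong = Inverse.to-cong enumeration

  -- The inverse makes the induced action on functions the left regular representation, v(x) ↦
  -- v(g⁻¹x).
  σ : Carrier → Fin N → Fin N
  σ g x = index (g ⁻¹ ∙ element x)

  σ-cong : ∀ {g h} → g ≈ h → ∀ x → σ g x ≡ σ h x
  σ-cong g≈h x = index-cong (∙-congʳ (⁻¹-cong g≈h))

  σ-∙ : ∀ g h x → σ (g ∙ h) x ≡ σ h (σ g x)
  σ-∙ g h x = index-cong (G.trans (∙-congʳ (⁻¹-anti-homo-∙ g h))
    (G.trans (assoc (h ⁻¹) (g ⁻¹) (element x)) (∙-congˡ (G.sym (element-index _)))))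

  ε⁻¹∙ : ∀ g → ε ⁻¹ ∙ g ≈ g
  ε⁻¹∙ g = G.trans (∙-congʳ (GroupProperties.ε⁻¹≈ε group)) (identityˡ g)

  σ-ε : ∀ x → σ ε x ≡ x
  σ-ε x = trans (index-cong (ε⁻¹∙ (element x))) (index-element x)

  σ-transitive : ∀ x y → ∃ λ g → σ g x ≡ y
  σ-transitive x y = element x ∙ element y ⁻¹ , trans (index-cong (begin
    (element x ∙ element y ⁻¹) ⁻¹ ∙ element x      ≈⟨ ∙-congʳ (⁻¹-anti-homo-∙ _ _) ⟩
    (element y ⁻¹) ⁻¹ ∙ element x ⁻¹ ∙ element x   ≈⟨ assoc _ _ _ ⟩
    (element y ⁻¹) ⁻¹ ∙ (element x ⁻¹ ∙ element x) ≈⟨ ∙-cong (⁻¹-involutive _) (inverseˡ _) ⟩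
    element y ∙ ε                                  ≈⟨ identityʳ _ ⟩
    element y                                      ∎)) (index-element y)
    where open import Relation.Binary.Reasoning.Setoid G.setoid

  sum-reindex : (F : Carrier → ℚ) → (∀ {g h} → g ≈ h → F g ≡ F h) → (α β : Carrier → Carrier) →
    (∀ {g h} → g ≈ h → α g ≈ α h) → (∀ {g h} → g ≈ h → β g ≈ β h) →
    (∀ g → α (β g) ≈ g) → (∀ g → β (α g) ≈ g) →
    sum (λ i → F (α (element i))) ≡ sum (λ i → F (element i))
  sum-reindex F F-cong α β α-cong β-cong αβ βα = sym (trans
    (sum-permute (λ i → F (element i)) (permutation
      (λ i → index (α (element i))) (λ i → index (β (element i)))
      (λ i → trans (index-cong (G.trans (α-cong (element-index _)) (αβ _))) (index-element i))
      (λ i → trans (index-cong (G.trans (β-cong (element-index _)) (βα _))) (index-element i))))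
    (sum-cong {N} λ i → F-cong (element-index (α (element i)))))

  χ : Carrier → ℚ
  χ g = signℚ (f ⟨$⟩ g)

  χ-cong : ∀ {g h} → g ≈ h → χ g ≡ χ h
  χ-cong g≈h = cong signℚ (Func.cong f g≈h)

  signℚ² : ∀ s → signℚ s ℚ.* signℚ s ≡ 1ℚ
  signℚ² Sign.+ = refl
  signℚ² Sign.- = refl

  χ² : ∀ g → χ g ℚ.* χ g ≡ 1ℚ
  χ² g = signℚ² (f ⟨$⟩ g)

  S₀ S : SquareMatrix N
  S₀ x y = χ (element x ⁻¹ ∙ element y)
  S x y  = S₀ x y ℚ.+ S₀ y x

  S-sym : Symmetric S
  S-sym x y = ℚ.+-comm (S₀ x y) (S₀ y x)

  S₀-invariant : ∀ g x y → S₀ (σ g x) (σ g y) ≡ S₀ x y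
  S₀-invariant g x y = χ-cong (begin
    element (σ g x) ⁻¹ ∙ element (σ g y)
      ≈⟨ ∙-cong (⁻¹-cong (element-index _)) (element-index _) ⟩
    (g ⁻¹ ∙ element x) ⁻¹ ∙ (g ⁻¹ ∙ element y)
      ≈⟨ ∙-congʳ (G.trans (⁻¹-anti-homo-∙ _ _) (∙-congˡ (⁻¹-involutive g))) ⟩
    element x ⁻¹ ∙ g ∙ (g ⁻¹ ∙ element y)
      ≈⟨ assoc _ _ _ ⟩
    element x ⁻¹ ∙ (g ∙ (g ⁻¹ ∙ element y))
      ≈⟨ ∙-congˡ (GroupProperties.\\-leftDividesˡ group g (element y)) ⟩
    element x ⁻¹ ∙ element y ∎)
    where open import Relation.Binary.Reasoning.Setoid G.setoid

  S-invariant : ∀ g x y → S (σ g x) (σ g y) ≡ S x y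
  S-invariant g x y = cong₂ ℚ._+_ (S₀-invariant g x y) (S₀-invariant g y x)

  module _ (mean : sum (λ i → χ (element i)) ≡ 0ℚ) where

    -- For fixed x both y ↦ x⁻¹y and y ↦ y⁻¹x are bijections of G, so each half of a row sums f over
    -- the whole group.
    S-rowSum : ∀ x → sum (S x) ≡ 0ℚ
    S-rowSum x = trans (∑-distrib-+ (S₀ x) (λ y → S₀ y x)) (cong₂ ℚ._+_
      (trans (sum-reindex χ χ-cong (λ g → h ⁻¹ ∙ g) (λ g → h ∙ g) ∙-congˡ ∙-congˡ
        (GroupProperties.\\-leftDividesʳ group h) (GroupProperties.\\-leftDividesˡ group h)) mean)
      (trans (sum-reindex χ χ-cong (λ g → g ⁻¹ ∙ h) (λ g → h ∙ g ⁻¹)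
        (λ g≈g′ → ∙-congʳ (⁻¹-cong g≈g′)) (λ g≈g′ → ∙-congˡ (⁻¹-cong g≈g′)) inv₁ inv₂) mean))
      where
      h = element x
      open import Relation.Binary.Reasoning.Setoid G.setoid
      inv₁ : ∀ g → (h ∙ g ⁻¹) ⁻¹ ∙ h ≈ g
      inv₁ g = begin
        (h ∙ g ⁻¹) ⁻¹ ∙ h       ≈⟨ ∙-congʳ (⁻¹-anti-homo-∙ h (g ⁻¹)) ⟩
        (g ⁻¹) ⁻¹ ∙ h ⁻¹ ∙ h    ≈⟨ GroupProperties.//-rightDividesˡ group h ((g ⁻¹) ⁻¹) ⟩
        (g ⁻¹) ⁻¹               ≈⟨ ⁻¹-involutive g ⟩
        g                       ∎
      inv₂ : ∀ g → h ∙ (g ⁻¹ ∙ h) ⁻¹ ≈ g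
      inv₂ g = begin
        h ∙ (g ⁻¹ ∙ h) ⁻¹       ≈⟨ ∙-congˡ (⁻¹-anti-homo-∙ (g ⁻¹) h) ⟩
        h ∙ (h ⁻¹ ∙ (g ⁻¹) ⁻¹)  ≈⟨ GroupProperties.\\-leftDividesˡ group h ((g ⁻¹) ⁻¹) ⟩
        (g ⁻¹) ⁻¹               ≈⟨ ⁻¹-involutive g ⟩
        g                       ∎

  correlation : ℚ
  correlation = sum λ x → sum λ y → χ (element x) ℚ.* χ (element y) ℚ.* χ (element x ∙ element y)

  χᵛ : Vector ℚ N
  χᵛ x = χ (element x)

  -- Substituting xy for y in the inner sum turns f(x)·f(x⁻¹y)·f(y) into f(x)·f(y)·f(xy).
  form-S₀ : form S₀ χᵛ ≡ correlation
  form-S₀ = sum-cong {N} λ x → let g = element x in trans (*-distribˡ-sum (χ g) (λ y → χ (g ⁻¹ ∙ element y) ℚ.* χ (element y)))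
    (trans (sym (sum-reindex (λ h → χ g ℚ.* (χ (g ⁻¹ ∙ h) ℚ.* χ h))
        (λ h≈h′ → cong (χ g ℚ.*_) (cong₂ ℚ._*_ (χ-cong (∙-congˡ h≈h′)) (χ-cong h≈h′)))
        (λ h → g ∙ h) (λ h → g ⁻¹ ∙ h) ∙-congˡ ∙-congˡ
        (GroupProperties.\\-leftDividesˡ group g) (GroupProperties.\\-leftDividesʳ group g)))
      (sum-cong {N} λ y → let h = element y in trans
        (cong (λ z → χ g ℚ.* (z ℚ.* χ (g ∙ h))) (χ-cong (GroupProperties.\\-leftDividesʳ group g h)))
        (sym (ℚ.*-assoc (χ g) (χ h) (χ (g ∙ h))))))

  form-S : form S χᵛ ≡ correlation ℚ.+ correlation
  form-S = begin
    sum (λ x → χᵛ x ℚ.* sum (λ y → (S₀ x y ℚ.+ S₀ y x) ℚ.* χᵛ y))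
      ≡⟨ sum-cong {N} (λ x → cong (χᵛ x ℚ.*_) (trans (sum-cong {N} λ y → ℚ.*-distribʳ-+ (χᵛ y) (S₀ x y) (S₀ y x))
           (∑-distrib-+ (λ y → S₀ x y ℚ.* χᵛ y) (λ y → S₀ y x ℚ.* χᵛ y)))) ⟩
    sum (λ x → χᵛ x ℚ.* ((S₀ ⊡ χᵛ) x ℚ.+ sum (λ y → S₀ y x ℚ.* χᵛ y)))
      ≡⟨ trans (sum-cong {N} λ x → ℚ.*-distribˡ-+ (χᵛ x) ((S₀ ⊡ χᵛ) x) (sum (λ y → S₀ y x ℚ.* χᵛ y)))
           (∑-distrib-+ (λ x → χᵛ x ℚ.* (S₀ ⊡ χᵛ) x) (λ x → χᵛ x ℚ.* sum (λ y → S₀ y x ℚ.* χᵛ y))) ⟩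
    form S₀ χᵛ ℚ.+ sum (λ x → χᵛ x ℚ.* sum (λ y → S₀ y x ℚ.* χᵛ y))
      ≡⟨ cong₂ ℚ._+_ form-S₀ (trans transpose form-S₀) ⟩
    correlation ℚ.+ correlation ∎
    where
    open ≡-Reasoning
    transpose : sum (λ x → χᵛ x ℚ.* sum (λ y → S₀ y x ℚ.* χᵛ y)) ≡ form S₀ χᵛ
    transpose = begin
      sum (λ x → χᵛ x ℚ.* sum (λ y → S₀ y x ℚ.* χᵛ y))
        ≡⟨ sum-cong {N} (λ x → *-distribˡ-sum (χᵛ x) (λ y → S₀ y x ℚ.* χᵛ y)) ⟩
      sum (λ x → sum (λ y → χᵛ x ℚ.* (S₀ y x ℚ.* χᵛ y)))
        ≡⟨ ∑-comm (λ x y → χᵛ x ℚ.* (S₀ y x ℚ.* χᵛ y)) ⟩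
      sum (λ y → sum (λ x → χᵛ x ℚ.* (S₀ y x ℚ.* χᵛ y)))
        ≡⟨ sum-cong {N} (λ y → trans
             (sum-cong {N} λ x → solve 3 (λ a s b → a :* (s :* b) := b :* (s :* a)) refl (χᵛ x) (S₀ y x) (χᵛ y))
             (sym (*-distribˡ-sum (χᵛ y) (λ x → S₀ y x ℚ.* χᵛ x)))) ⟩
      form S₀ χᵛ ∎

  sum-const : ∀ n q → sum {n} (λ _ → q) ≡ natℚ n ℚ.* q
  sum-const zero    q = sym (ℚ.*-zeroˡ q)
  sum-const (suc n) q = trans (cong (q ℚ.+_) (sum-const n q))
    (solve 2 (λ n q → q :+ n :* q := (con 1ℚ :+ n) :* q) refl (natℚ n) q)

  χᵛ∙χᵛ : χᵛ Q.∙ χᵛ ≡ natℚ N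
  χᵛ∙χᵛ = trans (sum-cong {N} λ x → χ² (element x)) (trans (sum-const N 1ℚ) (ℚ.*-identityʳ (natℚ N)))

  two four : ℚ
  two  = 1ℚ ℚ.+ 1ℚ
  four = two ℚ.+ two

  ∑S² : sum (λ x → sum λ y → S x y ℚ.* S x y) ℚ.≤ natℚ N ℚ.* (natℚ N ℚ.* four)
  ∑S² = subst (sum (λ x → sum λ y → S x y ℚ.* S x y) ℚ.≤_)
    (trans (sum-cong {N} λ _ → sum-const N four) (sum-const N (natℚ N ℚ.* four)))
    (sum-mono-≤ {N} λ x → sum-mono-≤ {N} λ y → S²≤4 (S₀ x y) (S₀ y x) (χ² (element x ⁻¹ ∙ element y)) (χ² (element y ⁻¹ ∙ element x)))
    where
    -- For signs (s + t)² = 4 - (s - t)².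
    S²≤4 : ∀ s t → s ℚ.* s ≡ 1ℚ → t ℚ.* t ≡ 1ℚ → (s ℚ.+ t) ℚ.* (s ℚ.+ t) ℚ.≤ four
    S²≤4 s t s² t² = ℚ-Order.0≤y-x⇒x≤y (subst (0ℚ ℚ.≤_)
      (trans (solve 2 (λ s t → (s :- t) :* (s :- t) := (s :* s :+ t :* t) :+ (s :* s :+ t :* t) :+ :- ((s :+ t) :* (s :+ t))) refl s t)
        (cong₂ (λ a b → (a ℚ.+ b) ℚ.+ (a ℚ.+ b) ℚ.+ ℚ.- ((s ℚ.+ t) ℚ.* (s ℚ.+ t))) s² t²))
      (ℚ-Order.0≤x*x (s ℚ.- t)))

  -- Entrywise a(s + t)b ≤ a² + b², from the squares of a - sb and a - tb. The resulting bound 2N on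
  -- the spectrum is crude but only has to start the bisection.
  form-S≤ : ∀ v → form S v ℚ.≤ natℚ N ℚ.* (v Q.∙ v) ℚ.+ natℚ N ℚ.* (v Q.∙ v)
  form-S≤ v = subst (form S v ℚ.≤_) total (subst (ℚ._≤ sum (λ x → sum λ y → v x ℚ.* v x ℚ.+ v y ℚ.* v y))
    (sym (sum-cong {N} λ x → *-distribˡ-sum (v x) (λ y → S x y ℚ.* v y)))
    (sum-mono-≤ {N} λ x → sum-mono-≤ {N} λ y → entry (v x) (v y) (S₀ x y) (S₀ y x) (χ² (element x ⁻¹ ∙ element y)) (χ² (element y ⁻¹ ∙ element x))))
    where
    entry : ∀ a b s t → s ℚ.* s ≡ 1ℚ → t ℚ.* t ≡ 1ℚ → a ℚ.* ((s ℚ.+ t) ℚ.* b) ℚ.≤ a ℚ.* a ℚ.+ b ℚ.* b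
    entry a b s t s² t² = ℚ-Order.0≤y-x⇒x≤y (subst (0ℚ ℚ.≤_)
      (trans (solve 4 (λ a b s t →
          con ½ :* ((a :- s :* b) :* (a :- s :* b)) :+ con ½ :* ((a :- t :* b) :* (a :- t :* b))
            := a :* a :+ con ½ :* (s :* s :+ t :* t) :* (b :* b) :+ :- (a :* ((s :+ t) :* b))) refl a b s t)
        (trans (cong₂ (λ p q → a ℚ.* a ℚ.+ ½ ℚ.* (p ℚ.+ q) ℚ.* (b ℚ.* b) ℚ.+ ℚ.- (a ℚ.* ((s ℚ.+ t) ℚ.* b))) s² t²)
          (cong (λ z → a ℚ.* a ℚ.+ z ℚ.+ ℚ.- (a ℚ.* ((s ℚ.+ t) ℚ.* b))) (ℚ.*-identityˡ (b ℚ.* b)))))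
      (ℚ-Order.+-nonNeg
        (OrderedRing.*-nonNeg ℚ-orderedRing (ℚ.<⇒≤ (ℚ.positive⁻¹ ½)) (ℚ-Order.0≤x*x (a ℚ.- s ℚ.* b)))
        (OrderedRing.*-nonNeg ℚ-orderedRing (ℚ.<⇒≤ (ℚ.positive⁻¹ ½)) (ℚ-Order.0≤x*x (a ℚ.- t ℚ.* b)))))
    total : sum (λ x → sum λ y → v x ℚ.* v x ℚ.+ v y ℚ.* v y) ≡ natℚ N ℚ.* (v Q.∙ v) ℚ.+ natℚ N ℚ.* (v Q.∙ v)
    total = trans (sum-cong {N} λ x → trans (∑-distrib-+ (λ _ → v x ℚ.* v x) (λ y → v y ℚ.* v y))
        (cong (ℚ._+ v Q.∙ v) (sum-const N (v x ℚ.* v x))))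
      (trans (∑-distrib-+ (λ x → natℚ N ℚ.* (v x ℚ.* v x)) (λ _ → v Q.∙ v))
        (cong₂ ℚ._+_ (sym (*-distribˡ-sum (natℚ N) (λ x → v x ℚ.* v x))) (sum-const N (v Q.∙ v))))

  -- Between the Rayleigh quotient q of χ and the bound 2N on the form of S, plus one.
  bracket : ∀ q → 0ℚ ℚ.≤ q → 0ℚ ℚ.< natℚ N → q ℚ.* natℚ N ≡ correlation ℚ.+ correlation →
            TopEigenvalue.Bracket S S-sym (natℚ N ℚ.+ natℚ N ℚ.+ 1ℚ)
  bracket q 0≤q 0<N qN = record
    { lo     = q
    ; nonPos = record
      { vector  = χᵛ
      ; nonZero = λ h → <⇒≱ 0<N (subst (ℚ._≤ 0ℚ) χᵛ∙χᵛ h)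
      ; nonPos  = ℚ.≤-reflexive (trans (form-·1- q S χᵛ) (trans
          (cong₂ (λ a b → a ℚ.+ ℚ.- b) (trans (cong (q ℚ.*_) χᵛ∙χᵛ) qN) form-S)
          (ℚ.+-inverseʳ (correlation ℚ.+ correlation))))
      }
    ; posDef = record
      { ε       = 1ℚ
      ; c       = 1ℚ
      ; ε≰0     = OrderedRing.1≰0 ℚ-orderedRing
      ; 0≤c     = ℚ.<⇒≤ (ℚ.positive⁻¹ 1ℚ)
      ; nonNeg  = λ v → ℚ.≤-trans (0≤v∙v v) (v∙v≤form v)
      ; bounded = λ v → ℚ-Order.*-monoˡ-≤ (ℚ.<⇒≤ (ℚ.positive⁻¹ 1ℚ)) (v∙v≤form v)
      }
    }
    where
    hi = q ℚ.+ (natℚ N ℚ.+ natℚ N ℚ.+ 1ℚ)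
    v∙v≤form : ∀ v → v Q.∙ v ℚ.≤ form (hi ·1- S) v
    v∙v≤form v = subst (v Q.∙ v ℚ.≤_) (sym (form-·1- hi S v)) (ℚ-Order.0≤y-x⇒x≤y (subst (0ℚ ℚ.≤_)
      (solve 4 (λ q n v s → (n :* v :+ n :* v :+ :- s) :+ q :* v := (q :+ (n :+ n :+ con 1ℚ)) :* v :+ :- s :+ :- v)
        refl q (natℚ N) (v Q.∙ v) (form S v))
      (ℚ-Order.+-nonNeg (ℚ-Order.x≤y⇒0≤y-x (form-S≤ v)) (OrderedRing.*-nonNeg ℚ-orderedRing 0≤q (0≤v∙v v)))))

-- Rational approximations of √d.

module SquareRoots where

  open Naturals
  open ℚ-Order

  natℚ-+ : ∀ m n → natℚ (m ℕ.+ n) ≡ natℚ m ℚ.+ natℚ n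
  natℚ-+ zero    n = sym (ℚ.+-identityˡ (natℚ n))
  natℚ-+ (suc m) n = trans (cong (1ℚ ℚ.+_) (natℚ-+ m n)) (sym (ℚ.+-assoc 1ℚ (natℚ m) (natℚ n)))

  natℚ-* : ∀ m n → natℚ (m ℕ.* n) ≡ natℚ m ℚ.* natℚ n
  natℚ-* zero    n = sym (ℚ.*-zeroˡ (natℚ n))
  natℚ-* (suc m) n = trans (natℚ-+ n (m ℕ.* n)) (trans (cong (natℚ n ℚ.+_) (natℚ-* m n))
    (solve 2 (λ m n → n :+ m :* n := (con 1ℚ :+ m) :* n) refl (natℚ m) (natℚ n)))

  /-* : ∀ r n .{{_ : NonZero n}} → (+ r ℚ./ n) ℚ.* natℚ n ≡ natℚ r
  /-* r n@(suc m) = trans (cong ((+ r ℚ./ n) ℚ.*_) (sym (n/1≡natℚ n))) (trans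
    (ℚ.toℚᵘ-injective
      (ℚᵘ.≃-trans (ℚ.toℚᵘ-homo-* (+ r ℚ./ n) (+ n ℚ./ 1))
      (ℚᵘ.≃-trans (ℚᵘ.*-cong (ℚ.toℚᵘ-fromℚᵘ (mkℚᵘ (+ r) m)) (ℚ.toℚᵘ-fromℚᵘ (mkℚᵘ (+ n) 0)))
      (ℚᵘ.≃-trans {j = mkℚᵘ (+ r) 0} (ℚᵘ.*≡* {mkℚᵘ (+ r) m ℚᵘ.* mkℚᵘ (+ n) 0} {mkℚᵘ (+ r) 0}
        (ℤ.*-assoc (+ r) (+ n) (+ 1)))
      (ℚᵘ.≃-sym (ℚ.toℚᵘ-fromℚᵘ (mkℚᵘ (+ r) 0)))))))
    (n/1≡natℚ r))

  0<natℚ : ∀ n → 0ℚ ℚ.< natℚ (suc n)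
  0<natℚ n = ℚ.<-≤-trans (ℚ.positive⁻¹ 1ℚ) (subst (ℚ._≤ natℚ (suc n)) (ℚ.+-identityʳ 1ℚ) (ℚ.+-monoʳ-≤ 1ℚ (0≤natℚ n)))

  x*x≤1⇒x≤1 : ∀ x → x ℚ.* x ℚ.≤ 1ℚ → x ℚ.≤ 1ℚ
  x*x≤1⇒x≤1 x h = decidable-stable (x ℚ.≤? 1ℚ) λ x≰1 →
    let 1<x = ℚ.≰⇒> x≰1
        0<x-1 = ℚ.≰⇒> λ x-1≤0 → x≰1 (0≤y-x⇒x≤y (subst (0ℚ ℚ.≤_) (solve 1 (λ x → :- (x :- con 1ℚ) := con 1ℚ :+ :- x) refl x) (x≤0⇒0≤-x x-1≤0)))
    in <⇒≱ (*-pos 0<x-1 0<x-1) (0≤-x⇒x≤0 (subst (0ℚ ℚ.≤_)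
         (solve 1 (λ x → (con 1ℚ :+ :- (x :* x)) :+ ((x :- con 1ℚ) :+ (x :- con 1ℚ)) := :- ((x :- con 1ℚ) :* (x :- con 1ℚ))) refl x)
         (+-nonNeg (x≤y⇒0≤y-x h) (+-nonNeg (ℚ.<⇒≤ 0<x-1) (ℚ.<⇒≤ 0<x-1)))))

  -- The approximations are rounded down, so they never exceed √d. This is what allows the final
  -- inequality to hold at every index.
  √-approx² : ∀ d k → √-approx d k ℚ.* √-approx d k ℚ.≤ natℚ d
  √-approx² d k = 0≤y-x⇒x≤y (*-cancel-nonNeg {natℚ M ℚ.* natℚ M} (<⇒≱ (*-pos (0<natℚ k) (0<natℚ k)))
    (subst (0ℚ ℚ.≤_) (trans
        (cong (λ z → natℚ d ℚ.* (natℚ M ℚ.* natℚ M) ℚ.+ ℚ.- (z ℚ.* z)) (sym (/-* r M)))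
        (solve 3 (λ d m s → d :* (m :* m) :+ :- (s :* m :* (s :* m)) := m :* m :* (d :+ :- (s :* s))) refl (natℚ d) (natℚ M) s))
      (x≤y⇒0≤y-x (subst₂ ℚ._≤_ (natℚ-* r r) (trans (natℚ-* d (M ℕ.* M)) (cong (natℚ d ℚ.*_) (natℚ-* M M)))
        (natℚ-mono-≤ (isqrt-lower (d ℕ.* (M ℕ.* M))))))))
    where
    M = suc k
    r = isqrt (d ℕ.* (M ℕ.* M))
    s = √-approx d k

  √-approx-pos : ∀ d .{{_ : NonZero d}} k → 0ℚ ℚ.< √-approx d k
  √-approx-pos d@(suc _) k = ℚ.<-≤-trans (ℚ.positive⁻¹ 1ℚ) (proj₂ (Positiveℝ.eventually (√-positive d)) k ℕ.z≤n)

  p≤invℚ : ∀ {p s} → 0ℚ ℚ.< s → p ℚ.* s ℚ.≤ 1ℚ → p ℚ.≤ invℚ s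
  p≤invℚ {p} {s} 0<s ps≤1 = subst₂ ℚ._≤_
    (trans (solve 3 (λ p s i → i :* (p :* s) := p :* (i :* s)) refl p s (invℚ s))
      (trans (cong (p ℚ.*_) (invℚ-inverse 0<s)) (ℚ.*-identityʳ p)))
    (ℚ.*-identityʳ (invℚ s))
    (*-monoˡ-≤ (invℚ-nonNeg 0<s) ps≤1)

  -- For p > 0, (p·s)² ≤ d·p² ≤ 1. For p ≤ 0 the right side is nonnegative anyway, so the spectral
  -- bound is called upon for positive p alone.
  p²≤1/s²⇒p≤invℚ : ∀ {d p s} → 0ℚ ℚ.< s → s ℚ.* s ℚ.≤ natℚ d → (0ℚ ℚ.< p → natℚ d ℚ.* (p ℚ.* p) ℚ.≤ 1ℚ) → p ℚ.≤ invℚ s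
  p²≤1/s²⇒p≤invℚ {d} {p} {s} 0<s s²≤d h with p ℚ.≤? 0ℚ
  ... | yes p≤0 = ℚ.≤-trans p≤0 (invℚ-nonNeg 0<s)
  ... | no  p≰0 = p≤invℚ 0<s (x*x≤1⇒x≤1 (p ℚ.* s) (ℚ.≤-trans
      (subst₂ ℚ._≤_ (solve 2 (λ p s → p :* p :* (s :* s) := p :* s :* (p :* s)) refl p s)
        (ℚ.*-comm (p ℚ.* p) (natℚ d)) (*-monoˡ-≤ (0≤x*x p) s²≤d))
      (h (ℚ.≰⇒> p≰0))))

-- Minimality of d as a refutation of smaller irreducibles.

module Irreps {c ℓ} (G : FiniteGroup c ℓ) where

  private module G = FiniteGroup G
  open ℂ-Complexification

  toLinearSubspace : ∀ {n} → Subspace n → LinearSubspace ℂ-commutativeRing n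
  toLinearSubspace W = record { _∈ = _∈W ; resp = resp ; 0-closed = 0-closed ; +-closed = +-closed ; *-closed = *-closed }
    where open Subspace W

  module _ (σ : G.Carrier → Fin G.order → Fin G.order)
    (σ-cong : ∀ {g h} → g G.≈ h → ∀ x → σ g x ≡ σ h x)
    (σ-∙ : ∀ g h x → σ (g G.∙ h) x ≡ σ h (σ g x))
    (σ-ε : ∀ x → σ G.ε x ≡ x) where

    open PermutationAction ℂ-complexification G.group σ σ-cong σ-∙ σ-ε using (NoNontrivialIrrepBelow)

    noNontrivialIrrepBelow : ∀ {d} → (∀ n → IsNontrivialIrrepDim G n → d ℕ.≤ n) → NoNontrivialIrrepBelow d
    noNontrivialIrrepBelow minimal k k<d ρ ρ-cong ρ-∙ ρ-ε irreducible nontrivial =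
      ℕ.<⇒≱ k<d (minimal k
        ( record
          { ρ = ρ
          ; isHomomorphism = record
            { isMagmaHomomorphism = record
              { isRelHomomorphism = record { cong = ρ-cong }
              ; homo = ρ-∙ }
            ; ε-homo = ρ-ε } }
        -- Rebuilds a relevant `NonZero k` from the irrelevant instance argument.
        , (ℕ.≢-nonZero (ℕ.≢-nonZero⁻¹ k) , λ (W , invariant , nonZero , proper) →
            irreducible (toLinearSubspace W) invariant nonZero proper)
        , nontrivial ))

-- The probability, the correlation and its bound.

module Correlation {c ℓ} (G : FiniteGroup c ℓ) (f : Func (FiniteGroup.setoid G) (setoid Sign)) where

  open FiniteGroup G using (_∙_; element; order-nonZero)
  open ConvolutionMatrix G f
  open Naturals
  open SquareRoots
  open ℚ-Order using (solve; _:=_; _:+_; _:*_; _:-_; :-_; con)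
  open QuadraticForms ℚ-orderedRing using (sum; sum-cong; ∑-linear; *-distribʳ-sum)

  -- `bias` is Φ, the mean of f(x)·f(y)·f(xy) over all pairs.
  n 1/n bias : ℚ
  n    = natℚ N
  1/n  = + 1 ℚ./ N
  bias = correlation ℚ.* (1/n ℚ.* 1/n)

  1/n*n : 1/n ℚ.* n ≡ 1ℚ
  1/n*n = trans (/-* 1 N) (ℚ.+-identityʳ 1ℚ)

  0<n : 0ℚ ℚ.< n
  0<n with N in eq | order-nonZero
  ... | suc m | _ = 0<natℚ m

  bias*n² : bias ℚ.* (n ℚ.* n) ≡ correlation
  bias*n² = trans (solve 3 (λ c i n → c :* (i :* i) :* (n :* n) := c :* ((i :* n) :* (i :* n))) refl correlation 1/n n)
    (trans (cong (λ z → correlation ℚ.* (z ℚ.* z)) 1/n*n) (ℚ.*-identityʳ correlation))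

  mean-zero : 𝔼 G (λ x → signℚ (f ⟨$⟩ x)) ≡ 0ℚ → sum (λ i → χ (element i)) ≡ 0ℚ
  mean-zero mean = trans (sym (ℚ.*-identityʳ Σχ)) (trans (cong (Σχ ℚ.*_) (sym 1/n*n))
    (trans (sym (ℚ.*-assoc Σχ 1/n n)) (trans (cong (ℚ._* n) mean) (ℚ.*-zeroˡ n))))
    where Σχ = sum λ i → χ (element i)

  -- For signs, st = u exactly when stu = 1. The right side has the shape that `∑-linear` sums.
  indicator : ∀ s t u → (if does ((s * t) ≟ u) then 1ℚ else 0ℚ) ≡
              ½ ℚ.* 1ℚ ℚ.+ ½ ℚ.* (signℚ s ℚ.* signℚ t ℚ.* signℚ u)
  indicator Sign.+ Sign.+ Sign.+ = refl
  indicator Sign.+ Sign.+ Sign.- = refl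
  indicator Sign.+ Sign.- Sign.+ = refl
  indicator Sign.+ Sign.- Sign.- = refl
  indicator Sign.- Sign.+ Sign.+ = refl
  indicator Sign.- Sign.+ Sign.- = refl
  indicator Sign.- Sign.- Sign.+ = refl
  indicator Sign.- Sign.- Sign.- = refl

  Pr≡½[1+bias] : Pr G (λ x y → ((f ⟨$⟩ x) * (f ⟨$⟩ y)) ≟ (f ⟨$⟩ (x ∙ y))) ≡ ½ ℚ.* (1ℚ ℚ.+ bias)
  Pr≡½[1+bias] = begin
    sum (λ x → sum (λ y → ind x y) ℚ.* 1/n) ℚ.* 1/n
      ≡⟨ cong (ℚ._* 1/n) (*-distribʳ-sum 1/n (λ x → sum (λ y → ind x y))) ⟨
    sum (λ x → sum (λ y → ind x y)) ℚ.* 1/n ℚ.* 1/n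
      ≡⟨ cong (λ z → z ℚ.* 1/n ℚ.* 1/n) (trans (sum-cong {N} inner)
           (trans (∑-linear ½ ½ (λ _ → n ℚ.* 1ℚ) (λ x → sum (τ x)))
             (cong (λ z → ½ ℚ.* z ℚ.+ ½ ℚ.* correlation) (sum-const N (n ℚ.* 1ℚ))))) ⟩
    (½ ℚ.* (n ℚ.* (n ℚ.* 1ℚ)) ℚ.+ ½ ℚ.* correlation) ℚ.* 1/n ℚ.* 1/n
      ≡⟨ solve 3 (λ n c i → (con ½ :* (n :* (n :* con 1ℚ)) :+ con ½ :* c) :* i :* i
           := con ½ :* ((i :* n) :* (i :* n) :+ c :* (i :* i))) refl n correlation 1/n ⟩
    ½ ℚ.* (1/n ℚ.* n ℚ.* (1/n ℚ.* n) ℚ.+ bias)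
      ≡⟨ cong (λ z → ½ ℚ.* (z ℚ.* z ℚ.+ bias)) 1/n*n ⟩
    ½ ℚ.* (1ℚ ℚ.+ bias) ∎
    where
    open ≡-Reasoning
    ind τ : Fin N → Fin N → ℚ
    ind x y = if does (((f ⟨$⟩ element x) * (f ⟨$⟩ element y)) ≟ (f ⟨$⟩ (element x ∙ element y))) then 1ℚ else 0ℚ
    τ x y   = χ (element x) ℚ.* χ (element y) ℚ.* χ (element x ∙ element y)
    inner : ∀ x → sum (ind x) ≡ ½ ℚ.* (n ℚ.* 1ℚ) ℚ.+ ½ ℚ.* sum (τ x)
    inner x = trans (sum-cong {N} λ y → indicator (f ⟨$⟩ element x) (f ⟨$⟩ element y) (f ⟨$⟩ (element x ∙ element y)))
      (trans (∑-linear ½ ½ (λ _ → 1ℚ) (τ x)) (cong (λ z → ½ ℚ.* z ℚ.+ ½ ℚ.* sum (τ x)) (sum-const N 1ℚ)))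

  module _ (mean : 𝔼 G (λ x → signℚ (f ⟨$⟩ x)) ≡ 0ℚ) (d : ℕ)
    (minimal : ∀ n → IsNontrivialIrrepDim G n → d ℕ.≤ n) (0<bias : 0ℚ ℚ.< bias) where

    open ℝ-Order
    open ℚ-Order using (*-pos; +-nonNeg; 0≤x*x; 0≤y-x⇒x≤y; x≤y⇒0≤y-x; 0≤-x⇒x≤0)
    open ℂ-Complexification using (ℂ-complexification)
    private
      module R = OrderedRing ℝ-orderedRing
      module RQ = QuadraticForms ℝ-orderedRing
      module T = TopEigenvalue

    quotient : ℚ
    quotient = (bias ℚ.+ bias) ℚ.* n

    0<quotient : 0ℚ ℚ.< quotient
    0<quotient = *-pos (ℚ.+-mono-< 0<bias 0<bias) 0<n

    quotient*n : quotient ℚ.* n ≡ correlation ℚ.+ correlation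
    quotient*n = trans (solve 2 (λ b n → (b :+ b) :* n :* n := b :* (n :* n) :+ b :* (n :* n)) refl bias n)
      (cong₂ ℚ._+_ bias*n² bias*n²)

    0≤width : 0ℚ ℚ.≤ n ℚ.+ n ℚ.+ 1ℚ
    0≤width = +-nonNeg (+-nonNeg (ℚ.<⇒≤ 0<n) (ℚ.<⇒≤ 0<n)) (ℚ.<⇒≤ (ℚ.positive⁻¹ 1ℚ))

    bracket₀ : T.Bracket S S-sym (n ℚ.+ n ℚ.+ 1ℚ)
    bracket₀ = bracket quotient (ℚ.<⇒≤ 0<quotient) 0<n quotient*n

    top : ℝ
    top = T.top S S-sym 0≤width bracket₀

    quotient≤top : fromℚ quotient ≤ℝ top
    quotient≤top = T.lo₀≤top S S-sym 0≤width bracket₀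

    Sᴿ : Fin N → Fin N → ℝ
    Sᴿ = T.Sᴿ S S-sym

    open PermutationAction ℂ-complexification (FiniteGroup.group G) σ σ-cong σ-∙ σ-ε
      using (¬topOfSpectrum)

    seq-sum : ∀ {m} (v : Fin m → ℝ) k → seq (RQ.sum v) k ≡ sum (λ i → seq (v i) k)
    seq-sum v k = sum-homo R.+-rawMonoid (OrderedRing.+-monoid ℚ-orderedRing) (λ x → seq x k) refl (λ _ _ → refl) v

    -- A real sum of embedded rationals is a constant sequence without being literally `fromℚ` of
    -- its value; the two equations supply that value.
    ≤ℝ⇒≤ : ∀ {x y p q} → x ≤ℝ y → (∀ k → seq x k ≡ p) → (∀ k → seq y k ≡ q) → p ℚ.≤ q
    ≤ℝ⇒≤ {x} {y} {p} {q} (mk≤ h) x≡p y≡q = fromℚ-cancel-≤ (mk≤ λ ε 0<ε → let M , b = h ε 0<ε in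
      M , λ k k≥ → subst₂ (λ u v → u ℚ.≤ v ℚ.+ ε) (x≡p k) (y≡q k) (b k k≥))

    -- With q = 2Φn, the chain d·q² ≤ ∑S² ≤ 4n² says (dΦ² - 1)·4n² ≤ 0, a product of two positive
    -- factors.
    large : ¬ (natℚ d ℚ.* (bias ℚ.* bias) ℚ.≤ 1ℚ) →
            ¬ (RQ.sum {d} (λ _ → fromℚ quotient R.* fromℚ quotient) R.≤ RQ.sum (λ x → RQ.sum λ y → Sᴿ x y R.* Sᴿ x y))
    large d*bias²>1 h = *-cancel
      where
      dq²≤ : natℚ d ℚ.* (quotient ℚ.* quotient) ℚ.≤ sum (λ x → sum λ y → S x y ℚ.* S x y)
      dq²≤ = ≤ℝ⇒≤ h
        (λ k → trans (seq-sum {d} (λ _ → fromℚ quotient *ℝ fromℚ quotient) k) (sum-const d (quotient ℚ.* quotient)))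
        (λ k → trans (seq-sum (λ x → RQ.sum λ y → Sᴿ x y R.* Sᴿ x y) k)
          (sum-cong {N} λ x → seq-sum (λ y → Sᴿ x y R.* Sᴿ x y) k))
      *-cancel : ⊥
      *-cancel = OrderedRing.*-pos ℚ-orderedRing
        {natℚ d ℚ.* (bias ℚ.* bias) ℚ.- 1ℚ} {n ℚ.* (n ℚ.* four)}
        (λ le → d*bias²>1 (0≤y-x⇒x≤y (subst (0ℚ ℚ.≤_)
          (solve 1 (λ x → :- (x :- con 1ℚ) := con 1ℚ :+ :- x) refl (natℚ d ℚ.* (bias ℚ.* bias))) (ℚ-Order.x≤0⇒0≤-x le))))
        (<⇒≱ (*-pos 0<n (*-pos 0<n (ℚ.positive⁻¹ four))))
        (0≤-x⇒x≤0 (subst (0ℚ ℚ.≤_)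
          (solve 3 (λ d b n → n :* (n :* con four) :+ :- (d :* ((b :+ b) :* n :* ((b :+ b) :* n)))
             := :- ((d :* (b :* b) :- con 1ℚ) :* (n :* (n :* con four)))) refl (natℚ d) bias n)
          (x≤y⇒0≤y-x (ℚ.≤-trans dq²≤ ∑S²))))

    bias-bound : natℚ d ℚ.* (bias ℚ.* bias) ℚ.≤ 1ℚ
    bias-bound = decidable-stable (_ ℚ.≤? 1ℚ) λ ≰1 →
      ¬topOfSpectrum Sᴿ top (T.Sᴿ-sym S S-sym) (T.topOfSpectrum S S-sym 0≤width bracket₀)
        (λ g x y → cong fromℚ (S-invariant g x y)) σ-transitive
        (λ x → ≈ℝ-pointwise λ k → trans (seq-sum (Sᴿ x) k) (S-rowSum (mean-zero mean) x))
        d (Irreps.noNontrivialIrrepBelow G σ σ-cong σ-∙ σ-ε minimal)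
        (fromℚ quotient) quotient≤top (λ q≤0 → <⇒≱ 0<quotient (fromℚ-cancel-≤ q≤0)) (large ≰1)

theorem1 : ∀ {c ℓ} (G : FiniteGroup c ℓ)
    (f : Func (FiniteGroup.setoid G) (setoid Sign)) →
    𝔼 G (λ x → signℚ (f ⟨$⟩ x)) ≡ 0ℚ →
    (d : ℕ) .{{_ : NonZero d}} → IsMinNontrivialIrrepDim G d →
    let open FiniteGroup G using (_∙_) in
    fromℚ (Pr G (λ x y → ((f ⟨$⟩ x) * (f ⟨$⟩ y)) ≟ (f ⟨$⟩ (x ∙ y)))) ≤ℝ fromℚ ½ *ℝ (1ℝ +ℝ 1/√ d)
-- The left side is a constant sequence, and Φ ≤ 1/s for each approximation s of √d, so the
-- inequality is checked term by term with no error ε.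
theorem1 G f mean d (_ , minimal) = ℝ-Order.≤ℝ-pointwise λ k →
  ℚ.≤-trans (ℚ.≤-reflexive Pr≡½[1+bias]) (ℚ-Order.*-monoˡ-≤ (ℚ.<⇒≤ (ℚ.positive⁻¹ ½))
    (ℚ.+-monoʳ-≤ 1ℚ (p²≤1/s²⇒p≤invℚ {d} {bias} (√-approx-pos d k) (√-approx² d k) (bias-bound mean d minimal))))
  where
  open Correlation G f
  open SquareRoots
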